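{- Let $v$ be a packed word of length $n$. Then the expansion of $U_v(t)=(\sigma_1^t)_n*\mathbf{N}_v$ on the basis $(\mathbf{K}_x)$ of $\mathbf{WQSym}^*_n$ is $$U_v(t)=\sum_{x\in\mathrm{WRef}(v)}c_{m(v,x)}(t)\,\mathbf{K}_x,$$ where $m(v,x)$ is the refinement word of the pair $(v,x)$ and $c_m(t)$ denotes the $t$-Goldberg coefficient of the packed word $m$.
   Context: $\mathbb{K}$ is a field of characteristic $0$, $t$ an indeterminate. A word over the positive integers is packed if its set of letters is $\{1,\dots,r\}$ for some $r$; then $r=\max(u)$. For a word $w$ over a totally ordered alphabet with distinct letters $b_1<\dots<b_r$, $\mathrm{pack}(w)$ is obtained by replacing each $b_i$ by $i$. For packed words $v,x$ of length $n$, $x$ is a weak refinement of $v$, written $x\in\mathrm{WRef}(v)$, if $x_i=x_j\Rightarrow v_i=v_j$ for all $i,j$. In that case the refinement word $m(v,x)$ is the word of length $\max(x)$ whose $i$-th letter is $v_j$ for any $j$ with $x_j=i$. (Example: $m(12113,41223)=2131$.) $\mathbf{WQSym}^*_n$ is the $\mathbb{K}$-vector space with basis $\mathbf{N}_u$, $u$ running over packed words of length $n$, with internal product $\mathbf{N}_u*\mathbf{N}_v=\mathbf{N}_{\mathrm{pack}\binom{u}{v}}$, where $\binom{u}{v}$ is the word of biletters $\binom{u_1}{v_1}\cdots\binom{u_n}{v_n}$, ordered lexicographically with priority to the top letter; scalars are extended to $\mathbb{K}[t]$. The degree $n$ component of $\sigma_1^t$ is $$(\sigma_1^t)_n=\sum_{|u|=n}\binom{t}{\max(u)}\mathbf{N}_u=\sum_{k=1}^n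 t^kE_n^{[k]},$$ the first sum being over all packed words of length $n$; the second equality defines $E_n^{[k]}$. For a packed word $u$ of length $n$, $\mathbf{K}_u:=\mathbf{N}_u*E_n^{[\max(u)]}$; the $\mathbf{K}_u$ form a basis of $\mathbf{WQSym}^*_n$. The $t$-Goldberg coefficients $c_u(t)$, $u$ packed, are the polynomials defined by $(e^{a_1}e^{a_2}\cdots)^t=\sum_u c_u(t)\mathbf{M}_u(A)$, where $a_1,a_2,\dots$ are noncommuting variables, $g=e^{a_1}e^{a_2}\cdots$ is viewed as a formal series of words, $g^t=\sum_{k\ge 0}\binom{t}{k}(g-1)^k$, and $\mathbf{M}_u(A)=\sum_{\mathrm{pack}(w)=u}w$ (so $c_u(t)$ is the coefficient in $g^t$ of any word $w$ with $\mathrm{pack}(w)=u$). -}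

module Defs where

open import Algebra.Apartness.Bundles using (HeytingField; module HeytingCommutativeRing)
open import Algebra.Bundles using (CommutativeRing)
open import Algebra.Bundles.Raw using (RawRing)
import Algebra.Definitions.RawMonoid as RawMonoidDefs
open import Data.Bool.Base using (if_then_else_)
open import Data.Fin.Base as Fin using (Fin; toℕ; fromℕ<; punchOut)
import Data.Fin.Properties as Fin
open import Data.List.Base as List
  using (List; []; _∷_; length; filter; deduplicate; mapMaybe; cartesianProductWith; upTo; take; drop)
open import Data.List.Extrema.Nat using (max; max≤v⁺; xs≤max)
open import Data.List.Membership.Propositional.Properties
  using (∈-cartesianProductWith⁺; ∈-map⁺; ∈-upTo⁺; ∈-upTo⁻; ∈-lookup)
import Data.List.Properties as List
open import Data.List.Properties using (filter-notAll)
open import Data.List.Relation.Unary.All as All using (All; []; _∷_)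
import Data.List.Relation.Unary.All.Properties as All
open import Data.List.Relation.Unary.AllPairs using ([]; _∷_)
open import Data.List.Relation.Unary.Any as Any using (Any; here; there)
import Data.List.Relation.Unary.Any.Properties as Any
import Data.List.Relation.Unary.Unique.DecSetoid.Properties as UniqueDecSetoid
open import Data.List.Relation.Unary.Unique.Propositional using (Unique)
import Data.List.Relation.Unary.Unique.Propositional.Properties as Unique
import Data.List.Relation.Unary.Unique.Setoid as UniqueSetoid
open import Data.Maybe.Base as Maybe using (Maybe; just; nothing)
open import Data.Nat.Base as ℕ using (ℕ; zero; suc; _≤_; _<_; _!; s≤s; z≤n)
import Data.Nat.Properties as ℕ
open import Data.Product.Base using (∃-syntax; _×_; _,_; proj₁; proj₂)
open import Data.Product.Relation.Binary.Lex.Strict using (×-strictTotalOrder)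
open import Data.Sum.Base using (inj₁; inj₂)
open import Data.Vec.Base as Vec using (Vec; []; _∷_; lookup; tabulate; toList)
open import Data.Vec.Membership.DecPropositional ℕ._≟_ using (_∈_; _∈?_)
import Data.Vec.Membership.Propositional.Properties as VecMem
import Data.Vec.Properties as Vec
import Data.Vec.Relation.Unary.Any as VecAny
import Data.Vec.Relation.Unary.Any.Properties as VecAny
open import Function.Base using (_∘_)
open import Function.Bundles using (_⇔_; mk⇔; Equivalence)
open import Level using (0ℓ; _⊔_)
open import Relation.Binary.Bundles using (StrictTotalOrder)
open import Relation.Binary.Definitions using (tri<; tri≈; tri>)
open import Relation.Binary.PropositionalEquality
  using (_≡_; _≢_; refl; sym; trans; cong; cong₂; subst)
open import Relation.Nullary using (Dec; yes; no; does; contradiction; map′; recompute)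
open import Relation.Nullary.Decidable using (_×-dec_; _→-dec_; dec⇒maybe; dec-false)

open Equivalence using (to; from)

Packed : ∀ {n} → Vec ℕ n → Set
Packed u = ∃[ r ] ∀ a → (a ∈ u) ⇔ (1 ≤ a × a ≤ r)

maxLetter : ∀ {n} → Vec ℕ n → ℕ
maxLetter u = max 0 (toList u)

∈⇒≤maxLetter : ∀ {n a} {u : Vec ℕ n} → a ∈ u → a ≤ maxLetter u
∈⇒≤maxLetter {u = u} a∈u = All.lookup (xs≤max 0 (toList u)) (VecAny.toList⁺ a∈u)

packed-max : ∀ {n} {u : Vec ℕ n} → Packed u → ∀ a → (a ∈ u) ⇔ (1 ≤ a × a ≤ maxLetter u)
packed-max {u = u} (r , h) a = mk⇔
  (λ a∈u → proj₁ (to (h a) a∈u) , ∈⇒≤maxLetter a∈u)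
  (λ (1≤a , a≤m) → from (h a) (1≤a , ℕ.≤-trans a≤m max≤r))
  where
  max≤r : maxLetter u ≤ r
  max≤r = max≤v⁺ z≤n (All.tabulate (λ b∈u → proj₂ (to (h _) (VecAny.toList⁻ b∈u))))

packed? : ∀ {n} (u : Vec ℕ n) → Dec (Packed u)
packed? u = map′ ⇒ ⇐
  (All.all? (1 ℕ.≤?_) (toList u) ×-dec Fin.all? (λ (i : Fin (maxLetter u)) → suc (toℕ i) ∈? u))
  where
  ⇒ : All (1 ≤_) (toList u) × (∀ (i : Fin (maxLetter u)) → suc (toℕ i) ∈ u) → Packed u
  ⇒ (pos , full) = maxLetter u , λ where
    zero    → mk⇔ (λ 0∈u → All.lookup pos (VecAny.toList⁺ 0∈u) , z≤n) (λ ())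
    (suc a) → mk⇔ (λ a∈u → s≤s z≤n , ∈⇒≤maxLetter a∈u)
      (λ (_ , a<m) → subst (λ k → suc k ∈ u) (Fin.toℕ-fromℕ< a<m) (full (fromℕ< a<m)))
  ⇐ : Packed u → All (1 ≤_) (toList u) × (∀ (i : Fin (maxLetter u)) → suc (toℕ i) ∈ u)
  ⇐ p = All.tabulate (λ b∈u → proj₁ (to (packed-max p _) (VecAny.toList⁻ b∈u)))
      , λ i → from (packed-max p _) (s≤s z≤n , Fin.toℕ<n i)

-- Packedness is stored irrelevantly, so that a packed word is determined by its letters.
record PackedWord (n : ℕ) : Set where
  constructor ⟨_,_⟩
  field
    letters : Vec ℕ n
    .packed : Packed letters

open PackedWord public

packedProof : ∀ {n} (u : PackedWord n) → Packed (letters u)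
packedProof ⟨ w , p ⟩ = recompute (packed? w) p

maxᵖ : ∀ {n} → PackedWord n → ℕ
maxᵖ u = maxLetter (letters u)

letters-injective : ∀ {n} {u v : PackedWord n} → letters u ≡ letters v → u ≡ v
letters-injective {u = ⟨ _ , _ ⟩} {v = ⟨ _ , _ ⟩} refl = refl

-- The letters of a packed word of length n are at most n.

wordsOver : List ℕ → (n : ℕ) → List (Vec ℕ n)
wordsOver as zero    = [] ∷ []
wordsOver as (suc n) = cartesianProductWith _∷_ as (wordsOver as n)

toPacked : ∀ {n} → Vec ℕ n → Maybe (PackedWord n)
toPacked u = Maybe.map (λ p → ⟨ u , p ⟩) (dec⇒maybe (packed? u))

packedWords : (n : ℕ) → List (PackedWord n)
packedWords n = mapMaybe toPacked (wordsOver (List.map suc (upTo n)) n)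

packed⇒≤length : ∀ {n a} (u : PackedWord n) → a ∈ letters u → a ≤ n
packed⇒≤length {n} u a∈u = ℕ.≤-trans (∈⇒≤maxLetter a∈u) (Fin.injective⇒≤ {f = pos} inj)
  where
  occ : (i : Fin (maxᵖ u)) → suc (toℕ i) ∈ letters u
  occ i = from (packed-max (packedProof u) _) (s≤s z≤n , Fin.toℕ<n i)
  pos : Fin (maxᵖ u) → Fin n
  pos i = VecAny.index (occ i)
  inj : ∀ {i j} → pos i ≡ pos j → i ≡ j
  inj {i} {j} e = Fin.toℕ-injective (ℕ.suc-injective
    (trans (VecAny.lookup-index (occ i))
      (trans (cong (lookup (letters u)) e) (sym (VecAny.lookup-index (occ j))))))

∈-wordsOver : ∀ {as n} (u : Vec ℕ n) → (∀ {a} → a ∈ u → Any (a ≡_) as) → Any (u ≡_) (wordsOver as n)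
∈-wordsOver []      h = here refl
∈-wordsOver (a ∷ u) h =
  ∈-cartesianProductWith⁺ _∷_ (h (VecAny.here refl)) (∈-wordsOver u (h ∘ VecAny.there))

∈-packedWords : ∀ {n} (u : PackedWord n) → Any (u ≡_) (packedWords n)
∈-packedWords {n} u@(⟨ w , p ⟩) =
  go (wordsOver (List.map suc (upTo n)) n) (∈-wordsOver w letter)
  where
  letter : ∀ {a} → a ∈ w → Any (a ≡_) (List.map suc (upTo n))
  letter {zero}  a∈w = contradiction (proj₁ (to (packed-max (packedProof u) 0) a∈w)) λ ()
  letter {suc a} a∈w = ∈-map⁺ suc (∈-upTo⁺ (packed⇒≤length u a∈w))
  go : ∀ ws → Any (w ≡_) ws → Any (u ≡_) (mapMaybe toPacked ws)
  go (_ ∷ ws) (here refl) with packed? w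
  ... | yes _  = here refl
  ... | no  ¬p = contradiction (packedProof u) ¬p
  go (w′ ∷ ws) (there w∈) with packed? w′
  ... | yes _ = there (go ws w∈)
  ... | no  _ = go ws w∈

wordsOver-unique : ∀ {as} → Unique as → ∀ n → Unique (wordsOver as n)
wordsOver-unique as! zero    = [] ∷ []
wordsOver-unique as! (suc n) =
  Unique.cartesianProductWith⁺ _∷_ Vec.∷-injective as! (wordsOver-unique as! n)

packedWords-unique : ∀ n → Unique (packedWords n)
packedWords-unique n =
  go _ (wordsOver-unique (Unique.map⁺ ℕ.suc-injective (Unique.upTo⁺ n)) n)
  where
  fresh : ∀ {w} .{p : Packed w} ws → All (w ≢_) ws → All (⟨ w , p ⟩ ≢_) (mapMaybe toPacked ws)
  fresh []        []         = []
  fresh (w′ ∷ ws) (ne ∷ nes) with packed? w′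
  ... | yes _ = (λ e → ne (cong letters e)) ∷ fresh ws nes
  ... | no  _ = fresh ws nes
  go : ∀ ws → Unique ws → Unique (mapMaybe toPacked ws)
  go []       []          = []
  go (w ∷ ws) (w∉ ∷ ws!) with packed? w
  ... | yes _ = fresh ws w∉ ∷ go ws ws!
  ... | no  _ = go ws ws!

module Packing {a ℓ₁ ℓ₂} (O : StrictTotalOrder a ℓ₁ ℓ₂) where

  private module O = StrictTotalOrder O

  distinctLetters : ∀ {n} → Vec O.Carrier n → List O.Carrier
  distinctLetters w = deduplicate O._≟_ (toList w)

  -- If b₁ < ⋯ < b_r are the distinct letters of w, exactly i ∸ 1 of them are below b_i.
  smaller : ∀ {n} → Vec O.Carrier n → O.Carrier → ℕ
  smaller w b = length (filter (O._<? b) (distinctLetters w))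

  packVec : ∀ {n} → Vec O.Carrier n → Vec ℕ n
  packVec w = Vec.map (λ b → suc (smaller w b)) w

  private
    below-mono : ∀ {a b} → a O.< b → ∀ xs →
      length (filter (O._<? a) xs) ≤ length (filter (O._<? b) xs)
    below-mono a<b []       = z≤n
    below-mono {a} {b} a<b (x ∷ xs) with x O.<? a | x O.<? b
    ... | yes _   | yes _  = s≤s (below-mono a<b xs)
    ... | yes x<a | no x≮b = contradiction (O.trans x<a a<b) x≮b
    ... | no _    | yes _  = ℕ.m≤n⇒m≤1+n (below-mono a<b xs)
    ... | no _    | no _   = below-mono a<b xs

    below-strict : ∀ {a b} → a O.< b → ∀ {xs} → Any (a ≡_) xs →
      length (filter (O._<? a) xs) < length (filter (O._<? b) xs)
    below-strict {a} {b} a<b {_ ∷ xs} (here refl) with a O.<? a | a O.<? b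
    ... | yes a<a | _      = contradiction a<a (O.irrefl O.Eq.refl)
    ... | no _    | no a≮b = contradiction a<b a≮b
    ... | no _    | yes _  = s≤s (below-mono a<b xs)
    below-strict {a} {b} a<b {x ∷ xs} (there a∈) with x O.<? a | x O.<? b
    ... | yes _   | yes _  = s≤s (below-strict a<b a∈)
    ... | yes x<a | no x≮b = contradiction (O.trans x<a a<b) x≮b
    ... | no _    | yes _  = ℕ.m≤n⇒m≤1+n (below-strict a<b a∈)
    ... | no _    | no _   = below-strict a<b a∈

    injective⇒surjective : ∀ {n} (f : Fin n → Fin n) → (∀ {i j} → f i ≡ f j → i ≡ j) →
      ∀ k → ∃[ i ] f i ≡ k
    injective⇒surjective {suc n} f inj k with Fin.any? (λ i → f i Fin.≟ k)
    ... | yes hit = hit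
    ... | no miss = contradiction (Fin.injective⇒≤ {f = g} g-inj) ℕ.1+n≰n
      where
      k≢ : ∀ i → k ≢ f i
      k≢ i e = miss (i , sym e)
      g : Fin (suc n) → Fin n
      g i = punchOut (k≢ i)
      g-inj : ∀ {i j} → g i ≡ g j → i ≡ j
      g-inj {i} {j} e = inj (Fin.punchOut-injective (k≢ i) (k≢ j) e)

    lookup-distinct : ∀ {xs} → UniqueSetoid.Unique O.Eq.setoid xs →
      ∀ {i j} → List.lookup xs i O.≈ List.lookup xs j → i ≡ j
    lookup-distinct (_ ∷ _)    {Fin.zero}  {Fin.zero}  _ = refl
    lookup-distinct (x∉ ∷ _)  {Fin.zero}  {Fin.suc j} e = contradiction e (All.lookup x∉ (∈-lookup j))
    lookup-distinct (x∉ ∷ _)  {Fin.suc i} {Fin.zero}  e =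
      contradiction (O.Eq.sym e) (All.lookup x∉ (∈-lookup i))
    lookup-distinct (_ ∷ xs!) {Fin.suc i} {Fin.suc j} e = cong Fin.suc (lookup-distinct xs! e)

  packVec-packed : ∀ {n} (w : Vec O.Carrier n) → Packed (packVec w)
  packVec-packed w = r , λ a → mk⇔ (⇒ a) (⇐ a)
    where
    S = distinctLetters w
    r = length S

    smaller<r : ∀ {b} → Any (O._≈ b) S → smaller w b < r
    smaller<r b∈S = filter-notAll (O._<? _) S (Any.map (λ e b<b → O.irrefl e b<b) b∈S)

    ⇒ : ∀ a → a ∈ packVec w → 1 ≤ a × a ≤ r
    ⇒ a a∈ = subst (λ k → 1 ≤ k × k ≤ r) (sym a≡)
      (s≤s z≤n , smaller<r (Any.deduplicate⁺ O._≟_ (λ x≈y x≈b → O.Eq.trans x≈y x≈b) b∈w))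
      where
      i = VecAny.index a∈
      b = lookup w i
      a≡ : a ≡ suc (smaller w b)
      a≡ = trans (VecAny.lookup-index a∈) (Vec.lookup-map i _ w)
      b∈w : Any (O._≈ b) (toList w)
      b∈w = VecAny.toList⁺ (VecAny.map (O.Eq.reflexive ∘ sym) (VecMem.∈-lookup i w))

    rank : Fin r → Fin r
    rank i = fromℕ< (smaller<r (Any.map (O.Eq.reflexive ∘ sym) (∈-lookup {xs = S} i)))

    rank-injective : ∀ {i j} → rank i ≡ rank j → i ≡ j
    rank-injective {i} {j} e with O.compare (List.lookup S i) (List.lookup S j)
    ... | tri< lt _ _ = contradiction (Fin.fromℕ<-injective _ _ _ _ e) (ℕ.<⇒≢ (below-strict lt (∈-lookup {xs = S} i)))
    ... | tri≈ _ eq _ = lookup-distinct (UniqueDecSetoid.deduplicate-! O.decSetoid (toList w)) eq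
    ... | tri> _ _ gt = contradiction (sym (Fin.fromℕ<-injective _ _ _ _ e)) (ℕ.<⇒≢ (below-strict gt (∈-lookup {xs = S} j)))

    ⇐ : ∀ a → 1 ≤ a × a ≤ r → a ∈ packVec w
    ⇐ (suc a) (_ , a<r) with injective⇒surjective rank rank-injective (fromℕ< a<r)
    ... | i , e = subst (_∈ packVec w) (cong suc (Fin.fromℕ<-injective _ _ _ _ e))
      (VecMem.∈-map⁺ (λ b → suc (smaller w b))
        (VecAny.toList⁻ (Any.deduplicate⁻ O._≟_ (∈-lookup {xs = S} i))))

  pack : ∀ {n} → Vec O.Carrier n → PackedWord n
  pack w = ⟨ packVec w , packVec-packed w ⟩

biletters : StrictTotalOrder 0ℓ 0ℓ 0ℓ
biletters = ×-strictTotalOrder ℕ.<-strictTotalOrder ℕ.<-strictTotalOrder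

packBiword : ∀ {n} → PackedWord n → PackedWord n → PackedWord n
packBiword u v = Packing.pack biletters (Vec.zip (letters u) (letters v))

-- Argument order: WRef v x says that x is a weak refinement of v.
WRef : ∀ {n} → PackedWord n → PackedWord n → Set
WRef v x = ∀ i j → lookup (letters x) i ≡ lookup (letters x) j → lookup (letters v) i ≡ lookup (letters v) j

wRef? : ∀ {n} (v x : PackedWord n) → Dec (WRef v x)
wRef? v x = Fin.all? λ i → Fin.all? λ j →
  (lookup (letters x) i ℕ.≟ lookup (letters x) j) →-dec (lookup (letters v) i ℕ.≟ lookup (letters v) j)

wRefs : ∀ {n} → PackedWord n → List (PackedWord n)
wRefs {n} v = filter (wRef? v) (packedWords n)

occurrence : ∀ {n} (x : PackedWord n) (i : Fin (maxᵖ x)) → suc (toℕ i) ∈ letters x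
occurrence x i = from (packed-max (packedProof x) _) (s≤s z≤n , Fin.toℕ<n i)

-- The letter at the (0-based) index i is v_j for a chosen j with x_j = i + 1.
refinementWord : ∀ {n} (v x : PackedWord n) → Vec ℕ (maxᵖ x)
refinementWord v x = tabulate λ i → lookup (letters v) (VecAny.index (occurrence x i))

refinementWord-lookup : ∀ {n} (v x : PackedWord n) → WRef v x → ∀ i j →
  lookup (letters x) j ≡ suc (toℕ i) → lookup (refinementWord v x) i ≡ lookup (letters v) j
refinementWord-lookup v x v≤x i j xj≡i =
  trans (Vec.lookup∘tabulate _ i)
    (v≤x _ j (trans (sym (VecAny.lookup-index (occurrence x i))) (sym xj≡i)))

refinementWord-packed : ∀ {n} (v x : PackedWord n) → WRef v x → Packed (refinementWord v x)
refinementWord-packed v x v≤x with packedProof v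
... | r , h = r , λ a → mk⇔ (⇒ a) (⇐ a)
  where
  ⇒ : ∀ a → a ∈ refinementWord v x → 1 ≤ a × a ≤ r
  ⇒ a a∈ = to (h a) (subst (_∈ letters v)
    (sym (trans (VecAny.lookup-index a∈) (Vec.lookup∘tabulate _ (VecAny.index a∈))))
    (VecMem.∈-lookup _ (letters v)))
  ⇐ : ∀ a → 1 ≤ a × a ≤ r → a ∈ refinementWord v x
  ⇐ a a≤r with from (h a) a≤r
  ... | a∈v = hit (to (packed-max (packedProof x) _) (VecMem.∈-lookup j (letters x))) refl
    where
    j = VecAny.index a∈v
    hit : ∀ {b} → 1 ≤ b × b ≤ maxᵖ x → lookup (letters x) j ≡ b → a ∈ refinementWord v x
    hit {suc b} (_ , b<m) xj≡ = subst (_∈ refinementWord v x)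
      (trans (refinementWord-lookup v x v≤x (fromℕ< b<m) j
        (trans xj≡ (cong suc (sym (Fin.toℕ-fromℕ< b<m))))) (sym (VecAny.lookup-index a∈v)))
      (VecMem.∈-lookup (fromℕ< b<m) (refinementWord v x))

module _ {c ℓ} (R : RawRing c ℓ) where
  open RawRing R

  ∑ : ∀ {a} {A : Set a} → List A → (A → Carrier) → Carrier
  ∑ xs f = List.foldr (λ x s → f x + s) 0# xs

-- A polynomial is its list of coefficients, constant term first; equality
-- ignores trailing zeros.
module Polynomial {c ℓ} (R : RawRing c ℓ) where
  open RawRing R

  Poly : Set c
  Poly = List Carrier

  coeff : Poly → ℕ → Carrier
  coeff []      _       = 0#
  coeff (a ∷ p) zero    = a
  coeff (a ∷ p) (suc k) = coeff p k

  _≈ᵖ_ : Poly → Poly → Set ℓ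
  p ≈ᵖ q = ∀ k → coeff p k ≈ coeff q k

  _+ᵖ_ : Poly → Poly → Poly
  []      +ᵖ q       = q
  (a ∷ p) +ᵖ []      = a ∷ p
  (a ∷ p) +ᵖ (b ∷ q) = (a + b) ∷ (p +ᵖ q)

  scale : Carrier → Poly → Poly
  scale a = List.map (a *_)

  _*ᵖ_ : Poly → Poly → Poly
  []      *ᵖ q = []
  (a ∷ p) *ᵖ q = scale a q +ᵖ (0# ∷ (p *ᵖ q))

  constant : Carrier → Poly
  constant a = a ∷ []

  t : Poly
  t = 0# ∷ 1# ∷ []

  R[t] : RawRing c ℓ
  R[t] = record
    { Carrier = Poly ; _≈_ = _≈ᵖ_ ; _+_ = _+ᵖ_ ; _*_ = _*ᵖ_
    ; -_ = List.map (-_) ; 0# = [] ; 1# = constant 1# }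

-- WQSym*_n with coefficients in R: an element is the family of its
-- coordinates in the basis N.

module WQSym {c ℓ} (R : RawRing c ℓ) where
  open RawRing R

  WQSym* : ℕ → Set c
  WQSym* n = PackedWord n → Carrier

  infix  4 _≋_
  infixr 7 _•_
  infixl 7 _⋆_

  _≋_ : ∀ {n} → WQSym* n → WQSym* n → Set ℓ
  f ≋ g = ∀ w → f w ≈ g w

  _•_ : ∀ {n} → Carrier → WQSym* n → WQSym* n
  (a • f) w = a * f w

  ∑ʷ : ∀ {a} {A : Set a} {n} → List A → (A → WQSym* n) → WQSym* n
  ∑ʷ xs f w = ∑ R xs (λ x → f x w)

  N : ∀ {n} → PackedWord n → WQSym* n
  N u w = if does (Vec.≡-dec ℕ._≟_ (letters u) (letters w)) then 1# else 0#

  _⋆_ : ∀ {n} → WQSym* n → WQSym* n → WQSym* n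
  _⋆_ {n} f g =
    ∑ʷ (packedWords n) λ u → ∑ʷ (packedWords n) λ v → (f u * g v) • N (packBiword u v)

-- In a Heyting field the apartness # plays the role of ≠.
CharacteristicZero : ∀ {c ℓ₁ ℓ₂} → HeytingField c ℓ₁ ℓ₂ → Set ℓ₂
CharacteristicZero F = ∀ n .{{_ : ℕ.NonZero n}} → (n ×ᴷ 1#) # 0#
  where
  open HeytingField F
  K = HeytingCommutativeRing.commutativeRing heytingCommutativeRing
  open RawMonoidDefs (CommutativeRing.+-rawMonoid K) using () renaming (_×_ to _×ᴷ_)

module Goldberg {c ℓ₁ ℓ₂} (F : HeytingField c ℓ₁ ℓ₂) (char0 : CharacteristicZero F) where

  private
    module F = HeytingField F

  commutativeRing : CommutativeRing c ℓ₁
  commutativeRing = HeytingCommutativeRing.commutativeRing F.heytingCommutativeRing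

  open CommutativeRing commutativeRing hiding (refl; sym; trans)
  private
    module K = CommutativeRing commutativeRing
  open RawMonoidDefs +-rawMonoid using () renaming (_×_ to _×ᴷ_)

  open Polynomial rawRing public

  1/_! : ℕ → Carrier
  1/ n ! = proj₁ (F.#⇒invertible (char0 (n ℕ.!) {{n ℕ.!≢0}}))

  -- binom k = t(t-1)⋯(t-k+1)/k!
  fallingFactorial : ℕ → Poly
  fallingFactorial zero    = constant 1#
  fallingFactorial (suc k) = fallingFactorial k *ᵖ (t +ᵖ constant (- (k ×ᴷ 1#)))

  binom : ℕ → Poly
  binom k = scale (1/ k !) (fallingFactorial k)

  -- Formal series in noncommuting variables a₁, a₂, …; the word
  -- a_{i₁}⋯a_{iₖ} is the list i₁, …, iₖ. The letter 0 stands for no variable, and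
  -- words containing it have coefficient 0 in every series used here.

  Series : Set c
  Series = List ℕ → Carrier

  1ˢ : Series
  1ˢ []      = 1#
  1ˢ (_ ∷ _) = 0#

  infixl 6 _-ˢ_
  infixl 7 _⊛_

  _-ˢ_ : Series → Series → Series
  (f -ˢ g) w = f w - g w

  _⊛_ : Series → Series → Series
  (f ⊛ g) w = ∑ rawRing (upTo (suc (length w))) λ i → f (take i w) * g (drop i w)

  _^ˢ_ : Series → ℕ → Series
  f ^ˢ zero  = 1ˢ
  f ^ˢ suc k = f ⊛ (f ^ˢ k)

  -- e^{a_i}: the word (a_i)^k has coefficient 1/k!, all other words have coefficient 0.
  exp : ℕ → Series
  exp i w = if does (All.all? (i ℕ.≟_) w) then 1/ length w ! else 0#

  expProduct : ℕ → Series
  expProduct zero    = 1ˢ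
  expProduct (suc m) = expProduct m ⊛ exp (suc m)

  -- The infinite product e^{a₁}e^{a₂}⋯: the coefficient of w is the same in all
  -- partial products containing every letter of w (expProduct-stable below).
  g : Series
  g w = expProduct (max 0 w) w

  -- The coefficient of w in g^t = ∑_{k≥0} binom(t,k) (g-1)^k; the terms with
  -- k > length w do not contribute (power-vanishes below).
  gᵗ : List ℕ → Poly
  gᵗ w = ∑ R[t] (upTo (suc (length w))) λ k → scale (((g -ˢ 1ˢ) ^ˢ k) w) (binom k)

  -- c_u(t), for u packed, is the coefficient in g^t of any word that packs to u,
  -- in particular of u itself.
  goldberg : ∀ {r} → Vec ℕ r → Poly
  goldberg u = gᵗ (toList u)

  module WQ    = WQSym rawRing
  module WQ[t] = WQSym R[t]
  open WQ[t] public using (_≋_; _•_; ∑ʷ; _⋆_)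

  -- the inclusion of WQSym*_n into WQSym*_n ⊗ K[t]
  extend : ∀ {n} → WQ.WQSym* n → WQ[t].WQSym* n
  extend f w = constant (f w)

  -- (σ₁^t)_n = ∑_u binom(t, max u) N_u
  σᵗ : (n : ℕ) → WQ[t].WQSym* n
  σᵗ n u = binom (maxᵖ u)

  -- E_n^{[k]} is the coefficient of t^k in (σ₁^t)_n. For n ≥ 1 only 1 ≤ k ≤ n give a
  -- nonzero element; for n = 0 this makes E_0^{[0]} the basis element of the empty word.
  E : (n k : ℕ) → WQ.WQSym* n
  E n k u = coeff (σᵗ n u) k

  𝐊 : ∀ {n} → PackedWord n → WQ.WQSym* n
  𝐊 {n} u = WQ._⋆_ (WQ.N u) (E n (maxᵖ u))

  U : ∀ {n} → PackedWord n → WQ[t].WQSym* n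
  U {n} v = σᵗ n ⋆ WQ[t].N v

  private
    open import Relation.Binary.Reasoning.Setoid K.setoid

    ∑-zero : ∀ {a} {A : Set a} (xs : List A) (f : A → Carrier) →
      (∀ {x} → Any (x ≡_) xs → f x ≈ 0#) → ∑ rawRing xs f ≈ 0#
    ∑-zero []       f z = K.refl
    ∑-zero (x ∷ xs) f z =
      K.trans (+-cong (z (here refl)) (∑-zero xs f (z ∘ there))) (+-identityˡ 0#)

    ∑-∷ʳ : ∀ {a} {A : Set a} (xs : List A) y (f : A → Carrier) →
      ∑ rawRing (xs List.∷ʳ y) f ≈ ∑ rawRing xs f + f y
    ∑-∷ʳ []       y f = +-comm _ _
    ∑-∷ʳ (x ∷ xs) y f = K.trans (+-congˡ (∑-∷ʳ xs y f)) (K.sym (+-assoc _ _ _))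

    1/0! : 1/ 0 ! ≈ 1#
    1/0! = begin
      1/ 0 !                         ≈⟨ *-identityʳ _ ⟨
      1/ 0 ! * 1#                    ≈⟨ *-congˡ 1≈ ⟩
      1/ 0 ! * ((1# + 0#) - 0#)      ≈⟨ proj₁ (proj₂ (F.#⇒invertible (char0 1))) ⟩
      1#                             ∎
      where
      1≈ : 1# ≈ (1# + 0#) - 0#
      1≈ = K.sym (begin
        (1# + 0#) - 0# ≈⟨ +-congʳ (+-identityʳ 1#) ⟩
        1# - 0#        ≈⟨ +-identityʳ _ ⟨
        1# - 0# + 0#   ≈⟨ +-assoc _ _ _ ⟩
        1# + (- 0# + 0#) ≈⟨ +-congˡ (-‿inverseˡ 0#) ⟩
        1# + 0#        ≈⟨ +-identityʳ 1# ⟩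
        1#             ∎)

  power-vanishes : ∀ k w → length w < k → ((g -ˢ 1ˢ) ^ˢ k) w ≈ 0#
  power-vanishes (suc k) w w<k = ∑-zero (upTo (suc (length w))) _ (λ {i} _ → term i w w<k)
    where
    g-1 = g -ˢ 1ˢ
    term : ∀ i w → length w < suc k → g-1 (take i w) * (g-1 ^ˢ k) (drop i w) ≈ 0#
    term zero    w       _         = K.trans (*-congʳ (-‿inverseʳ 1#)) (zeroˡ _)
    term (suc i) []      _         = K.trans (*-congʳ (-‿inverseʳ 1#)) (zeroˡ _)
    term (suc i) (a ∷ w) (s≤s w<k) = K.trans
      (*-congˡ (power-vanishes k (drop i w)
        (ℕ.≤-<-trans (ℕ.≤-trans (ℕ.≤-reflexive (List.length-drop i w)) (ℕ.m∸n≤m _ i)) w<k)))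
      (zeroʳ _)

  expProduct-step : ∀ m w → max 0 w ≤ m → expProduct (suc m) w ≈ expProduct m w
  expProduct-step m w w≤m = begin
    ∑ rawRing (upTo (suc (length w))) term   ≡⟨ cong (λ is → ∑ rawRing is term) (List.upTo-∷ʳ (length w)) ⟨
    ∑ rawRing (upTo (length w) List.∷ʳ length w) term ≈⟨ ∑-∷ʳ (upTo (length w)) _ term ⟩
    ∑ rawRing (upTo (length w)) term + term (length w)
      ≈⟨ +-cong (∑-zero (upTo (length w)) term (λ i∈ → early (∈-upTo⁻ i∈))) last ⟩
    0# + expProduct m w                      ≈⟨ +-identityˡ _ ⟩
    expProduct m w                           ∎
    where
    term : ℕ → Carrier
    term i = expProduct m (take i w) * exp (suc m) (drop i w)

    exp-zero : ∀ i v → All (_≤ m) v → i < length v → exp (suc m) (drop i v) ≈ 0#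
    exp-zero zero    (a ∷ v) (a≤m ∷ _) _
      rewrite dec-false (suc m ℕ.≟ a) (λ e → ℕ.1+n≰n (ℕ.≤-trans (ℕ.≤-reflexive e) a≤m)) = K.refl
    exp-zero (suc i) (a ∷ v) (_ ∷ v≤m) (s≤s i<) = exp-zero i v v≤m i<

    early : ∀ {i} → i < length w → term i ≈ 0#
    early {i} i< = K.trans
      (*-congˡ (exp-zero i w (All.map (λ a≤ → ℕ.≤-trans a≤ w≤m) (xs≤max 0 w)) i<)) (zeroʳ _)

    last : term (length w) ≈ expProduct m w
    last = begin
      expProduct m (take (length w) w) * exp (suc m) (drop (length w) w)
        ≡⟨ cong₂ (λ x y → expProduct m x * exp (suc m) y) (List.take-all _ w ℕ.≤-refl) (List.drop-all _ w ℕ.≤-refl) ⟩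
      expProduct m w * 1/ 0 ! ≈⟨ *-congˡ 1/0! ⟩
      expProduct m w * 1#     ≈⟨ *-identityʳ _ ⟩
      expProduct m w          ∎

  expProduct-stable : ∀ m w → max 0 w ≤ m → expProduct m w ≈ g w
  expProduct-stable m w w≤m with ℕ.m≤n⇒m<n∨m≡n w≤m
  expProduct-stable m       w _ | inj₂ refl       = K.refl
  expProduct-stable (suc m) w _ | inj₁ (s≤s w≤m) =
    K.trans (expProduct-step m w w≤m) (expProduct-stable m w w≤m)

{-# OPTIONS --safe #-}

-- Fix a packed word w with p = max w. A pair (u, v) packs to w exactly when u = φ ∘ w and
-- v = ψ ∘ w with the biletters (φᵢ, ψᵢ) increasing strictly, so that only nondecreasing
-- packed words φ of length p, i.e. compositions of p, contribute.
--
-- The coefficient of N_w in U_v is therefore the sum of binom(t, r) over the ways of cutting ψ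
-- into r strictly increasing blocks, that is, the coefficient of ψ in hᵗ for
-- h = (1 + a₁)(1 + a₂)⋯. On the other side, the coefficient of N_w in K_{χ ∘ w} is the
-- coefficient of tʳ, r = max χ, in the sum of binom(t, max μ) over the packed words μ that
-- increase strictly on the blocks of the composition χ. At a natural number t this sum counts
-- all words over {1, …, t} increasing on these blocks, so it is the product of binom(t, kᵢ)
-- over the block sizes kᵢ, and its coefficient of tʳ is the product of the coefficients of
-- x^{kᵢ} in log (1 + x). Hence the right-hand side is the coefficient of ψ in the image of gᵗ
-- under the multiplicative substitution aᵢ ↦ log (1 + aᵢ), which sends g to h.

module Submission where

open import Defs
open import Algebra.Apartness.Bundles using (HeytingField)
open import Algebra.Bundles using (CommutativeRing)
import Algebra.Properties.CommutativeSemigroup as CommSemigroup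
import Algebra.Properties.Ring as RingProperties
import Algebra.Properties.Semiring.Mult as SemiringMult
import Algebra.Solver.Ring.NaturalCoefficients.Default as SemiringSolver
open import Data.Bool.Base using (true; false; if_then_else_)
open import Data.Fin.Base as Fin using (Fin; toℕ; fromℕ<)
import Data.Fin.Properties as Fin
open import Data.List.Base as List
  using (List; []; _∷_; _++_; map; filter; length; upTo; applyUpTo; cartesianProductWith)
import Data.List.Properties as List
open import Data.List.Extrema.Nat using (max; max≤v⁺; xs≤max)
open import Data.List.Membership.Propositional using () renaming (_∈_ to _∈ˡ_)
open import Data.List.Membership.Propositional.Properties
  using (∈-filter⁺; ∈-filter⁻; ∈-map⁺; ∈-map⁻; ∈-++⁺ˡ; ∈-++⁺ʳ; ∈-++⁻; ∈-upTo⁻; ∈-cartesianProductWith⁻)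
open import Data.List.Membership.Propositional.Properties.WithK using (unique∧set⇒bag)
open import Data.List.Relation.Binary.BagAndSetEquality using (∼bag⇒↭)
import Data.List.Relation.Binary.Permutation.Homogeneous as Homogeneous
open import Data.List.Relation.Binary.Permutation.Propositional using (_↭_; ↭⇒↭ₛ)
import Data.List.Relation.Binary.Permutation.Propositional.Properties as Permutation
import Data.List.Relation.Binary.Permutation.Setoid.Properties as Permutationₛ
open import Data.List.Relation.Unary.All as All using (All; []; _∷_)
open import Data.List.Relation.Unary.AllPairs using ([]; _∷_)
open import Data.List.Relation.Unary.Any using (Any; here; there)
import Data.List.Relation.Unary.Any.Properties as Any
open import Data.List.Relation.Unary.Unique.Propositional using (Unique)
import Data.List.Relation.Unary.Unique.Propositional.Properties as Unique
open import Data.Nat.Base as ℕ using (ℕ; zero; suc; _≤_; _<_; s≤s; z≤n; _∸_; _!)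
import Data.Nat.Properties as ℕ
open import Data.Product.Base using (∃-syntax; _×_; _,_; proj₁; proj₂)
open import Data.Sum.Base using (_⊎_; inj₁; inj₂)
open import Data.Unit.Base using (⊤; tt)
open import Data.Vec.Base as Vec using (Vec; []; _∷_; lookup; toList; zip; replicate; tabulate)
open import Data.Vec.Membership.Propositional using (_∈_)
import Data.Vec.Membership.Propositional.Properties as VecMem
import Data.Vec.Properties as Vec
import Data.Vec.Relation.Unary.Any as VecAny
import Data.Vec.Relation.Unary.Any.Properties as VecAny
open import Data.Vec.Relation.Binary.Pointwise.Extensional using (Pointwise-≡⇒≡; ext)
open import Function.Base using (_∘_; id)
open import Function.Bundles using (_⇔_; mk⇔; Equivalence)
open import Level using (Level)
open import Relation.Binary.Bundles using (StrictTotalOrder)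
open import Relation.Binary.Definitions using (DecidableEquality; tri<; tri≈; tri>)
open import Relation.Binary.PropositionalEquality as ≡ using (_≡_; _≢_)
open import Relation.Nullary using (Dec; yes; no; does; ¬_; contradiction; map′)
open import Relation.Nullary.Decidable using (_×-dec_; _⊎-dec_; _→-dec_)

open Equivalence using (to; from)

-- Both sides are compared at one coordinate `w` and one power of t. If `w` does not refine `v`,
-- both vanish; otherwise v = ψ ∘ w, and all sums over packed words of length n reduce to words φ ∘
-- w, hence to packed words of length max w. The index in `E n (maxᵖ u)` matters because binom(t, k)
-- is divisible by t for k ≥ 1: with r blocks, t^r is the lowest power in the product of the
-- binom(t, kᵢ), so its coefficient is just the product of the linear coefficients. The logarithm is
-- never defined. If E_r is the series in x of the coefficients of t^r in binom(t, n), the recursion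
-- of the falling factorials gives E_1 E_r = (r + 1) E_{r+1}, so E_r = E_1^r / r!. Then exp E_1 = ∑ᵣ
-- E_r has the coefficients binom(1, n), which is 1 + x. Substitution into a noncommutative series
-- is a recursion on the word at which the coefficient is read, with the open block as a state; the
-- choices made in this recursion are recorded by compositions. Characteristic 0 provides the
-- inverse factorials, the cancellation of natural factors and the comparison of polynomials at
-- natural numbers.

module Sums {c ℓ} (R : CommutativeRing c ℓ) where
  open CommutativeRing R hiding (zero)
  open import Relation.Binary.Reasoning.Setoid setoid
  open CommSemigroup +-commutativeSemigroup using () renaming (interchange to +-interchange) public
  open CommSemigroup *-commutativeSemigroup using () renaming (x∙yz≈y∙xz to x*yz≈y*xz) public

  private variable
    a b p q : Level
    A : Set a
    B : Set b

  -- Finite sums with indicator factors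

  Σᴿ : {A : Set a} → List A → (A → Carrier) → Carrier
  Σᴿ = ∑ rawRing

  ⟦_⟧ : {P : Set p} → Dec P → Carrier
  ⟦ d ⟧ = if does d then 1# else 0#

  ⟦⟧-yes : {P : Set p} (d : Dec P) → P → ⟦ d ⟧ ≈ 1#
  ⟦⟧-yes (yes _) _ = refl
  ⟦⟧-yes (no ¬p) p = contradiction p ¬p

  ⟦⟧-no : {P : Set p} (d : Dec P) → ¬ P → ⟦ d ⟧ ≈ 0#
  ⟦⟧-no (yes p) ¬p = contradiction p ¬p
  ⟦⟧-no (no _)  _  = refl

  ⟦⟧-⇔ : {P : Set p} {Q : Set q} (d : Dec P) (e : Dec Q) → (P → Q) → (Q → P) → ⟦ d ⟧ ≈ ⟦ e ⟧
  ⟦⟧-⇔ (yes p) e f g = sym (⟦⟧-yes e (f p))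
  ⟦⟧-⇔ (no ¬p) e f g = sym (⟦⟧-no e (¬p ∘ g))

  ⟦⟧-× : {P : Set p} {Q : Set q} (d : Dec P) (e : Dec Q) → ⟦ d ×-dec e ⟧ ≈ ⟦ d ⟧ * ⟦ e ⟧
  ⟦⟧-× (yes _) e = sym (*-identityˡ _)
  ⟦⟧-× (no _)  e = sym (zeroˡ _)

  ⟦⟧*-cong : {P : Set p} (d : Dec P) {x y : Carrier} → (P → x ≈ y) → ⟦ d ⟧ * x ≈ ⟦ d ⟧ * y
  ⟦⟧*-cong (yes p) e = *-congˡ (e p)
  ⟦⟧*-cong (no _)  e = trans (zeroˡ _) (sym (zeroˡ _))

  ∑-cong∈ : (xs : List A) {f g : A → Carrier} → (∀ {x} → x ∈ˡ xs → f x ≈ g x) → Σᴿ xs f ≈ Σᴿ xs g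
  ∑-cong∈ []       e = refl
  ∑-cong∈ (x ∷ xs) e = +-cong (e (here ≡.refl)) (∑-cong∈ xs (e ∘ there))

  ∑-cong : (xs : List A) {f g : A → Carrier} → (∀ x → f x ≈ g x) → Σᴿ xs f ≈ Σᴿ xs g
  ∑-cong xs e = ∑-cong∈ xs (λ {x} _ → e x)

  ∑-zero : (xs : List A) {f : A → Carrier} → (∀ {x} → x ∈ˡ xs → f x ≈ 0#) → Σᴿ xs f ≈ 0#
  ∑-zero []       e = refl
  ∑-zero (x ∷ xs) e = trans (+-cong (e (here ≡.refl)) (∑-zero xs (e ∘ there))) (+-identityˡ _)

  ∑-+ : (xs : List A) (f g : A → Carrier) → Σᴿ xs (λ x → f x + g x) ≈ Σᴿ xs f + Σᴿ xs g
  ∑-+ []       f g = sym (+-identityˡ _)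
  ∑-+ (x ∷ xs) f g = trans (+-congˡ (∑-+ xs f g)) (+-interchange _ _ _ _)

  *-∑ : (xs : List A) (k : Carrier) (f : A → Carrier) → k * Σᴿ xs f ≈ Σᴿ xs (λ x → k * f x)
  *-∑ []       k f = zeroʳ k
  *-∑ (x ∷ xs) k f = trans (distribˡ _ _ _) (+-congˡ (*-∑ xs k f))

  ∑-* : (xs : List A) (f : A → Carrier) (k : Carrier) → Σᴿ xs f * k ≈ Σᴿ xs (λ x → f x * k)
  ∑-* []       f k = zeroˡ k
  ∑-* (x ∷ xs) f k = trans (distribʳ _ _ _) (+-congˡ (∑-* xs f k))

  ∑-swap : (xs : List A) (ys : List B) (f : A → B → Carrier) →
    Σᴿ xs (λ x → Σᴿ ys (f x)) ≈ Σᴿ ys (λ y → Σᴿ xs (λ x → f x y))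
  ∑-swap []       ys f = sym (∑-zero ys (λ _ → refl))
  ∑-swap (x ∷ xs) ys f = trans (+-congˡ (∑-swap xs ys f)) (sym (∑-+ ys _ _))

  ∑-map : (h : A → B) (xs : List A) (f : B → Carrier) → Σᴿ (map h xs) f ≡ Σᴿ xs (f ∘ h)
  ∑-map h xs f = List.foldr-map _ h 0# xs

  ∑-++ : (xs ys : List A) (f : A → Carrier) → Σᴿ (xs ++ ys) f ≈ Σᴿ xs f + Σᴿ ys f
  ∑-++ []       ys f = sym (+-identityˡ _)
  ∑-++ (x ∷ xs) ys f = trans (+-congˡ (∑-++ xs ys f)) (sym (+-assoc _ _ _))

  ∑-filter : {P : A → Set p} (P? : ∀ x → Dec (P x)) (xs : List A) (f : A → Carrier) →
    Σᴿ (filter P? xs) f ≈ Σᴿ xs (λ x → ⟦ P? x ⟧ * f x)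
  ∑-filter P? []       f = refl
  ∑-filter P? (x ∷ xs) f with P? x
  ... | yes _ = +-cong (sym (*-identityˡ _)) (∑-filter P? xs f)
  ... | no  _ = trans (∑-filter P? xs f) (trans (sym (+-identityˡ _)) (+-congʳ (sym (zeroˡ _))))

  ∑-applyUpTo : (h : ℕ → A) (n : ℕ) (f : A → Carrier) → Σᴿ (applyUpTo h n) f ≡ Σᴿ (upTo n) (f ∘ h)
  ∑-applyUpTo h n f = ≡.trans (≡.cong (λ xs → Σᴿ xs f) (≡.sym (List.map-upTo h n))) (∑-map h (upTo n) f)

  ∑-upTo-suc : (n : ℕ) (f : ℕ → Carrier) → Σᴿ (upTo (suc n)) f ≡ f 0 + Σᴿ (upTo n) (f ∘ suc)
  ∑-upTo-suc n f = ≡.cong (f 0 +_) (∑-applyUpTo suc n f)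

  ∑-upTo-last : (n : ℕ) (f : ℕ → Carrier) → Σᴿ (upTo (suc n)) f ≈ Σᴿ (upTo n) f + f n
  ∑-upTo-last n f = begin
    Σᴿ (upTo (suc n)) f          ≡⟨ ≡.cong (λ is → Σᴿ is f) (List.upTo-∷ʳ n) ⟨
    Σᴿ (upTo n ++ n ∷ []) f      ≈⟨ ∑-++ (upTo n) (n ∷ []) f ⟩
    Σᴿ (upTo n) f + (f n + 0#)   ≈⟨ +-congˡ (+-identityʳ _) ⟩
    Σᴿ (upTo n) f + f n          ∎

  ∑-cartesianProductWith : ∀ {d} {D : Set d} (h : A → B → D) (xs : List A) (ys : List B) (f : D → Carrier) →
    Σᴿ (cartesianProductWith h xs ys) f ≈ Σᴿ xs (λ x → Σᴿ ys (λ y → f (h x y)))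
  ∑-cartesianProductWith h []       ys f = refl
  ∑-cartesianProductWith h (x ∷ xs) ys f = trans (∑-++ (map (h x) ys) _ f)
    (+-cong (reflexive (∑-map (h x) ys f)) (∑-cartesianProductWith h xs ys f))

  -- The filtered list `xs` and the image under `h` of the filtered list `ys` have no repetitions
  -- and the same elements, so they are permutations of each other. All changes of summation
  -- variable below go through this lemma.
  ∑-reindex : {P : A → Set p} {Q : B → Set q} (P? : ∀ x → Dec (P x)) (Q? : ∀ y → Dec (Q y))
    {xs : List A} {ys : List B} → Unique xs → Unique ys →
    (h : B → A) → (∀ {y y′} → h y ≡ h y′ → y ≡ y′) →
    (∀ {x} → x ∈ˡ xs → P x → ∃[ y ] y ∈ˡ ys × Q y × x ≡ h y) →
    (∀ {y} → y ∈ˡ ys → Q y → h y ∈ˡ xs × P (h y)) →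
    (f : A → Carrier) → Σᴿ xs (λ x → ⟦ P? x ⟧ * f x) ≈ Σᴿ ys (λ y → ⟦ Q? y ⟧ * f (h y))
  ∑-reindex {A = A} P? Q? {xs} {ys} xs! ys! h inj to from f = begin
    Σᴿ xs (λ x → ⟦ P? x ⟧ * f x)      ≈⟨ ∑-filter P? xs f ⟨
    Σᴿ (filter P? xs) f               ≡⟨ List.foldr-map _ f 0# (filter P? xs) ⟨
    List.foldr _+_ 0# (map f (filter P? xs))
      ≈⟨ Permutationₛ.foldr-commMonoid setoid +-isCommutativeMonoid (↭-map perm) ⟩
    List.foldr _+_ 0# (map f (map h (filter Q? ys))) ≡⟨ List.foldr-map _ f 0# (map h (filter Q? ys)) ⟩
    Σᴿ (map h (filter Q? ys)) f       ≡⟨ ∑-map h (filter Q? ys) f ⟩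
    Σᴿ (filter Q? ys) (f ∘ h)         ≈⟨ ∑-filter Q? ys (f ∘ h) ⟩
    Σᴿ ys (λ y → ⟦ Q? y ⟧ * f (h y))  ∎
    where
    ↭-map : ∀ {us vs : List A} → us ↭ vs →
      Homogeneous.Permutation _≈_ (map f us) (map f vs)
    ↭-map us↭vs = Homogeneous.map reflexive (↭⇒↭ₛ (Permutation.map⁺ f us↭vs))
    perm : filter P? xs ↭ map h (filter Q? ys)
    perm = ∼bag⇒↭ (unique∧set⇒bag (Unique.filter⁺ P? xs!) (Unique.map⁺ inj (Unique.filter⁺ Q? ys!))
      (mk⇔ ⇒ ⇐))
      where
      ⇒ : ∀ {x} → x ∈ˡ filter P? xs → x ∈ˡ map h (filter Q? ys)
      ⇒ x∈ with ∈-filter⁻ P? x∈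
      ... | x∈xs , px with to x∈xs px
      ... | y , y∈ys , qy , ≡.refl = ∈-map⁺ h (∈-filter⁺ Q? y∈ys qy)
      ⇐ : ∀ {x} → x ∈ˡ map h (filter Q? ys) → x ∈ˡ filter P? xs
      ⇐ x∈ with ∈-map⁻ h x∈
      ... | y , y∈ , ≡.refl with ∈-filter⁻ Q? y∈
      ... | y∈ys , qy = let h∈ , ph = from y∈ys qy in ∈-filter⁺ P? h∈ ph

  ∑-delta : (_≟_ : DecidableEquality A) {xs : List A} → Unique xs → ∀ {x₀} → x₀ ∈ˡ xs →
    (f : A → Carrier) → Σᴿ xs (λ x → ⟦ x₀ ≟ x ⟧ * f x) ≈ f x₀
  ∑-delta _≟_ {xs} xs! {x₀} x₀∈ f = begin
    Σᴿ xs (λ x → ⟦ x₀ ≟ x ⟧ * f x) ≈⟨ ∑-reindex (x₀ ≟_) (λ _ → yes tt) xs! ([] ∷ []) id id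
      (λ _ e → x₀ , here ≡.refl , tt , ≡.sym e) (λ { (here ≡.refl) _ → x₀∈ , ≡.refl }) f ⟩
    1# * f x₀ + 0#                 ≈⟨ +-identityʳ _ ⟩
    1# * f x₀                      ≈⟨ *-identityˡ _ ⟩
    f x₀                           ∎

-- Packed words as surjections, their composition and their packing

module Words where

  open ≡ using (refl; sym; trans; cong; cong₂; subst; subst₂; module ≡-Reasoning)

  lookup-ext : ∀ {n} {u v : Vec ℕ n} → (∀ i → lookup u i ≡ lookup v i) → u ≡ v
  lookup-ext e = Pointwise-≡⇒≡ (ext e)

  nth : List ℕ → ℕ → ℕ
  nth []      _       = 0
  nth (a ∷ z) zero    = a
  nth (a ∷ z) (suc k) = nth z k

  -- Letters are numbered from 1, and the letter 0 (as well as any letter beyond the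
  -- length of z) is sent to 0; with this convention act-act holds without hypotheses.
  act : ∀ {n} → List ℕ → Vec ℕ n → Vec ℕ n
  act z = Vec.map (nth (0 ∷ z))

  nth-toList : ∀ {n} (v : Vec ℕ n) i → nth (toList v) (toℕ i) ≡ lookup v i
  nth-toList (a ∷ v) Fin.zero    = refl
  nth-toList (a ∷ v) (Fin.suc i) = nth-toList v i

  nth-fromℕ< : ∀ {n k} (v : Vec ℕ n) (k<n : k < n) → nth (toList v) k ≡ lookup v (fromℕ< k<n)
  nth-fromℕ< v k<n = trans (cong (nth (toList v)) (sym (Fin.toℕ-fromℕ< k<n))) (nth-toList v (fromℕ< k<n))

  nth-map : ∀ (f : ℕ → ℕ) → f 0 ≡ 0 → ∀ z k → nth (map f z) k ≡ f (nth z k)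
  nth-map f f0 []      k       = sym f0
  nth-map f f0 (a ∷ z) zero    = refl
  nth-map f f0 (a ∷ z) (suc k) = nth-map f f0 z k

  nth-ext : ∀ {z z′} → length z ≡ length z′ → (∀ k → k < length z → nth z k ≡ nth z′ k) → z ≡ z′
  nth-ext {[]}    {[]}      _ _ = refl
  nth-ext {a ∷ z} {b ∷ z′} l e =
    cong₂ _∷_ (e 0 (s≤s z≤n)) (nth-ext (ℕ.suc-injective l) (λ k k< → e (suc k) (s≤s k<)))

  act-act : ∀ {m n} z (χ : Vec ℕ m) (w : Vec ℕ n) → act z (act (toList χ) w) ≡ act (toList (act z χ)) w
  act-act z χ w = trans (sym (Vec.map-∘ (nth (0 ∷ z)) (nth (0 ∷ toList χ)) w)) (Vec.map-cong step w)
    where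
    step : ∀ a → nth (0 ∷ z) (nth (0 ∷ toList χ) a) ≡ nth (0 ∷ toList (act z χ)) a
    step a = sym (trans (cong (λ l → nth (0 ∷ l) a) (Vec.toList-map (nth (0 ∷ z)) χ))
      (nth-map (nth (0 ∷ z)) refl (0 ∷ toList χ) a))

  packed-positive : ∀ {n} {u : Vec ℕ n} → Packed u → ∀ i → 1 ≤ lookup u i
  packed-positive {u = u} (_ , h) i = proj₁ (to (h _) (VecMem.∈-lookup i u))

  letter-bounds : ∀ {n} (w : PackedWord n) i → 1 ≤ lookup (letters w) i × lookup (letters w) i ≤ maxᵖ w
  letter-bounds w i = to (packed-max (packedProof w) _) (VecMem.∈-lookup i (letters w))

  letter-index : ∀ {n} (w : PackedWord n) i → ∃[ k ] lookup (letters w) i ≡ suc (toℕ {maxᵖ w} k)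
  letter-index w i = go (letter-bounds w i)
    where
    go : ∀ {a} → 1 ≤ a × a ≤ maxᵖ w → ∃[ k ] a ≡ suc (toℕ {maxᵖ w} k)
    go {suc a} (_ , a<) = fromℕ< a< , cong suc (sym (Fin.toℕ-fromℕ< a<))

  position : ∀ {n} (w : PackedWord n) → Fin (maxᵖ w) → Fin n
  position w k = VecAny.index (occurrence w k)

  lookup-position : ∀ {n} (w : PackedWord n) k → lookup (letters w) (position w k) ≡ suc (toℕ k)
  lookup-position w k = sym (VecAny.lookup-index (occurrence w k))

  maxLetter-unique : ∀ {n r} {u : Vec ℕ n} → (∀ a → (a ∈ u) ⇔ (1 ≤ a × a ≤ r)) → maxLetter u ≡ r
  maxLetter-unique {r = r} {u} h = ℕ.≤-antisym (le _ h′ h) (le _ h h′)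
    where
    h′ = packed-max (r , h)
    le : ∀ p {q} → (∀ a → (a ∈ u) ⇔ (1 ≤ a × a ≤ p)) → (∀ a → (a ∈ u) ⇔ (1 ≤ a × a ≤ q)) → p ≤ q
    le zero    _ _ = z≤n
    le (suc p) e f = proj₂ (to (f _) (from (e _) (s≤s z≤n , ℕ.≤-refl)))

  ∈-act : ∀ {n} (w : PackedWord n) (φ : Vec ℕ (maxᵖ w)) {a} → (a ∈ act (toList φ) (letters w)) ⇔ (a ∈ φ)
  ∈-act w φ {a} = mk⇔ ⇒ ⇐
    where
    ⇒ : a ∈ act (toList φ) (letters w) → a ∈ φ
    ⇒ a∈ with letter-index w (VecAny.index a∈)
    ... | k , e = subst (_∈ φ) (sym a≡) (VecMem.∈-lookup k φ)
      where
      a≡ : a ≡ lookup φ k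
      a≡ = trans (VecAny.lookup-index a∈) (trans (Vec.lookup-map (VecAny.index a∈) _ (letters w))
        (trans (cong (nth (0 ∷ toList φ)) e) (nth-toList φ k)))
    ⇐ : a ∈ φ → a ∈ act (toList φ) (letters w)
    ⇐ a∈ = subst (_∈ act (toList φ) (letters w))
      (trans (nth-toList φ _) (sym (VecAny.lookup-index a∈)))
      (VecMem.∈-map⁺ (nth (0 ∷ toList φ)) (occurrence w (VecAny.index a∈)))

  act-bounds : ∀ {n} (w : PackedWord n) (φ : PackedWord (maxᵖ w)) a →
    (a ∈ act (toList (letters φ)) (letters w)) ⇔ (1 ≤ a × a ≤ maxᵖ φ)
  act-bounds w φ a = mk⇔
    (to (packed-max (packedProof φ) a) ∘ to (∈-act w (letters φ)))
    (from (∈-act w (letters φ)) ∘ from (packed-max (packedProof φ) a))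

  -- The word φ ∘ w, when packed words are viewed as surjections.
  compose : ∀ {n} (w : PackedWord n) → PackedWord (maxᵖ w) → PackedWord n
  compose w φ = ⟨ act (toList (letters φ)) (letters w) , (maxᵖ φ , act-bounds w φ) ⟩

  max-compose : ∀ {n} (w : PackedWord n) (φ : PackedWord (maxᵖ w)) → maxᵖ (compose w φ) ≡ maxᵖ φ
  max-compose w φ = maxLetter-unique (act-bounds w φ)

  -- Every letter from 1 to max w occurs in `w`, so each entry of `z` can be read off at a position
  -- of its index.
  act-injective : ∀ {n} (w : PackedWord n) {z z′} → length z ≡ maxᵖ w → length z′ ≡ maxᵖ w →
    act z (letters w) ≡ act z′ (letters w) → z ≡ z′
  act-injective w {z} {z′} l l′ e = nth-ext (trans l (sym l′)) λ k k< → at k (fromℕ< (subst (k <_) l k<))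
      (sym (Fin.toℕ-fromℕ< (subst (k <_) l k<)))
    where
    at : ∀ k (i : Fin (maxᵖ w)) → k ≡ toℕ i → nth z k ≡ nth z′ k
    at _ i refl = trans (sym (value z)) (trans (cong (λ x → lookup x (position w i)) e) (value z′))
      where
      value : ∀ y → lookup (act y (letters w)) (position w i) ≡ nth y (toℕ i)
      value y = trans (Vec.lookup-map (position w i) _ (letters w))
        (cong (nth (0 ∷ y)) (lookup-position w i))

  compose-injective : ∀ {n} (w : PackedWord n) {φ ψ : PackedWord (maxᵖ w)} →
    compose w φ ≡ compose w ψ → φ ≡ ψ
  compose-injective w {φ} {ψ} e = letters-injective (trans (sym (Vec.cast-is-id refl _)) (Vec.toList-injective refl _ _
    (act-injective w (Vec.length-toList (letters φ)) (Vec.length-toList (letters ψ)) (cong letters e))))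

  -- The refinement word is the factor m in v = m ∘ x. Conversely such a factor forces weak
  -- refinement (`act⇒WRef`), and by `act-injective` it is unique among lists of length max x.
  act-refinementWord : ∀ {n} (v x : PackedWord n) → WRef v x →
    act (toList (refinementWord v x)) (letters x) ≡ letters v
  act-refinementWord v x v≤x = lookup-ext λ j → at j (letter-index x j)
    where
    at : ∀ j → ∃[ k ] lookup (letters x) j ≡ suc (toℕ {maxᵖ x} k) →
      lookup (act (toList (refinementWord v x)) (letters x)) j ≡ lookup (letters v) j
    at j (k , e) = begin
      lookup (act (toList (refinementWord v x)) (letters x)) j ≡⟨ Vec.lookup-map j _ (letters x) ⟩
      nth (0 ∷ toList (refinementWord v x)) (lookup (letters x) j) ≡⟨ cong (nth (0 ∷ toList (refinementWord v x))) e ⟩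
      nth (toList (refinementWord v x)) (toℕ k)  ≡⟨ nth-toList (refinementWord v x) k ⟩
      lookup (refinementWord v x) k              ≡⟨ refinementWord-lookup v x v≤x k j e ⟩
      lookup (letters v) j                       ∎
      where open ≡-Reasoning

  act⇒WRef : ∀ {n} (v x : PackedWord n) z → act z (letters x) ≡ letters v → WRef v x
  act⇒WRef v x z e i j xi≡xj = trans (sym (value i)) (trans (cong (nth (0 ∷ z)) xi≡xj) (value j))
    where
    value : ∀ i → nth (0 ∷ z) (lookup (letters x) i) ≡ lookup (letters v) i
    value i = trans (sym (Vec.lookup-map i _ (letters x))) (cong (λ u → lookup u i) e)

  refinement : ∀ {n} (v x : PackedWord n) → WRef v x → PackedWord (maxᵖ x)
  refinement v x v≤x = ⟨ refinementWord v x , refinementWord-packed v x v≤x ⟩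

  compose-refinement : ∀ {n} (v x : PackedWord n) (v≤x : WRef v x) → compose x (refinement v x v≤x) ≡ v
  compose-refinement v x v≤x = letters-injective (act-refinementWord v x v≤x)

  WRef-compose : ∀ {n} (w : PackedWord n) (φ : PackedWord (maxᵖ w)) → WRef (compose w φ) w
  WRef-compose w φ = act⇒WRef (compose w φ) w (toList (letters φ)) refl

  -- Packing and order isomorphism

  -- Unfolds to the strict order of `biletters` on the pairs (s, c) and (y, d), so that facts about
  -- packing biwords apply without conversion.
  Lex : ℕ → ℕ → ℕ → ℕ → Set
  Lex s c y d = s < y ⊎ (s ≡ y × c < d)

  lex? : ∀ s c y d → Dec (Lex s c y d)
  lex? s c y d = (s ℕ.<? y) ⊎-dec ((s ℕ.≟ y) ×-dec (c ℕ.<? d))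

  Lex-trans : ∀ {s c y d z e} → Lex s c y d → Lex y d z e → Lex s c z e
  Lex-trans (inj₁ p)          (inj₁ q)          = inj₁ (ℕ.<-trans p q)
  Lex-trans (inj₁ p)          (inj₂ (refl , _)) = inj₁ p
  Lex-trans (inj₂ (refl , _)) (inj₁ q)          = inj₁ q
  Lex-trans (inj₂ (refl , p)) (inj₂ (refl , q)) = inj₂ (refl , ℕ.<-trans p q)

  Lex-irrefl : ∀ {s c} → ¬ Lex s c s c
  Lex-irrefl (inj₁ p)       = ℕ.<-irrefl refl p
  Lex-irrefl (inj₂ (_ , p)) = ℕ.<-irrefl refl p

  Lex-resp : ∀ {s s′ c c′ y y′ d d′} → s ≡ s′ → c ≡ c′ → y ≡ y′ → d ≡ d′ → Lex s c y d → Lex s′ c′ y′ d′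
  Lex-resp refl refl refl refl l = l

  module _ {a ℓ₁ ℓ₂} (O : StrictTotalOrder a ℓ₁ ℓ₂) where
    private module O = StrictTotalOrder O
    open Packing O

    -- Strict comparisons are enough: by trichotomy they also decide which letters coincide.
    OrderIso : ∀ {n} → Vec O.Carrier n → Vec ℕ n → Set ℓ₂
    OrderIso z w = ∀ i j → (lookup w i < lookup w j) ⇔ (lookup z i O.< lookup z j)

    private
      count-mono : ∀ {b c} → (∀ {x} → x O.< b → x O.< c) → ∀ xs →
        length (filter (O._<? b) xs) ≤ length (filter (O._<? c) xs)
      count-mono         h []       = z≤n
      count-mono {b} {c} h (x ∷ xs) with x O.<? b | x O.<? c
      ... | yes _ | yes _ = s≤s (count-mono h xs)
      ... | yes p | no ¬p = contradiction (h p) ¬p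
      ... | no _  | yes _ = ℕ.m≤n⇒m≤1+n (count-mono h xs)
      ... | no _  | no _  = count-mono h xs

      count-strict : ∀ {b c} → b O.< c → ∀ {xs} → Any (O._≈ b) xs →
        length (filter (O._<? b) xs) < length (filter (O._<? c) xs)
      count-strict {b} {c} b<c {x ∷ xs} (here x≈b) with x O.<? b | x O.<? c
      ... | yes x<b | _     = contradiction x<b (O.irrefl x≈b)
      ... | no _    | yes _ = s≤s (count-mono (λ p → O.trans p b<c) xs)
      ... | no _    | no ¬p = contradiction (O.<-respˡ-≈ (O.Eq.sym x≈b) b<c) ¬p
      count-strict {b} {c} b<c {x ∷ xs} (there b∈) with x O.<? b | x O.<? c
      ... | yes _ | yes _ = s≤s (count-strict b<c b∈)
      ... | yes p | no ¬p = contradiction (O.trans p b<c) ¬p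
      ... | no _  | yes _ = ℕ.m≤n⇒m≤1+n (count-strict b<c b∈)
      ... | no _  | no _  = count-strict b<c b∈

      smaller-strict : ∀ {n} (z : Vec O.Carrier n) i {c} → lookup z i O.< c →
        smaller z (lookup z i) < smaller z c
      smaller-strict z i b<c = count-strict b<c
        (Any.deduplicate⁺ O._≟_ (λ x≈y x≈b → O.Eq.trans x≈y x≈b)
          (VecAny.toList⁺ (VecAny.map (O.Eq.reflexive ∘ sym) (VecMem.∈-lookup i z))))

      smaller-cancel : ∀ {n} (z : Vec O.Carrier n) {b c} → smaller z b < smaller z c → b O.< c
      smaller-cancel z {b} {c} lt with O.compare b c
      ... | tri< b<c _ _ = b<c
      ... | tri≈ _ b≈c _ = contradiction lt (ℕ.≤⇒≯
        (count-mono (O.<-respʳ-≈ (O.Eq.sym b≈c)) (distinctLetters z)))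
      ... | tri> _ _ c<b = contradiction lt (ℕ.≤⇒≯ (count-mono (λ p → O.trans p c<b) (distinctLetters z)))

    packVec-orderIso : ∀ {n} (z : Vec O.Carrier n) → OrderIso z (packVec z)
    packVec-orderIso z i j
      rewrite Vec.lookup-map i (λ b → suc (smaller z b)) z | Vec.lookup-map j (λ b → suc (smaller z b)) z
      = mk⇔ (λ { (s≤s lt) → smaller-cancel z lt }) (s≤s ∘ smaller-strict z i)

  -- Induction on the letter: if k + 2 occurs in `u`, so does k + 1, since a packed word has no
  -- gaps, and `mono` turns this step into an increase of `w` by at least 1.
  packed-≤ : ∀ {n} {u w : Vec ℕ n} → Packed u → Packed w →
    (∀ i j → lookup u i < lookup u j → lookup w i < lookup w j) → ∀ i → lookup u i ≤ lookup w i
  packed-≤ {u = u} {w} pu pw mono i = go _ i refl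
    where
    go : ∀ k i → lookup u i ≡ k → k ≤ lookup w i
    go zero          i e = z≤n
    go (suc zero)    i e = packed-positive pw i
    go (suc (suc k)) i e = ℕ.≤-<-trans (go (suc k) j (sym (VecAny.lookup-index ∈u)))
      (mono j i (subst₂ _<_ (VecAny.lookup-index ∈u) (sym e) ℕ.≤-refl))
      where
      bound = proj₂ (to (packed-max pu _) (subst (_∈ u) e (VecMem.∈-lookup i u)))
      ∈u : suc k ∈ u
      ∈u = from (packed-max pu _) (s≤s z≤n , ℕ.≤-trans (ℕ.n≤1+n _) bound)
      j = VecAny.index ∈u

  -- Two packed words with the same strict comparisons bound each other by `packed-≤`.
  pack-unique : ∀ {a ℓ₁ ℓ₂} (O : StrictTotalOrder a ℓ₁ ℓ₂) {n} (z : Vec (StrictTotalOrder.Carrier O) n)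
    (w : PackedWord n) → OrderIso O z (letters w) → Packing.pack O z ≡ w
  pack-unique O z w iso = letters-injective (lookup-ext λ i → ℕ.≤-antisym
    (packed-≤ pz (packedProof w) (λ i j → from (iso i j) ∘ to (packVec-orderIso O z i j)) i)
    (packed-≤ (packedProof w) pz (λ i j → from (packVec-orderIso O z i j) ∘ to (iso i j)) i))
    where pz = packedProof (Packing.pack O z)

  pack-orderIso : ∀ {a ℓ₁ ℓ₂} (O : StrictTotalOrder a ℓ₁ ℓ₂) {n} (z : Vec (StrictTotalOrder.Carrier O) n)
    (w : PackedWord n) → Packing.pack O z ≡ w → OrderIso O z (letters w)
  pack-orderIso O z w refl = packVec-orderIso O z

  -- Chain s c φ ψ: the biletters (s,c), (φ₁,ψ₁), (φ₂,ψ₂), … increase strictly.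
  Chain : ∀ {p} → ℕ → ℕ → Vec ℕ p → Vec ℕ p → Set
  Chain s c []      []      = ⊤
  Chain s c (y ∷ φ) (d ∷ ψ) = Lex s c y d × Chain y d φ ψ

  chain? : ∀ {p} s c (φ ψ : Vec ℕ p) → Dec (Chain s c φ ψ)
  chain? s c []      []      = yes tt
  chain? s c (y ∷ φ) (d ∷ ψ) = lex? s c y d ×-dec chain? y d φ ψ

  -- Index 0 reads the initial biletter (s, c) and index k ≥ 1 the k-th biletter of (φ, ψ);
  -- transitivity spreads the increase from neighbours to all pairs.
  Chain⇒mono : ∀ {p s c} (φ ψ : Vec ℕ p) → Chain s c φ ψ → ∀ {a b} → a < b → b ≤ p →
    Lex (nth (s ∷ toList φ) a) (nth (c ∷ toList ψ) a) (nth (s ∷ toList φ) b) (nth (c ∷ toList ψ) b)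
  Chain⇒mono (y ∷ φ) (d ∷ ψ) (l , ch) {zero}  {suc zero}    _         _         = l
  Chain⇒mono (y ∷ φ) (d ∷ ψ) (l , ch) {zero}  {suc (suc b)} _         (s≤s b≤p) =
    Lex-trans l (Chain⇒mono φ ψ ch {zero} (s≤s z≤n) b≤p)
  Chain⇒mono (y ∷ φ) (d ∷ ψ) (l , ch) {suc a} {suc b}       (s≤s a<b) (s≤s b≤p) = Chain⇒mono φ ψ ch a<b b≤p
  Chain⇒mono []      []      _        {_}     {zero}        ()        _
  Chain⇒mono []      []      _        {_}     {suc b}       _         ()

  mono⇒Chain : ∀ {p s c} (φ ψ : Vec ℕ p) → (∀ {a b} → a < b → b ≤ p →
    Lex (nth (s ∷ toList φ) a) (nth (c ∷ toList ψ) a) (nth (s ∷ toList φ) b) (nth (c ∷ toList ψ) b)) →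
    Chain s c φ ψ
  mono⇒Chain []      []      h = tt
  mono⇒Chain (y ∷ φ) (d ∷ ψ) h =
    h {0} {1} (s≤s z≤n) (s≤s z≤n) , mono⇒Chain φ ψ (λ a<b b≤p → h (s≤s a<b) (s≤s b≤p))

  module _ {n} (u v w : PackedWord n) where
    private
      z = zip (letters u) (letters v)

      lookup-z : ∀ i → lookup z i ≡ (lookup (letters u) i , lookup (letters v) i)
      lookup-z i = Vec.lookup-zip i (letters u) (letters v)

      LexAt : Fin n → Fin n → Set
      LexAt i j = Lex (lookup (letters u) i) (lookup (letters v) i) (lookup (letters u) j) (lookup (letters v) j)

      iso⇔ : OrderIso biletters z (letters w) ⇔ (∀ i j → (lookup (letters w) i < lookup (letters w) j) ⇔ LexAt i j)
      iso⇔ = mk⇔ (λ iso i j → subst₂ (R i j) (lookup-z i) (lookup-z j) (iso i j))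
                 (λ iso i j → subst₂ (R i j) (sym (lookup-z i)) (sym (lookup-z j)) (iso i j))
        where
        R : Fin n → Fin n → ℕ × ℕ → ℕ × ℕ → Set
        R i j (s , c) (y , d) = (lookup (letters w) i < lookup (letters w) j) ⇔ Lex s c y d

    packBiword-lex : packBiword u v ≡ w → ∀ i j → (lookup (letters w) i < lookup (letters w) j) ⇔ LexAt i j
    packBiword-lex e = to iso⇔ (pack-orderIso biletters z w e)

    packBiword-unique : (∀ i j → (lookup (letters w) i < lookup (letters w) j) ⇔ LexAt i j) → packBiword u v ≡ w
    packBiword-unique iso = pack-unique biletters z w (from iso⇔ iso)

    private
      -- Distinct biletters are comparable, and a comparison would carry over to different letters
      -- of `w`.
      equal : packBiword u v ≡ w → ∀ i j → lookup (letters w) i ≡ lookup (letters w) j →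
        lookup (letters u) i ≡ lookup (letters u) j × lookup (letters v) i ≡ lookup (letters v) j
      equal e i j wi≡wj with ℕ.<-cmp (lookup (letters u) i) (lookup (letters u) j)
      ... | tri< p _ _ = contradiction (from (packBiword-lex e i j) (inj₁ p)) (ℕ.<-irrefl wi≡wj)
      ... | tri> _ _ p = contradiction (from (packBiword-lex e j i) (inj₁ p)) (ℕ.<-irrefl (sym wi≡wj))
      ... | tri≈ _ ui≡uj _ with ℕ.<-cmp (lookup (letters v) i) (lookup (letters v) j)
      ...   | tri< p _ _ = contradiction (from (packBiword-lex e i j) (inj₂ (ui≡uj , p))) (ℕ.<-irrefl wi≡wj)
      ...   | tri> _ _ p = contradiction (from (packBiword-lex e j i) (inj₂ (sym ui≡uj , p))) (ℕ.<-irrefl (sym wi≡wj))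
      ...   | tri≈ _ vi≡vj _ = ui≡uj , vi≡vj

    packBiword⇒WRefˡ : packBiword u v ≡ w → WRef u w
    packBiword⇒WRefˡ e i j wi≡wj = proj₁ (equal e i j wi≡wj)

    packBiword⇒WRefʳ : packBiword u v ≡ w → WRef v w
    packBiword⇒WRefʳ e i j wi≡wj = proj₂ (equal e i j wi≡wj)

  module _ {n} (w : PackedWord n) (φ ψ : PackedWord (maxᵖ w)) where
    private
      u = compose w φ
      v = compose w ψ
      ω = letters w

      at : ∀ (χ : PackedWord (maxᵖ w)) i →
        lookup (letters (compose w χ)) i ≡ nth (0 ∷ toList (letters χ)) (lookup ω i)
      at χ i = Vec.lookup-map i _ ω

      Lexʷ : ℕ → ℕ → Set
      Lexʷ a b = Lex (nth (0 ∷ toList (letters φ)) a) (nth (0 ∷ toList (letters ψ)) a)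
                     (nth (0 ∷ toList (letters φ)) b) (nth (0 ∷ toList (letters ψ)) b)

    -- The biletter at a position depends only on the letter of `w` there and grows strictly with
    -- it; trichotomy gives the converse implication that `packBiword-unique` asks for.
    Chain⇒pack : Chain 0 0 (letters φ) (letters ψ) → packBiword (compose w φ) (compose w ψ) ≡ w
    Chain⇒pack ch = packBiword-unique u v w iso
      where
      mono : ∀ {i j} → lookup ω i < lookup ω j → Lexʷ (lookup ω i) (lookup ω j)
      mono {i} {j} lt = Chain⇒mono (letters φ) (letters ψ) ch lt (proj₂ (letter-bounds w j))
      reflect : ∀ {i j} → Lexʷ (lookup ω i) (lookup ω j) → lookup ω i < lookup ω j
      reflect {i} {j} l with ℕ.<-cmp (lookup ω i) (lookup ω j)
      ... | tri< p _ _ = p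
      ... | tri≈ _ e _ = contradiction (subst (λ a → Lexʷ a (lookup ω j)) e l) Lex-irrefl
      ... | tri> _ _ p = contradiction (Lex-trans l (mono {j} {i} p)) Lex-irrefl
      iso : ∀ i j → (lookup ω i < lookup ω j) ⇔ Lex (lookup (letters u) i) (lookup (letters v) i)
                                                   (lookup (letters u) j) (lookup (letters v) j)
      iso i j = mk⇔
        (λ lt → Lex-resp (sym (at φ i)) (sym (at ψ i)) (sym (at φ j)) (sym (at ψ j)) (mono {i} {j} lt))
        (λ l → reflect {i} {j} (Lex-resp (at φ i) (at ψ i) (at φ j) (at ψ j) l))

    pack⇒Chain : packBiword (compose w φ) (compose w ψ) ≡ w → Chain 0 0 (letters φ) (letters ψ)
    pack⇒Chain e = mono⇒Chain (letters φ) (letters ψ) mono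
      where
      value : ∀ χ (k : Fin (maxᵖ w)) →
        lookup (letters (compose w χ)) (position w k) ≡ nth (toList (letters χ)) (toℕ k)
      value χ k = trans (at χ (position w k)) (cong (nth (0 ∷ toList (letters χ))) (lookup-position w k))
      mono-at : ∀ (k l : Fin (maxᵖ w)) → toℕ k < toℕ l → Lexʷ (suc (toℕ k)) (suc (toℕ l))
      mono-at k l k<l = Lex-resp (value φ k) (value ψ k) (value φ l) (value ψ l)
        (to (packBiword-lex u v w e (position w k) (position w l))
          (subst₂ _<_ (sym (lookup-position w k)) (sym (lookup-position w l)) (s≤s k<l)))
      mono : ∀ {a b} → a < b → b ≤ maxᵖ w → Lexʷ a b
      -- Index 0 carries the initial biletter (0, 0), which lies below all others because the
      -- letters of `φ` are positive.
      mono {zero}  {suc b} _         b< = inj₁ (subst (1 ≤_) (sym (nth-fromℕ< (letters φ) b<))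
        (packed-positive (packedProof φ) (fromℕ< b<)))
      mono {suc a} {suc b} (s≤s a<b) b< = subst₂ (λ a b → Lexʷ (suc a) (suc b))
        (Fin.toℕ-fromℕ< a<) (Fin.toℕ-fromℕ< b<)
        (mono-at (fromℕ< a<) (fromℕ< b<)
          (subst₂ _<_ (sym (Fin.toℕ-fromℕ< a<)) (sym (Fin.toℕ-fromℕ< b<)) a<b))
        where a< = ℕ.<-trans a<b b<

  -- Nondecreasing packed words of length p, that is, compositions of p

  NonDecreasing : ∀ {p} → ℕ → Vec ℕ p → Set
  NonDecreasing s []      = ⊤
  NonDecreasing s (y ∷ φ) = s ≤ y × NonDecreasing y φ

  nonDecreasing? : ∀ {p} s (φ : Vec ℕ p) → Dec (NonDecreasing s φ)
  nonDecreasing? s []      = yes tt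
  nonDecreasing? s (y ∷ φ) = (s ℕ.≤? y) ×-dec nonDecreasing? y φ

  Chain⇒NonDecreasing : ∀ {p s c} (φ ψ : Vec ℕ p) → Chain s c φ ψ → NonDecreasing s φ
  Chain⇒NonDecreasing []      []      _                      = tt
  Chain⇒NonDecreasing (y ∷ φ) (d ∷ ψ) (inj₁ s<y , ch)        = ℕ.<⇒≤ s<y , Chain⇒NonDecreasing φ ψ ch
  Chain⇒NonDecreasing (y ∷ φ) (d ∷ ψ) (inj₂ (refl , _) , ch) = ℕ.≤-refl , Chain⇒NonDecreasing φ ψ ch

  nonDecreasing-≤ : ∀ {p s a} {φ : Vec ℕ p} → NonDecreasing s φ → a ∈ φ → s ≤ a
  nonDecreasing-≤ (s≤y , _)  (VecAny.here refl) = s≤y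
  nonDecreasing-≤ (s≤y , nd) (VecAny.there a∈)  = ℕ.≤-trans s≤y (nonDecreasing-≤ nd a∈)

  -- A composition is encoded by numbering its blocks and writing at each position the number of its
  -- block: a letter equal to `s` prolongs the current block, `suc s` opens the next one.
  Steps : ∀ {p} → ℕ → Vec ℕ p → Set
  Steps s []      = ⊤
  Steps s (y ∷ φ) = (y ≡ s ⊎ y ≡ suc s) × Steps y φ

  lastLetter : ∀ {p} → ℕ → Vec ℕ p → ℕ
  lastLetter s []      = s
  lastLetter s (y ∷ φ) = lastLetter y φ

  Steps-≤last : ∀ {p s} (φ : Vec ℕ p) → Steps s φ → s ≤ lastLetter s φ
  Steps-≤last []      _                = ℕ.≤-refl
  Steps-≤last (y ∷ φ) (inj₁ refl , st) = Steps-≤last φ st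
  Steps-≤last (y ∷ φ) (inj₂ refl , st) = ℕ.<⇒≤ (Steps-≤last φ st)

  Steps-∈⁻ : ∀ {p s a} {φ : Vec ℕ p} → Steps s φ → a ∈ φ → s ≤ a × a ≤ lastLetter s φ
  Steps-∈⁻ {φ = y ∷ φ} (inj₁ refl , st) (VecAny.here refl) = ℕ.≤-refl , Steps-≤last φ st
  Steps-∈⁻ {φ = y ∷ φ} (inj₂ refl , st) (VecAny.here refl) = ℕ.n≤1+n _ , Steps-≤last φ st
  Steps-∈⁻ {φ = y ∷ φ} (inj₁ refl , st) (VecAny.there a∈)  = Steps-∈⁻ st a∈
  Steps-∈⁻ {φ = y ∷ φ} (inj₂ refl , st) (VecAny.there a∈)  =
    let s<a , a≤l = Steps-∈⁻ st a∈ in ℕ.<⇒≤ s<a , a≤l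

  Steps-∈⁺ : ∀ {p s a} {φ : Vec ℕ p} → Steps s φ → s < a → a ≤ lastLetter s φ → a ∈ φ
  Steps-∈⁺ {φ = []}    _                s<a a≤l = contradiction (ℕ.<-≤-trans s<a a≤l) (ℕ.<-irrefl refl)
  Steps-∈⁺ {φ = y ∷ φ} (inj₁ refl , st) s<a a≤l = VecAny.there (Steps-∈⁺ st s<a a≤l)
  Steps-∈⁺ {φ = y ∷ φ} (inj₂ refl , st) s<a a≤l with ℕ.m≤n⇒m<n∨m≡n s<a
  ... | inj₁ y<a  = VecAny.there (Steps-∈⁺ st y<a a≤l)
  ... | inj₂ refl = VecAny.here refl

  stepsFrom : ℕ → (p : ℕ) → List (Vec ℕ p)
  stepsFrom s zero    = [] ∷ []
  stepsFrom s (suc p) = map (s ∷_) (stepsFrom s p) ++ map (suc s ∷_) (stepsFrom (suc s) p)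

  ∈-stepsFrom : ∀ {p s} (φ : Vec ℕ p) → (φ ∈ˡ stepsFrom s p) ⇔ Steps s φ
  ∈-stepsFrom φ = mk⇔ (⇒ φ) (⇐ φ)
    where
    ⇒ : ∀ {p s} (φ : Vec ℕ p) → φ ∈ˡ stepsFrom s p → Steps s φ
    ⇒ []      _  = tt
    ⇒ {suc p} {s} (y ∷ φ) y∈ with ∈-++⁻ (map (s ∷_) (stepsFrom s p)) y∈
    ... | inj₁ ∈ˢ with ∈-map⁻ _ ∈ˢ
    ...   | _ , φ∈ , refl = inj₁ refl , ⇒ φ φ∈
    ⇒ {suc p} {s} (y ∷ φ) y∈ | inj₂ ∈ˢ with ∈-map⁻ _ ∈ˢ
    ...   | _ , φ∈ , refl = inj₂ refl , ⇒ φ φ∈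
    ⇐ : ∀ {p s} (φ : Vec ℕ p) → Steps s φ → φ ∈ˡ stepsFrom s p
    ⇐ []      _                = here refl
    ⇐ (y ∷ φ) (inj₁ refl , st) = ∈-++⁺ˡ (∈-map⁺ (y ∷_) (⇐ φ st))
    ⇐ {suc p} {s} (y ∷ φ) (inj₂ refl , st) = ∈-++⁺ʳ (map (s ∷_) (stepsFrom s p)) (∈-map⁺ (y ∷_) (⇐ φ st))

  stepsFrom-unique : ∀ p s → Unique (stepsFrom s p)
  stepsFrom-unique zero    s = [] ∷ []
  stepsFrom-unique (suc p) s = Unique.++⁺
    (Unique.map⁺ Vec.∷-injectiveʳ (stepsFrom-unique p s))
    (Unique.map⁺ Vec.∷-injectiveʳ (stepsFrom-unique p (suc s)))
    (λ (∈₁ , ∈₂) → disjoint ∈₁ ∈₂)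
    where
    disjoint : ∀ {φ} → φ ∈ˡ map (s ∷_) (stepsFrom s p) → ¬ (φ ∈ˡ map (suc s ∷_) (stepsFrom (suc s) p))
    disjoint ∈₁ ∈₂ with ∈-map⁻ _ ∈₁ | ∈-map⁻ _ ∈₂
    ... | _ , _ , refl | _ , _ , e = ℕ.1+n≢n (sym (Vec.∷-injectiveˡ e))

  -- The first position opens block 1. Starting from `stepsFrom 0` would admit words with letter 0,
  -- which are not packed.
  compositions : (p : ℕ) → List (Vec ℕ p)
  compositions zero    = [] ∷ []
  compositions (suc p) = map (1 ∷_) (stepsFrom 1 p)

  compositions-unique : ∀ p → Unique (compositions p)
  compositions-unique zero    = [] ∷ []
  compositions-unique (suc p) = Unique.map⁺ Vec.∷-injectiveʳ (stepsFrom-unique p 1)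

  ∈-compositions⁻ : ∀ {p} {φ : Vec ℕ p} → φ ∈ˡ compositions p → Steps 0 φ × (∀ {a} → a ∈ φ → 1 ≤ a)
  ∈-compositions⁻ {zero}  {[]}    _  = tt , λ ()
  ∈-compositions⁻ {suc p} {_ ∷ _} φ∈ with ∈-map⁻ (1 ∷_) φ∈
  ... | φ′ , φ′∈ , refl = (inj₂ refl , st) , pos
    where
    st = to (∈-stepsFrom φ′) φ′∈
    pos : ∀ {a} → a ∈ 1 ∷ φ′ → 1 ≤ a
    pos (VecAny.here refl) = s≤s z≤n
    pos (VecAny.there a∈)  = proj₁ (Steps-∈⁻ st a∈)

  composition-letters : ∀ {p} {φ : Vec ℕ p} → φ ∈ˡ compositions p →
    ∀ a → (a ∈ φ) ⇔ (1 ≤ a × a ≤ lastLetter 0 φ)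
  composition-letters φ∈ a = mk⇔ (λ a∈ → pos a∈ , proj₂ (Steps-∈⁻ st a∈)) (λ (0<a , a≤l) → Steps-∈⁺ st 0<a a≤l)
    where
    st = proj₁ (∈-compositions⁻ φ∈)
    pos = proj₂ (∈-compositions⁻ φ∈)

  Steps⇒NonDecreasing : ∀ {p s} (φ : Vec ℕ p) → Steps s φ → NonDecreasing s φ
  Steps⇒NonDecreasing []      _                = tt
  Steps⇒NonDecreasing (y ∷ φ) (inj₁ refl , st) = ℕ.≤-refl , Steps⇒NonDecreasing φ st
  Steps⇒NonDecreasing (y ∷ φ) (inj₂ refl , st) = ℕ.n≤1+n _ , Steps⇒NonDecreasing φ st

  gapless⇒Steps : ∀ {p s} (φ : Vec ℕ p) → NonDecreasing s φ →
    (∀ {a b} → b ∈ φ → s < a → a ≤ b → a ∈ φ) → Steps s φ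
  gapless⇒Steps []      _          _ = tt
  gapless⇒Steps {s = s} (y ∷ φ) (s≤y , nd) h = step , gapless⇒Steps φ nd tail
    where
    step : y ≡ s ⊎ y ≡ suc s
    step with ℕ.m≤n⇒m<n∨m≡n s≤y
    ... | inj₂ e   = inj₁ (sym e)
    ... | inj₁ s<y with h (VecAny.here refl) (ℕ.n<1+n s) s<y
    ...   | VecAny.here e   = inj₂ (sym e)
    -- Here s + 1 occurs after `y`, and the letters after `y` are at least `y`, so y ≤ s + 1.
    ...   | VecAny.there s∈ = inj₂ (ℕ.≤-antisym (nonDecreasing-≤ nd s∈) s<y)
    tail : ∀ {a b} → b ∈ φ → y < a → a ≤ b → a ∈ φ
    tail b∈ y<a a≤b with h (VecAny.there b∈) (ℕ.≤-<-trans s≤y y<a) a≤b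
    ... | VecAny.here e   = contradiction y<a (ℕ.<-irrefl (sym e))
    ... | VecAny.there a∈ = a∈

  ∈-compositions⁺ : ∀ {p} (φ : PackedWord p) → NonDecreasing 0 (letters φ) → letters φ ∈ˡ compositions p
  ∈-compositions⁺ φ nd = start (letters φ) (gapless⇒Steps (letters φ) nd gapless)
      (λ a∈ → proj₁ (to (packed-max (packedProof φ) _) a∈))
    where
    gapless : ∀ {a b} → b ∈ letters φ → 0 < a → a ≤ b → a ∈ letters φ
    gapless b∈ 0<a a≤b = from (packed-max (packedProof φ) _)
      (0<a , ℕ.≤-trans a≤b (proj₂ (to (packed-max (packedProof φ) _) b∈)))
    start : ∀ {p} (φ : Vec ℕ p) → Steps 0 φ → (∀ {a} → a ∈ φ → 1 ≤ a) → φ ∈ˡ compositions p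
    start []      _                _   = here refl
    start (y ∷ φ) (inj₁ refl , st) pos = contradiction (pos (VecAny.here refl)) λ ()
    start (y ∷ φ) (inj₂ refl , st) _   = ∈-map⁺ (1 ∷_) (from (∈-stepsFrom φ) st)

  compositionWord : ∀ {p} {φ : Vec ℕ p} → φ ∈ˡ compositions p → PackedWord p
  compositionWord {φ = φ} φ∈ = ⟨ φ , (lastLetter 0 φ , composition-letters φ∈) ⟩

  max-composition : ∀ {p} {φ : Vec ℕ p} → φ ∈ˡ compositions p → maxLetter φ ≡ lastLetter 0 φ
  max-composition φ∈ = maxLetter-unique (composition-letters φ∈)

  -- Constancy of a word on the blocks of a composition

  BlockConstant : ∀ {p} → ℕ → ℕ → Vec ℕ p → Vec ℕ p → Set
  BlockConstant s c []      []      = ⊤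
  BlockConstant s c (y ∷ χ) (d ∷ ψ) = (y ≡ s → d ≡ c) × BlockConstant y d χ ψ

  blockConstant? : ∀ {p} s c (χ ψ : Vec ℕ p) → Dec (BlockConstant s c χ ψ)
  blockConstant? s c []      []      = yes tt
  blockConstant? s c (y ∷ χ) (d ∷ ψ) = ((y ℕ.≟ s) →-dec (d ℕ.≟ c)) ×-dec blockConstant? y d χ ψ

  -- One letter of ψ for each newly opened block of χ. For ψ constant on the blocks this is the
  -- refinement word of the pair, in a form that follows the recursion on χ
  -- (`refinementWord-blockHeads`).
  blockHeads : ∀ {p} → ℕ → Vec ℕ p → Vec ℕ p → List ℕ
  blockHeads s []      []      = []
  blockHeads s (y ∷ χ) (d ∷ ψ) with y ℕ.≟ s
  ... | yes _ = blockHeads s χ ψ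
  ... | no _  = d ∷ blockHeads y χ ψ

  length-blockHeads : ∀ {p s} (χ ψ : Vec ℕ p) → Steps s χ → length (blockHeads s χ ψ) ℕ.+ s ≡ lastLetter s χ
  length-blockHeads         []      []      _        = refl
  length-blockHeads {s = s} (y ∷ χ) (d ∷ ψ) (y≡ , st) with y ℕ.≟ s
  ... | yes refl = length-blockHeads χ ψ st
  length-blockHeads {s = s} (y ∷ χ) (d ∷ ψ) (inj₁ y≡s , st)  | no y≢s = contradiction y≡s y≢s
  length-blockHeads {s = s} (y ∷ χ) (d ∷ ψ) (inj₂ refl , st) | no _   =
    trans (sym (ℕ.+-suc _ s)) (length-blockHeads χ ψ st)

  -- The letter `c` in front stands for the block `s` that is already open, so a block is found at
  -- its number minus `s`. For s = 0 and c = 0 the list becomes the one with leading 0 used by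
  -- `act`.
  nth-blockHeads : ∀ {p s c} (χ ψ : Vec ℕ p) → Steps s χ → BlockConstant s c χ ψ →
    ∀ i → nth (c ∷ blockHeads s χ ψ) (lookup χ i ∸ s) ≡ lookup ψ i
  nth-blockHeads {s = s} {c} (y ∷ χ) (d ∷ ψ) (y≡ , st) (d≡ , bc) i with y ℕ.≟ s
  nth-blockHeads {s = s} {c} (y ∷ χ) (d ∷ ψ) (y≡ , st) (d≡ , bc) Fin.zero | yes refl
    rewrite ℕ.n∸n≡0 y = sym (d≡ refl)
  nth-blockHeads {s = s} {c} (y ∷ χ) (d ∷ ψ) (y≡ , st) (d≡ , bc) (Fin.suc i) | yes refl
    rewrite sym (d≡ refl) = nth-blockHeads χ ψ st bc i
  nth-blockHeads {s = s} {c} (y ∷ χ) (d ∷ ψ) (inj₁ y≡s , st) (d≡ , bc) i | no y≢s = contradiction y≡s y≢s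
  nth-blockHeads {s = s} {c} (y ∷ χ) (d ∷ ψ) (inj₂ refl , st) (d≡ , bc) Fin.zero | no _
    rewrite ℕ.m+n∸n≡m 1 s = refl
  nth-blockHeads {s = s} {c} (y ∷ χ) (d ∷ ψ) (inj₂ refl , st) (d≡ , bc) (Fin.suc i) | no _ =
    trans (cong (nth (c ∷ d ∷ blockHeads y χ ψ)) (ℕ.+-∸-assoc 1 y≤))
      (nth-blockHeads χ ψ st bc i)
    where
    y≤ : suc s ≤ lookup χ i
    y≤ = proj₁ (Steps-∈⁻ st (VecMem.∈-lookup i χ))

  act-blockHeads : ∀ {p} {χ ψ : Vec ℕ p} → Steps 0 χ → BlockConstant 0 0 χ ψ →
    act (blockHeads 0 χ ψ) χ ≡ ψ
  act-blockHeads {χ = χ} {ψ} st bc =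
    lookup-ext λ i → trans (Vec.lookup-map i _ χ) (nth-blockHeads χ ψ st bc i)

  blockConstant : ∀ {p s c} (χ ψ : Vec ℕ p) → (∀ i → lookup χ i ≡ s → lookup ψ i ≡ c) →
    (∀ i j → lookup χ i ≡ lookup χ j → lookup ψ i ≡ lookup ψ j) → BlockConstant s c χ ψ
  blockConstant []      []      _ _ = tt
  blockConstant (y ∷ χ) (d ∷ ψ) h₀ h =
    h₀ Fin.zero , blockConstant χ ψ (λ i → h (Fin.suc i) Fin.zero) (λ i j → h (Fin.suc i) (Fin.suc j))

  length-blockHeads-≤ : ∀ {p} s (χ ψ : Vec ℕ p) → length (blockHeads s χ ψ) ≤ p
  length-blockHeads-≤ s []      []      = z≤n
  length-blockHeads-≤ s (y ∷ χ) (d ∷ ψ) with y ℕ.≟ s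
  ... | yes _ = ℕ.m≤n⇒m≤1+n (length-blockHeads-≤ s χ ψ)
  ... | no _  = s≤s (length-blockHeads-≤ y χ ψ)

  module _ {n} (w : PackedWord n) (ψ : PackedWord (maxᵖ w)) {χ : Vec ℕ (maxᵖ w)}
    (χ∈ : χ ∈ˡ compositions (maxᵖ w)) where

    private
      χᵖ = compositionWord χ∈
      v  = compose w ψ
      x  = compose w χᵖ
      st = proj₁ (∈-compositions⁻ χ∈)

      length-v : length (toList (letters ψ)) ≡ maxᵖ w
      length-v = Vec.length-toList (letters ψ)

      act-χ : ∀ z → act z (letters x) ≡ letters v → act z χ ≡ letters ψ
      act-χ z e = trans (sym (Vec.cast-is-id refl _)) (Vec.toList-injective refl _ _
        (act-injective w (Vec.length-toList (act z χ)) length-v (trans (sym (act-act z χ (letters w))) e)))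

      act-x : ∀ z → act z χ ≡ letters ψ → act z (letters x) ≡ letters v
      act-x z e = trans (act-act z χ (letters w)) (cong (λ u → act (toList u) (letters w)) e)

    WRef⇒BlockConstant : WRef v x → BlockConstant 0 0 χ (letters ψ)
    WRef⇒BlockConstant v≤x = blockConstant χ (letters ψ)
      -- The letters of χ are positive, so the condition on the fictitious block 0 is vacuous.
      (λ i e → contradiction (packed-positive (packedProof χᵖ) i) (λ 1≤ → ℕ.<-irrefl refl (subst (1 ≤_) e 1≤)))
      (act⇒WRef ψ χᵖ _ (act-χ (toList (refinementWord v x)) (act-refinementWord v x v≤x)))

    BlockConstant⇒WRef : BlockConstant 0 0 χ (letters ψ) → WRef v x
    BlockConstant⇒WRef bc = act⇒WRef v x (blockHeads 0 χ (letters ψ)) (act-x _ (act-blockHeads st bc))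

    -- Both lists have one entry per block and give ψ when composed with χ; as χ is surjective onto
    -- its block numbers, they agree.
    refinementWord-blockHeads : BlockConstant 0 0 χ (letters ψ) →
      toList (refinementWord v x) ≡ blockHeads 0 χ (letters ψ)
    refinementWord-blockHeads bc = act-injective χᵖ
      (trans (Vec.length-toList (refinementWord v x)) (max-compose w χᵖ))
      (trans (sym (ℕ.+-identityʳ _)) (trans (length-blockHeads χ (letters ψ) st) (sym (max-composition χ∈))))
      (trans (act-χ _ (act-refinementWord v x (BlockConstant⇒WRef bc))) (sym (act-blockHeads st bc)))

  infix 4 _≟ᵖ_

  _≟ᵖ_ : ∀ {n} → DecidableEquality (PackedWord n)
  u ≟ᵖ w = map′ letters-injective (cong letters) (Vec.≡-dec ℕ._≟_ (letters u) (letters w))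

  -- Packing words of positive integers

  packℕ : ∀ {n} → Vec ℕ n → PackedWord n
  packℕ = Packing.pack ℕ.<-strictTotalOrder

  Chain-resp : ∀ {p s c c′} (χ a a′ : Vec ℕ p) → (∀ i → c < lookup a i → c′ < lookup a′ i) →
    (∀ i j → lookup a i < lookup a j → lookup a′ i < lookup a′ j) → Chain s c χ a → Chain s c′ χ a′
  Chain-resp []      []      []        _  _ _             = tt
  Chain-resp (y ∷ χ) (d ∷ a) (d′ ∷ a′) h₀ h (inj₁ s<y , ch) =
    inj₁ s<y , Chain-resp χ a a′ (λ i → h Fin.zero (Fin.suc i)) (λ i j → h (Fin.suc i) (Fin.suc j)) ch
  Chain-resp (y ∷ χ) (d ∷ a) (d′ ∷ a′) h₀ h (inj₂ (e , c<d) , ch) =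
    inj₂ (e , h₀ Fin.zero c<d) ,
    Chain-resp χ a a′ (λ i → h Fin.zero (Fin.suc i)) (λ i j → h (Fin.suc i) (Fin.suc j)) ch

  -- A constant top row leaves a single block, on which the bottom row must increase strictly from
  -- 0. In this form the count of chains also yields the count of increasing words.
  Increasing : ∀ {r} → Vec ℕ r → Set
  Increasing {r} = Chain 0 0 (replicate r 0)

  increasing? : ∀ {r} (θ : Vec ℕ r) → Dec (Increasing θ)
  increasing? {r} = chain? 0 0 (replicate r 0)

  nth-zeros : ∀ r a → nth (0 ∷ toList (replicate r 0)) a ≡ 0
  nth-zeros r       zero    = refl
  nth-zeros zero    (suc a) = refl
  nth-zeros (suc r) (suc a) = nth-zeros r a

  Increasing⇒mono : ∀ {r} (θ : Vec ℕ r) → Increasing θ → ∀ {a b} → a < b → b ≤ r →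
    nth (0 ∷ toList θ) a < nth (0 ∷ toList θ) b
  Increasing⇒mono {r} θ inc {a} {b} a<b b≤r
    with Lex-resp (nth-zeros r a) refl (nth-zeros r b) refl (Chain⇒mono (replicate r 0) θ inc a<b b≤r)
  ... | inj₂ (_ , lt) = lt

  mono⇒Increasing : ∀ {r} (θ : Vec ℕ r) → (∀ {a b} → a < b → b ≤ r →
    nth (0 ∷ toList θ) a < nth (0 ∷ toList θ) b) → Increasing θ
  mono⇒Increasing {r} θ mono = mono⇒Chain (replicate r 0) θ λ {a} {b} a<b b≤r →
    Lex-resp (sym (nth-zeros r a)) refl (sym (nth-zeros r b)) refl (inj₂ (refl , mono a<b b≤r))

  module _ {p} (μ : PackedWord p) where

    -- Together with `act-values` and `values-increasing`: the words of positive integers that pack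
    -- to `μ` are the words θ ∘ μ with θ strictly increasing.
    packℕ-act : ∀ (θ : Vec ℕ (maxᵖ μ)) → Increasing θ → packℕ (act (toList θ) (letters μ)) ≡ μ
    packℕ-act θ inc = pack-unique ℕ.<-strictTotalOrder _ μ iso
      where
      a = act (toList θ) (letters μ)
      at : ∀ i → lookup a i ≡ nth (0 ∷ toList θ) (lookup (letters μ) i)
      at i = Vec.lookup-map i _ (letters μ)
      mono : ∀ i j → lookup (letters μ) i < lookup (letters μ) j → lookup a i < lookup a j
      mono i j lt = subst₂ _<_ (sym (at i)) (sym (at j))
        (Increasing⇒mono θ inc lt (proj₂ (letter-bounds μ j)))
      iso : OrderIso ℕ.<-strictTotalOrder a (letters μ)
      iso i j = mk⇔ (mono i j) reflect
        where
        reflect : lookup a i < lookup a j → lookup (letters μ) i < lookup (letters μ) j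
        reflect lt with ℕ.<-cmp (lookup (letters μ) i) (lookup (letters μ) j)
        ... | tri< l _ _ = l
        ... | tri≈ _ e _ = contradiction lt (ℕ.<-irrefl
          (trans (at i) (trans (cong (nth (0 ∷ toList θ)) e) (sym (at j)))))
        ... | tri> _ _ l = contradiction (ℕ.<-trans lt (mono j i l)) (ℕ.<-irrefl refl)

    module _ (a : Vec ℕ p) (pack≡ : packℕ a ≡ μ) where
      private
        iso : OrderIso ℕ.<-strictTotalOrder a (letters μ)
        iso = pack-orderIso ℕ.<-strictTotalOrder a μ pack≡

      values : Vec ℕ (maxᵖ μ)
      values = tabulate (λ k → lookup a (position μ k))

      private
        nth-values : ∀ k → nth (toList values) (toℕ k) ≡ lookup a (position μ k)
        nth-values k = trans (nth-toList values k) (Vec.lookup∘tabulate _ k)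

        same : ∀ i j → lookup (letters μ) i ≡ lookup (letters μ) j → lookup a i ≡ lookup a j
        same i j e with ℕ.<-cmp (lookup a i) (lookup a j)
        ... | tri< l _ _ = contradiction (from (iso i j) l) (ℕ.<-irrefl e)
        ... | tri≈ _ e′ _ = e′
        ... | tri> _ _ l = contradiction (from (iso j i) l) (ℕ.<-irrefl (sym e))

      act-values : a ≡ act (toList values) (letters μ)
      act-values = lookup-ext λ i → trans (at i (letter-index μ i)) (sym (Vec.lookup-map i _ (letters μ)))
        where
        at : ∀ i → ∃[ k ] lookup (letters μ) i ≡ suc (toℕ {maxᵖ μ} k) →
          lookup a i ≡ nth (0 ∷ toList values) (lookup (letters μ) i)
        at i (k , e) = trans (same i (position μ k) (trans e (sym (lookup-position μ k))))
          (trans (sym (nth-values k)) (cong (nth (0 ∷ toList values)) (sym e)))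

      values-increasing : (∀ i → 0 < lookup a i) → Increasing values
      values-increasing pos = mono⇒Increasing values mono
        where
        mono-at : ∀ k l → toℕ k < toℕ l → nth (toList values) (toℕ k) < nth (toList values) (toℕ l)
        mono-at k l k<l = subst₂ _<_ (sym (nth-values k)) (sym (nth-values l))
          (to (iso _ _) (subst₂ _<_ (sym (lookup-position μ k)) (sym (lookup-position μ l)) (s≤s k<l)))
        mono : ∀ {a b} → a < b → b ≤ maxᵖ μ → nth (0 ∷ toList values) a < nth (0 ∷ toList values) b
        mono {zero}  {suc b} _         b< = subst (λ k → 0 < nth (toList values) k) (Fin.toℕ-fromℕ< b<)
          (subst (0 <_) (sym (nth-values (fromℕ< b<))) (pos _))
        mono {suc a} {suc b} (s≤s a<b) b< = subst₂ (λ a b → nth (toList values) a < nth (toList values) b)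
          (Fin.toℕ-fromℕ< a<) (Fin.toℕ-fromℕ< b<)
          (mono-at (fromℕ< a<) (fromℕ< b<)
            (subst₂ _<_ (sym (Fin.toℕ-fromℕ< a<)) (sym (Fin.toℕ-fromℕ< b<)) a<b))
          where a< = ℕ.<-trans a<b b<

      -- Packing preserves the strict comparisons between letters, and positivity on both sides
      -- preserves those with the initial 0.
      chain-packℕ : (∀ i → 0 < lookup a i) → ∀ χ → Chain 0 0 χ a ⇔ Chain 0 0 χ (letters μ)
      chain-packℕ pos χ = mk⇔
        (Chain-resp χ a (letters μ) (λ i _ → packed-positive (packedProof μ) i) (λ i j → from (iso i j)))
        (Chain-resp χ (letters μ) a (λ i _ → pos i) (λ i j → to (iso i j)))

  ∈-wordsOver⁻ : ∀ {as n} {u : Vec ℕ n} → u ∈ˡ wordsOver as n → ∀ {a} → a ∈ u → a ∈ˡ as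
  ∈-wordsOver⁻ {as} {suc n} u∈ a∈ with ∈-cartesianProductWith⁻ _∷_ as (wordsOver as n) u∈
  ∈-wordsOver⁻ {as} {suc n} u∈ (VecAny.here refl) | x , v , x∈ , v∈ , refl = x∈
  ∈-wordsOver⁻ {as} {suc n} u∈ (VecAny.there a∈)    | x , v , x∈ , v∈ , refl = ∈-wordsOver⁻ v∈ a∈

open Words

-- Polynomials: coefficients of products, values, and roots at natural numbers

module Polynomials {c ℓ} (R : CommutativeRing c ℓ) where
  open CommutativeRing R hiding (zero)
  open Sums R
  open Polynomial rawRing
  open import Relation.Binary.Reasoning.Setoid setoid
  open RingProperties ring using (-1*x≈-x; +-cancelˡ; +-cancelʳ)
  open SemiringMult semiring using (×-homo-+) renaming (_×_ to _×ᴷ_)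
  open SemiringSolver commutativeSemiring using (solve; _:+_; _:*_; _:=_; con)

  coeff-+ : ∀ p q k → coeff (p +ᵖ q) k ≈ coeff p k + coeff q k
  coeff-+ []      q       k       = sym (+-identityˡ _)
  coeff-+ (a ∷ p) []      k       = sym (+-identityʳ _)
  coeff-+ (a ∷ p) (b ∷ q) zero    = refl
  coeff-+ (a ∷ p) (b ∷ q) (suc k) = coeff-+ p q k

  coeff-scale : ∀ a p k → coeff (scale a p) k ≈ a * coeff p k
  coeff-scale a []      k       = sym (zeroʳ a)
  coeff-scale a (b ∷ p) zero    = refl
  coeff-scale a (b ∷ p) (suc k) = coeff-scale a p k

  coeff-∑ : ∀ {a} {A : Set a} (xs : List A) (f : A → Poly) k →
    coeff (∑ R[t] xs f) k ≈ Σᴿ xs (λ x → coeff (f x) k)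
  coeff-∑ []       f k = refl
  coeff-∑ (x ∷ xs) f k = trans (coeff-+ (f x) _ k) (+-congˡ (coeff-∑ xs f k))

  coeff-∷*-zero : ∀ a p q → coeff ((a ∷ p) *ᵖ q) 0 ≈ a * coeff q 0
  coeff-∷*-zero a p q = trans (coeff-+ (scale a q) _ 0)
    (trans (+-cong (coeff-scale a q 0) refl) (+-identityʳ _))

  coeff-∷*-suc : ∀ a p q k → coeff ((a ∷ p) *ᵖ q) (suc k) ≈ a * coeff q (suc k) + coeff (p *ᵖ q) k
  coeff-∷*-suc a p q k = trans (coeff-+ (scale a q) _ (suc k)) (+-congʳ (coeff-scale a q (suc k)))

  coeff-*-constant : ∀ p a k → coeff (p *ᵖ constant a) k ≈ coeff p k * a
  coeff-*-constant []      a k       = sym (zeroˡ a)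
  coeff-*-constant (b ∷ p) a zero    = coeff-∷*-zero b p (constant a)
  coeff-*-constant (b ∷ p) a (suc k) = trans (coeff-∷*-suc b p (constant a) k)
    (trans (+-cong (zeroʳ b) (coeff-*-constant p a k)) (+-identityˡ _))

  coeff-*-0 : ∀ p k → coeff (p *ᵖ []) k ≈ 0#
  coeff-*-0 []      k       = refl
  coeff-*-0 (b ∷ p) zero    = trans (coeff-∷*-zero b p []) (zeroʳ b)
  coeff-*-0 (b ∷ p) (suc k) = trans (coeff-∷*-suc b p [] k)
    (trans (+-cong (zeroʳ b) (coeff-*-0 p k)) (+-identityˡ _))

  coeff-*-linear-zero : ∀ p a b → coeff (p *ᵖ (a ∷ b ∷ [])) 0 ≈ coeff p 0 * a
  coeff-*-linear-zero []      a b = sym (zeroˡ a)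
  coeff-*-linear-zero (d ∷ p) a b = coeff-∷*-zero d p (a ∷ b ∷ [])

  coeff-*-linear-suc : ∀ p a b k →
    coeff (p *ᵖ (a ∷ b ∷ [])) (suc k) ≈ coeff p k * b + coeff p (suc k) * a
  coeff-*-linear-suc []      a b k       = sym (trans (+-cong (zeroˡ b) (zeroˡ a)) (+-identityˡ _))
  coeff-*-linear-suc (d ∷ p) a b zero    = trans (coeff-∷*-suc d p (a ∷ b ∷ []) 0)
    (+-congˡ (coeff-*-linear-zero p a b))
  coeff-*-linear-suc (d ∷ p) a b (suc k) = trans (coeff-∷*-suc d p (a ∷ b ∷ []) (suc k))
    (trans (+-cong (zeroʳ d) (coeff-*-linear-suc p a b k)) (+-identityˡ _))

  coeff-*-below : ∀ p q {r} → (∀ {i} → i < r → coeff q i ≈ 0#) → ∀ {i} → i < r → coeff (p *ᵖ q) i ≈ 0#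
  coeff-*-below []      q q≈0 _   = refl
  coeff-*-below (a ∷ p) q q≈0 {zero}  0<r  = trans (coeff-∷*-zero a p q) (trans (*-congˡ (q≈0 0<r)) (zeroʳ a))
  coeff-*-below (a ∷ p) q q≈0 {suc i} 1+i<r = trans (coeff-∷*-suc a p q i) (trans
    (+-cong (trans (*-congˡ (q≈0 1+i<r)) (zeroʳ a)) (coeff-*-below p q q≈0 (ℕ.<-trans (ℕ.n<1+n i) 1+i<r)))
    (+-identityˡ _))

  -- With q divisible by X^r, only the constant term of `p` can reach degree r.
  coeff-*-lowest : ∀ p q r → (∀ {i} → i < r → coeff q i ≈ 0#) → coeff (p *ᵖ q) r ≈ coeff p 0 * coeff q r
  coeff-*-lowest []      q r       q≈0 = sym (zeroˡ _)
  coeff-*-lowest (a ∷ p) q zero    q≈0 = coeff-∷*-zero a p q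
  coeff-*-lowest (a ∷ p) q (suc r) q≈0 = trans (coeff-∷*-suc a p q r)
    (trans (+-congˡ (coeff-*-below p q q≈0 (ℕ.n<1+n r))) (+-identityʳ _))

  coeff-*-below₁ : ∀ p q {r} → coeff p 0 ≈ 0# → (∀ {i} → i < r → coeff q i ≈ 0#) →
    ∀ {i} → i < suc r → coeff (p *ᵖ q) i ≈ 0#
  coeff-*-below₁ []      q p≈0 q≈0 _       = refl
  coeff-*-below₁ (a ∷ p) q p≈0 q≈0 {zero}  _ = trans (coeff-∷*-zero a p q) (trans (*-congʳ p≈0) (zeroˡ _))
  coeff-*-below₁ (a ∷ p) q p≈0 q≈0 {suc i} (s≤s i<r) = trans (coeff-∷*-suc a p q i) (trans
    (+-cong (trans (*-congʳ p≈0) (zeroˡ _)) (coeff-*-below p q q≈0 i<r)) (+-identityˡ _))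

  -- With X dividing p and X^r dividing q, degree r + 1 is reached only by the linear term of `p`.
  -- This is the step that adds one block.
  coeff-*-lowest₁ : ∀ p q r → coeff p 0 ≈ 0# → (∀ {i} → i < r → coeff q i ≈ 0#) →
    coeff (p *ᵖ q) (suc r) ≈ coeff p 1 * coeff q r
  coeff-*-lowest₁ []      q r p≈0 q≈0 = sym (zeroˡ _)
  coeff-*-lowest₁ (a ∷ p) q r p≈0 q≈0 = trans (coeff-∷*-suc a p q r) (trans
    (+-cong (trans (*-congʳ p≈0) (zeroˡ _)) (coeff-*-lowest p q r q≈0)) (+-identityˡ _))

  eval : Poly → Carrier → Carrier
  eval []      x = 0#
  eval (a ∷ p) x = a + x * eval p x

  eval-+ : ∀ p q x → eval (p +ᵖ q) x ≈ eval p x + eval q x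
  eval-+ []      q       x = sym (+-identityˡ _)
  eval-+ (a ∷ p) []      x = sym (+-identityʳ _)
  eval-+ (a ∷ p) (b ∷ q) x = begin
    (a + b) + x * eval (p +ᵖ q) x          ≈⟨ +-congˡ (*-congˡ (eval-+ p q x)) ⟩
    (a + b) + x * (eval p x + eval q x)    ≈⟨ +-congˡ (distribˡ _ _ _) ⟩
    (a + b) + (x * eval p x + x * eval q x) ≈⟨ +-interchange _ _ _ _ ⟩
    (a + x * eval p x) + (b + x * eval q x) ∎

  eval-scale : ∀ a p x → eval (scale a p) x ≈ a * eval p x
  eval-scale a []      x = sym (zeroʳ a)
  eval-scale a (b ∷ p) x = begin
    a * b + x * eval (scale a p) x ≈⟨ +-congˡ (*-congˡ (eval-scale a p x)) ⟩
    a * b + x * (a * eval p x)     ≈⟨ +-congˡ (x*yz≈y*xz x a _) ⟩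
    a * b + a * (x * eval p x)     ≈⟨ distribˡ _ _ _ ⟨
    a * (b + x * eval p x)         ∎

  eval-* : ∀ p q x → eval (p *ᵖ q) x ≈ eval p x * eval q x
  eval-* []      q x = sym (zeroˡ _)
  eval-* (a ∷ p) q x = begin
    eval (scale a q +ᵖ (0# ∷ (p *ᵖ q))) x      ≈⟨ eval-+ (scale a q) _ x ⟩
    eval (scale a q) x + (0# + x * eval (p *ᵖ q) x)
      ≈⟨ +-cong (eval-scale a q x) (trans (+-identityˡ _) (*-congˡ (eval-* p q x))) ⟩
    a * eval q x + x * (eval p x * eval q x)    ≈⟨ +-congˡ (*-assoc _ _ _) ⟨
    a * eval q x + (x * eval p x) * eval q x    ≈⟨ distribʳ _ _ _ ⟨
    (a + x * eval p x) * eval q x               ∎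

  eval-∑ : ∀ {a} {A : Set a} (xs : List A) (f : A → Poly) x →
    eval (∑ R[t] xs f) x ≈ Σᴿ xs (λ y → eval (f y) x)
  eval-∑ []       f x = refl
  eval-∑ (y ∷ xs) f x = trans (eval-+ (f y) _ x) (+-congˡ (eval-∑ xs f x))

  eval-zero : ∀ p x → (∀ k → coeff p k ≈ 0#) → eval p x ≈ 0#
  eval-zero []      x p≈0 = refl
  eval-zero (a ∷ p) x p≈0 = trans
    (+-cong (p≈0 0) (trans (*-congˡ (eval-zero p x (λ k → p≈0 (suc k)))) (zeroʳ x))) (+-identityˡ _)

  -- Synthetic division: X p(X) - c p(c) = (X - c) (quotient c p)(X).
  quotient : Carrier → Poly → Poly
  quotient c []      = []
  quotient c (a ∷ p) = eval (a ∷ p) c ∷ quotient c p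

  -- The identity of synthetic division with its negative terms moved across, so that the semiring
  -- solver can treat it.
  quotient-eval : ∀ c p x → x * eval p x + c * eval (quotient c p) x ≈ c * eval p c + x * eval (quotient c p) x
  quotient-eval c []      x = solve 2 (λ x c → x :* con 0 :+ c :* con 0 := c :* con 0 :+ x :* con 0) refl x c
  quotient-eval c (a ∷ p) x = begin
    x * (a + x * P) + c * ((a + c * P′) + x * Q) ≈⟨ solve 6 (λ x c a P P′ Q →
        x :* (a :+ x :* P) :+ c :* ((a :+ c :* P′) :+ x :* Q)
      := (x :* a :+ c :* (a :+ c :* P′)) :+ x :* (x :* P :+ c :* Q)) refl x c a P P′ Q ⟩
    (x * a + c * (a + c * P′)) + x * (x * P + c * Q) ≈⟨ +-congˡ (*-congˡ (quotient-eval c p x)) ⟩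
    (x * a + c * (a + c * P′)) + x * (c * P′ + x * Q) ≈⟨ solve 5 (λ x c a P′ Q →
        (x :* a :+ c :* (a :+ c :* P′)) :+ x :* (c :* P′ :+ x :* Q)
      := c :* (a :+ c :* P′) :+ x :* ((a :+ c :* P′) :+ x :* Q)) refl x c a P′ Q ⟩
    c * (a + c * P′) + x * ((a + c * P′) + x * Q) ∎
    where
    P = eval p x
    P′ = eval p c
    Q = eval (quotient c p) x

  -- The coefficients of the quotient are the values at `c` of the successive tails of `p`, as in
  -- Horner's scheme. Once the tail is known to vanish, the first of these values is the constant
  -- coefficient.
  quotient-zero : ∀ c p → (∀ k → coeff (quotient c p) k ≈ 0#) → ∀ k → coeff p k ≈ 0#
  quotient-zero c []      q≈0 k       = refl
  quotient-zero c (a ∷ p) q≈0 (suc k) = quotient-zero c p (λ k → q≈0 (suc k)) k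
  quotient-zero c (a ∷ p) q≈0 zero    = begin
    a                ≈⟨ +-identityʳ a ⟨
    a + 0#           ≈⟨ +-congˡ (zeroʳ c) ⟨
    a + c * 0#       ≈⟨ +-congˡ (*-congˡ (eval-zero p c (quotient-zero c p (λ k → q≈0 (suc k))))) ⟨
    a + c * eval p c ≈⟨ q≈0 0 ⟩
    0#               ∎

  length-quotient : ∀ c p → length (quotient c p) ≡ length p
  length-quotient c []      = ≡.refl
  length-quotient c (a ∷ p) = ≡.cong suc (length-quotient c p)

  module _ (torsionFree : ∀ n x → (suc n ×ᴷ 1#) * x ≈ 0# → x ≈ 0#) where

    -- Induction on the length, with the natural numbers from `c` on as roots. Dividing out X - c
    -- shortens the list, and every x = c + d + 1 is still a root of the quotient: its value Q(x)
    -- satisfies (d + 1) Q(x) = 0, and `torsionFree` removes the factor.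
    eval-zero⇒zero : ∀ p → (∀ d → eval p (d ×ᴷ 1#) ≈ 0#) → ∀ k → coeff p k ≈ 0#
    eval-zero⇒zero p roots = go (length p) p ℕ.≤-refl 0 (λ d →
        trans (reflexive (≡.cong (λ m → eval p (m ×ᴷ 1#)) (ℕ.+-identityʳ d))) (roots d))
      where
      go : ∀ n p → length p ≤ n → ∀ c → (∀ d → eval p ((d ℕ.+ c) ×ᴷ 1#) ≈ 0#) → ∀ k → coeff p k ≈ 0#
      go n       []      _       c h k = refl
      go (suc n) (a ∷ p) (s≤s l) c h   = λ where
          zero    → trans (sym (trans (+-congˡ (trans (*-congˡ (eval-zero p γ p≈0)) (zeroʳ γ))) (+-identityʳ a))) (h 0)
          (suc k) → p≈0 k
        where
        γ = c ×ᴷ 1#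
        Q : Carrier → Carrier
        Q = eval (quotient γ p)
        root : ∀ d → eval (quotient γ p) ((d ℕ.+ suc c) ×ᴷ 1#) ≈ 0#
        root d = torsionFree d (Q x) (+-cancelʳ (γ * Q x) _ _ (begin
          (suc d ×ᴷ 1#) * Q x + γ * Q x   ≈⟨ distribʳ _ _ _ ⟨
          ((suc d ×ᴷ 1#) + γ) * Q x       ≈⟨ *-congʳ (×-homo-+ 1# (suc d) c) ⟨
          ((suc d ℕ.+ c) ×ᴷ 1#) * Q x     ≡⟨ ≡.cong (λ m → (m ×ᴷ 1#) * Q x) (ℕ.+-suc d c) ⟨
          x * Q x                        ≈⟨ +-cancelˡ (γ * eval p γ) _ _ (begin
            γ * eval p γ + x * Q x         ≈⟨ quotient-eval γ p x ⟨
            x * eval p x + γ * Q x         ≈⟨ +-congʳ (+-cancelˡ a _ _ (trans p-at-x (sym (h 0)))) ⟩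
            γ * eval p γ + γ * Q x         ∎) ⟩
          γ * Q x                        ≈⟨ +-identityˡ _ ⟨
          0# + γ * Q x                   ∎))
          where
          x = (d ℕ.+ suc c) ×ᴷ 1#
          p-at-x : a + x * eval p x ≈ 0#
          p-at-x = trans (reflexive (≡.cong (λ m → eval (a ∷ p) (m ×ᴷ 1#)) (ℕ.+-suc d c))) (h (suc d))
        p≈0 : ∀ k → coeff p k ≈ 0#
        p≈0 = quotient-zero γ p
          (go n (quotient γ p) (≡.subst (_≤ n) (≡.sym (length-quotient γ p)) l) (suc c) root)

    eval-≈⇒≈ᵖ : ∀ p q → (∀ d → eval p (d ×ᴷ 1#) ≈ eval q (d ×ᴷ 1#)) → p ≈ᵖ q
    eval-≈⇒≈ᵖ p q p≈q k = begin
      coeff p k                                              ≈⟨ +-identityʳ _ ⟨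
      coeff p k + 0#                                         ≈⟨ +-congˡ (-‿inverseˡ _) ⟨
      coeff p k + (- coeff q k + coeff q k)                  ≈⟨ +-assoc _ _ _ ⟨
      (coeff p k - coeff q k) + coeff q k                    ≈⟨ +-congʳ zero-coeff ⟩
      0# + coeff q k                                         ≈⟨ +-identityˡ _ ⟩
      coeff q k                                              ∎
      where
      difference = p +ᵖ scale (- 1#) q
      zero-coeff : coeff p k - coeff q k ≈ 0#
      zero-coeff = begin
        coeff p k - coeff q k             ≈⟨ +-congˡ (-1*x≈-x _) ⟨
        coeff p k + - 1# * coeff q k      ≈⟨ +-congˡ (coeff-scale (- 1#) q k) ⟨
        coeff p k + coeff (scale (- 1#) q) k ≈⟨ coeff-+ p (scale (- 1#) q) k ⟨
        coeff difference k                ≈⟨ eval-zero⇒zero difference vanishes k ⟩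
        0#                                ∎
        where
        vanishes : ∀ d → eval difference (d ×ᴷ 1#) ≈ 0#
        vanishes d = begin
          eval difference (d ×ᴷ 1#)                                  ≈⟨ eval-+ p _ _ ⟩
          eval p (d ×ᴷ 1#) + eval (scale (- 1#) q) (d ×ᴷ 1#)          ≈⟨ +-cong (p≈q d) (eval-scale _ q _) ⟩
          eval q (d ×ᴷ 1#) + - 1# * eval q (d ×ᴷ 1#)                  ≈⟨ +-congˡ (-1*x≈-x _) ⟩
          eval q (d ×ᴷ 1#) - eval q (d ×ᴷ 1#)                         ≈⟨ -‿inverseʳ _ ⟩
          0#                                                        ∎

-- Coefficients and values of the binomial polynomials

module Binomials {c ℓ₁ ℓ₂} (F : HeytingField c ℓ₁ ℓ₂) (char0 : CharacteristicZero F) where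
  open Goldberg F char0
  open CommutativeRing commutativeRing hiding (zero)
  open Sums commutativeRing
  open Polynomials commutativeRing
  open import Relation.Binary.Reasoning.Setoid setoid
  open RingProperties ring using (+-cancelˡ; +-cancelʳ; -0#≈0#)
  open SemiringMult semiring using (×-homo-+; ×1-homo-*) renaming (_×_ to _×ᴷ_)
  open SemiringSolver commutativeSemiring using (solve; _:+_; _:*_; _:=_; con)

  -- Apartness from zero is turned into an inverse of the difference with zero; this identity
  -- converts it into an inverse of the element.
  x-0≈x : ∀ x → x - 0# ≈ x
  x-0≈x x = trans (+-congˡ -0#≈0#) (+-identityʳ x)

  ℕ-inverse : ∀ n .{{_ : ℕ.NonZero n}} → ∃[ y ] y * (n ×ᴷ 1#) ≈ 1#
  ℕ-inverse n = let y , y*n≈1 , _ = HeytingField.#⇒invertible F (char0 n) in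
    y , trans (*-congˡ (sym (x-0≈x _))) y*n≈1

  ℕ-cancel : ∀ n .{{_ : ℕ.NonZero n}} {x y} → (n ×ᴷ 1#) * x ≈ (n ×ᴷ 1#) * y → x ≈ y
  ℕ-cancel n {x} {y} e = trans (sym (undo x)) (trans (*-congˡ e) (undo y))
    where
    n⁻¹ = proj₁ (ℕ-inverse n)
    undo : ∀ z → n⁻¹ * ((n ×ᴷ 1#) * z) ≈ z
    undo z = trans (sym (*-assoc _ _ _)) (trans (*-congʳ (proj₂ (ℕ-inverse n))) (*-identityˡ z))

  torsionFree : ∀ n x → (suc n ×ᴷ 1#) * x ≈ 0# → x ≈ 0#
  torsionFree n x e = ℕ-cancel (suc n) (trans e (sym (zeroʳ _)))

  !-inverse : ∀ n → ((n !) ×ᴷ 1#) * 1/ n ! ≈ 1#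
  !-inverse n = trans (*-comm _ _) (trans (*-congˡ (sym (x-0≈x _)))
    (proj₁ (proj₂ (HeytingField.#⇒invertible F (char0 (n !) {{n ℕ.!≢0}})))))

  1/0!≈1 : 1/ 0 ! ≈ 1#
  1/0!≈1 = begin
    1/ 0 !              ≈⟨ *-identityˡ _ ⟨
    1# * 1/ 0 !         ≈⟨ *-congʳ (+-identityʳ 1#) ⟨
    (1 ×ᴷ 1#) * 1/ 0 !   ≈⟨ !-inverse 0 ⟩
    1#                  ∎

  1/suc! : ∀ n → (suc n ×ᴷ 1#) * 1/ suc n ! ≈ 1/ n !
  1/suc! n = ℕ-cancel (n !) {{n ℕ.!≢0}} (begin
    ((n !) ×ᴷ 1#) * ((suc n ×ᴷ 1#) * 1/ suc n !) ≈⟨ *-assoc _ _ _ ⟨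
    (((n !) ×ᴷ 1#) * (suc n ×ᴷ 1#)) * 1/ suc n ! ≈⟨ *-congʳ (×1-homo-* (n !) (suc n)) ⟨
    ((n ! ℕ.* suc n) ×ᴷ 1#) * 1/ suc n !      ≡⟨ ≡.cong (λ m → (m ×ᴷ 1#) * 1/ suc n !) (ℕ.*-comm (n !) (suc n)) ⟩
    ((suc n !) ×ᴷ 1#) * 1/ suc n !              ≈⟨ !-inverse (suc n) ⟩
    1#                                       ≈⟨ !-inverse n ⟨
    ((n !) ×ᴷ 1#) * 1/ n !                      ∎)

  -- The coefficients of binom k

  e : ℕ → ℕ → Carrier
  e k r = coeff (binom k) r

  private
    ff : ℕ → ℕ → Carrier
    ff k r = coeff (fallingFactorial k) r

    e-ff : ∀ k r → e k r ≈ 1/ k ! * ff k r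
    e-ff k r = coeff-scale (1/ k !) (fallingFactorial k) r

    suc*e : ∀ k r → (suc k ×ᴷ 1#) * e (suc k) r ≈ 1/ k ! * ff (suc k) r
    suc*e k r = trans (*-congˡ (e-ff (suc k) r)) (trans (sym (*-assoc _ _ _)) (*-congʳ (1/suc! k)))

    -- The list t +ᵖ constant a begins with 0# + a.
    ff-zero : ∀ k → ff (suc k) 0 ≈ ff k 0 * - (k ×ᴷ 1#)
    ff-zero k = trans (coeff-*-linear-zero (fallingFactorial k) _ _) (*-congˡ (+-identityˡ _))

    -- Coefficient of t^(r+1) in (t)_{k+1} = (t)_k (t - k), with the negative term moved to the
    -- left.
    ff-suc : ∀ k r → ff (suc k) (suc r) + (k ×ᴷ 1#) * ff k (suc r) ≈ ff k r
    ff-suc k r = begin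
      ff (suc k) (suc r) + κ * x
        ≈⟨ +-congʳ (coeff-*-linear-suc (fallingFactorial k) _ _ r) ⟩
      (ff k r * 1# + x * (0# + - κ)) + κ * x  ≈⟨ +-assoc _ _ _ ⟩
      ff k r * 1# + (x * (0# + - κ) + κ * x)
        ≈⟨ +-cong (*-identityʳ _) (+-cong (*-congˡ (+-identityˡ _)) (*-comm _ _)) ⟩
      ff k r + (x * - κ + x * κ)              ≈⟨ +-congˡ (distribˡ _ _ _) ⟨
      ff k r + x * (- κ + κ)                  ≈⟨ +-congˡ (*-congˡ (-‿inverseˡ κ)) ⟩
      ff k r + x * 0#                         ≈⟨ +-congˡ (zeroʳ x) ⟩
      ff k r + 0#                             ≈⟨ +-identityʳ _ ⟩
      ff k r                                  ∎
      where
      κ = k ×ᴷ 1#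
      x = ff k (suc r)

  e-0-0 : e 0 0 ≈ 1#
  e-0-0 = trans (*-congʳ 1/0!≈1) (*-identityˡ 1#)

  e-suc-0 : ∀ k → e (suc k) 0 ≈ 0#
  e-suc-0 k = trans (e-ff (suc k) 0) (trans (*-congˡ (vanish k)) (zeroʳ _))
    where
    vanish : ∀ k → ff (suc k) 0 ≈ 0#
    vanish zero    = trans (ff-zero 0) (trans (*-congˡ -0#≈0#) (zeroʳ _))
    vanish (suc k) = trans (ff-zero (suc k)) (trans (*-congʳ (vanish k)) (zeroˡ _))

  -- Coefficient of t^(r+1) in (k + 1) binom(t, k + 1) + k binom(t, k) = t binom(t, k).
  e-rec : ∀ k r → (suc k ×ᴷ 1#) * e (suc k) (suc r) + (k ×ᴷ 1#) * e k (suc r) ≈ e k r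
  e-rec k r = begin
    (suc k ×ᴷ 1#) * e (suc k) (suc r) + κ * e k (suc r)
      ≈⟨ +-cong (suc*e k (suc r)) (trans (*-congˡ (e-ff k (suc r))) (x*yz≈y*xz κ (1/ k !) _)) ⟩
    1/ k ! * ff (suc k) (suc r) + 1/ k ! * (κ * ff k (suc r)) ≈⟨ distribˡ _ _ _ ⟨
    1/ k ! * (ff (suc k) (suc r) + κ * ff k (suc r))          ≈⟨ *-congˡ (ff-suc k r) ⟩
    1/ k ! * ff k r                                           ≈⟨ e-ff k r ⟨
    e k r                                                     ∎
    where κ = k ×ᴷ 1#

  e-vanish : ∀ {k r} → k < r → e k r ≈ 0#
  e-vanish {zero}  {suc r} _         = refl
  e-vanish {suc k} {suc r} (s≤s k<r) = torsionFree k _ (begin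
    (suc k ×ᴷ 1#) * e (suc k) (suc r)        ≈⟨ +-identityʳ _ ⟨
    (suc k ×ᴷ 1#) * e (suc k) (suc r) + 0#   ≈⟨ +-congˡ (zeroʳ (k ×ᴷ 1#)) ⟨
    (suc k ×ᴷ 1#) * e (suc k) (suc r) + (k ×ᴷ 1#) * 0#
      ≈⟨ +-congˡ (*-congˡ (e-vanish (ℕ.m<n⇒m<1+n k<r))) ⟨
    (suc k ×ᴷ 1#) * e (suc k) (suc r) + (k ×ᴷ 1#) * e k (suc r) ≈⟨ e-rec k r ⟩
    e k r                                   ≈⟨ e-vanish k<r ⟩
    0#                                      ∎)

  -- With E r = ∑ₙ e n r xⁿ, e-rec says (1 + x) E (suc r)′ = E r; both sides of the
  -- identity E 1 · E r = (r + 1) E (r + 1) are then seen to satisfy the same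
  -- differential equation, by induction on r.

  convolution : ℕ → ℕ → ℕ → Carrier
  convolution q r n = Σᴿ (upTo (suc n)) (λ i → e i q * e (n ∸ i) r)

  private
    -- The Leibniz rule: both sides are the coefficient of xⁿ in the derivative of E q · E r. The
    -- factor n + 1 is split as i + (n + 1 - i), and the end terms with factor 0 drop out.
    convolution-suc : ∀ q r n → (suc n ×ᴷ 1#) * convolution q r (suc n) ≈
      Σᴿ (upTo (suc n)) (λ i → (suc i ×ᴷ 1#) * e (suc i) q * e (n ∸ i) r) +
      Σᴿ (upTo (suc n)) (λ i → e i q * ((suc (n ∸ i) ×ᴷ 1#) * e (suc (n ∸ i)) r))
    convolution-suc q r n = begin
      (suc n ×ᴷ 1#) * Σᴿ (upTo (suc (suc n))) f                              ≈⟨ *-∑ (upTo (suc (suc n))) _ f ⟩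
      Σᴿ (upTo (suc (suc n))) (λ i → (suc n ×ᴷ 1#) * f i)
        ≈⟨ ∑-cong∈ (upTo (suc (suc n))) (λ {i} i∈ → split i (ℕ.≤-pred (∈-upTo⁻ i∈))) ⟩
      Σᴿ (upTo (suc (suc n))) (λ i → left i + right i)                      ≈⟨ ∑-+ (upTo (suc (suc n))) left right ⟩
      Σᴿ (upTo (suc (suc n))) left + Σᴿ (upTo (suc (suc n))) right          ≈⟨ +-cong
        (trans (reflexive (∑-upTo-suc (suc n) left)) (trans (+-congʳ left-0) (+-identityˡ _)))
        (trans (∑-upTo-last (suc n) right) (trans (+-congˡ right-last) (+-identityʳ _))) ⟩
      Σᴿ (upTo (suc n)) (left ∘ suc) + Σᴿ (upTo (suc n)) right
        ≈⟨ +-congˡ (∑-cong∈ (upTo (suc n)) (λ i∈ → shift _ (ℕ.≤-pred (∈-upTo⁻ i∈)))) ⟩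
      Σᴿ (upTo (suc n)) (left ∘ suc) + Σᴿ (upTo (suc n)) (λ i → e i q * ((suc (n ∸ i) ×ᴷ 1#) * e (suc (n ∸ i)) r)) ∎
      where
      f left right : ℕ → Carrier
      f i = e i q * e (suc n ∸ i) r
      left i = (i ×ᴷ 1#) * e i q * e (suc n ∸ i) r
      right i = e i q * (((suc n ∸ i) ×ᴷ 1#) * e (suc n ∸ i) r)
      left-0 : left 0 ≈ 0#
      left-0 = trans (*-congʳ (zeroˡ _)) (zeroˡ _)
      right-last : right (suc n) ≈ 0#
      right-last = trans (*-congˡ (trans (*-congʳ (reflexive (≡.cong (_×ᴷ 1#) (ℕ.n∸n≡0 n)))) (zeroˡ _))) (zeroʳ _)
      split : ∀ i → i ≤ suc n → (suc n ×ᴷ 1#) * f i ≈ left i + right i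
      split i i≤ = begin
        (suc n ×ᴷ 1#) * f i                       ≡⟨ ≡.cong (λ m → (m ×ᴷ 1#) * f i) (ℕ.m+[n∸m]≡n i≤) ⟨
        ((i ℕ.+ (suc n ∸ i)) ×ᴷ 1#) * f i         ≈⟨ *-congʳ (×-homo-+ 1# i (suc n ∸ i)) ⟩
        ((i ×ᴷ 1#) + ((suc n ∸ i) ×ᴷ 1#)) * f i    ≈⟨ solve 4 (λ a b x y →
          (a :+ b) :* (x :* y) := a :* x :* y :+ x :* (b :* y)) refl _ _ _ _ ⟩
        left i + right i                         ∎
      shift : ∀ i → i ≤ n → right i ≈ e i q * ((suc (n ∸ i) ×ᴷ 1#) * e (suc (n ∸ i)) r)
      shift i i≤ = reflexive (≡.cong (λ m → e i q * ((m ×ᴷ 1#) * e m r)) (ℕ.+-∸-assoc 1 i≤))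

    -- The Leibniz rule again, for x times the derivative of E q · E r.
    convolution-split : ∀ q r n → (n ×ᴷ 1#) * convolution q r n ≈
      Σᴿ (upTo (suc n)) (λ i → (i ×ᴷ 1#) * e i q * e (n ∸ i) r) +
      Σᴿ (upTo (suc n)) (λ i → e i q * (((n ∸ i) ×ᴷ 1#) * e (n ∸ i) r))
    convolution-split q r n = begin
      (n ×ᴷ 1#) * Σᴿ (upTo (suc n)) f           ≈⟨ *-∑ (upTo (suc n)) _ f ⟩
      Σᴿ (upTo (suc n)) (λ i → (n ×ᴷ 1#) * f i)
        ≈⟨ ∑-cong∈ (upTo (suc n)) (λ {i} i∈ → split i (ℕ.≤-pred (∈-upTo⁻ i∈))) ⟩
      Σᴿ (upTo (suc n)) (λ i → left i + right i) ≈⟨ ∑-+ (upTo (suc n)) left right ⟩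
      Σᴿ (upTo (suc n)) left + Σᴿ (upTo (suc n)) right ∎
      where
      f left right : ℕ → Carrier
      f i = e i q * e (n ∸ i) r
      left i = (i ×ᴷ 1#) * e i q * e (n ∸ i) r
      right i = e i q * (((n ∸ i) ×ᴷ 1#) * e (n ∸ i) r)
      split : ∀ i → i ≤ n → (n ×ᴷ 1#) * f i ≈ left i + right i
      split i i≤ = begin
        (n ×ᴷ 1#) * f i                       ≡⟨ ≡.cong (λ m → (m ×ᴷ 1#) * f i) (ℕ.m+[n∸m]≡n i≤) ⟨
        ((i ℕ.+ (n ∸ i)) ×ᴷ 1#) * f i         ≈⟨ *-congʳ (×-homo-+ 1# i (n ∸ i)) ⟩
        ((i ×ᴷ 1#) + ((n ∸ i) ×ᴷ 1#)) * f i    ≈⟨ solve 4 (λ a b x y →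
          (a :+ b) :* (x :* y) := a :* x :* y :+ x :* (b :* y)) refl _ _ _ _ ⟩
        left i + right i                     ∎

    convolution-0 : ∀ r n → convolution 0 r n ≈ e n r
    convolution-0 r n = begin
      convolution 0 r n                                       ≡⟨ ∑-upTo-suc n _ ⟩
      e 0 0 * e n r + Σᴿ (upTo n) (λ i → e (suc i) 0 * e (n ∸ suc i) r)
        ≈⟨ +-cong (trans (*-congʳ e-0-0) (*-identityˡ _))
             (∑-zero (upTo n) (λ {i} _ → trans (*-congʳ (e-suc-0 i)) (zeroˡ _))) ⟩
      e n r + 0#                                              ≈⟨ +-identityʳ _ ⟩
      e n r                                                   ∎

    convolution-1-0 : ∀ n → convolution 1 0 n ≈ e n 1
    convolution-1-0 n = begin
      convolution 1 0 n                                                ≈⟨ ∑-upTo-last n _ ⟩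
      Σᴿ (upTo n) (λ i → e i 1 * e (n ∸ i) 0) + e n 1 * e (n ∸ n) 0
        ≈⟨ +-cong (∑-zero (upTo n) (λ i∈ → trans (*-congˡ (pos (ℕ.m<n⇒0<n∸m (∈-upTo⁻ i∈)))) (zeroʳ _)))
             (trans (*-congˡ (trans (reflexive (≡.cong (λ m → e m 0) (ℕ.n∸n≡0 n))) e-0-0)) (*-identityʳ _)) ⟩
      0# + e n 1                                                       ≈⟨ +-identityˡ _ ⟩
      e n 1                                                            ∎
      where
      pos : ∀ {m} → 0 < m → e m 0 ≈ 0#
      pos {suc m} _ = e-suc-0 m

    -- The differential equation (1 + x) (E 1 · E (r + 1))′ = E 0 · E (r + 1) + E 1 · E r, in which
    -- E 0 = 1.
    convolution-rec : ∀ r n → (suc n ×ᴷ 1#) * convolution 1 (suc r) (suc n) + (n ×ᴷ 1#) * convolution 1 (suc r) n ≈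
      e n (suc r) + convolution 1 r n
    convolution-rec r n = begin
      (suc n ×ᴷ 1#) * convolution 1 (suc r) (suc n) + (n ×ᴷ 1#) * convolution 1 (suc r) n
        ≈⟨ +-cong (convolution-suc 1 (suc r) n) (convolution-split 1 (suc r) n) ⟩
      (Σᴿ I a + Σᴿ I b) + (Σᴿ I c′ + Σᴿ I d)   ≈⟨ +-interchange _ _ _ _ ⟩
      (Σᴿ I a + Σᴿ I c′) + (Σᴿ I b + Σᴿ I d)   ≈⟨ +-cong (∑-+ I a c′) (∑-+ I b d) ⟨
      Σᴿ I (λ i → a i + c′ i) + Σᴿ I (λ i → b i + d i) ≈⟨ +-cong
        (trans (∑-cong I (λ i → trans (sym (distribʳ _ _ _)) (*-congʳ (e-rec i 0)))) (convolution-0 (suc r) n))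
        (∑-cong I (λ i → trans (sym (distribˡ _ _ _)) (*-congˡ (e-rec (n ∸ i) r)))) ⟩
      e n (suc r) + convolution 1 r n          ∎
      where
      I = upTo (suc n)
      a b c′ d : ℕ → Carrier
      a i = (suc i ×ᴷ 1#) * e (suc i) 1 * e (n ∸ i) (suc r)
      b i = e i 1 * ((suc (n ∸ i) ×ᴷ 1#) * e (suc (n ∸ i)) (suc r))
      c′ i = (i ×ᴷ 1#) * e i 1 * e (n ∸ i) (suc r)
      d i = e i 1 * (((n ∸ i) ×ᴷ 1#) * e (n ∸ i) (suc r))

  convolution-1 : ∀ r n → convolution 1 r n ≈ (suc r ×ᴷ 1#) * e n (suc r)
  convolution-1 zero    n       = trans (convolution-1-0 n)
    (sym (trans (*-congʳ (+-identityʳ 1#)) (*-identityˡ _)))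
  convolution-1 (suc r) zero    = trans (+-congʳ (zeroˡ _)) (trans (+-identityʳ _) (sym (zeroʳ _)))
  -- The differential equation determines the coefficient at n + 1 from the one at n up to the
  -- factor n + 1, so the recursion runs on n inside the recursion on r.
  convolution-1 (suc r) (suc n) = ℕ-cancel (suc n) (+-cancelʳ ((n ×ᴷ 1#) * convolution 1 (suc r) n) _ _ (begin
    (suc n ×ᴷ 1#) * convolution 1 (suc r) (suc n) + (n ×ᴷ 1#) * convolution 1 (suc r) n
      ≈⟨ convolution-rec r n ⟩
    e n (suc r) + convolution 1 r n                    ≈⟨ +-congˡ (convolution-1 r n) ⟩
    e n (suc r) + ρ * e n (suc r)                      ≈⟨ solve 2 (λ ρ x → x :+ ρ :* x := (con 1 :+ ρ) :* x) refl ρ _ ⟩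
    (1# + ρ) * e n (suc r)                             ≈⟨ *-congˡ (e-rec n (suc r)) ⟨
    (1# + ρ) * ((suc n ×ᴷ 1#) * e (suc n) (suc (suc r)) + (n ×ᴷ 1#) * e n (suc (suc r)))
      ≈⟨ solve 5 (λ ρ s x m y → ρ :* (s :* x :+ m :* y) := s :* (ρ :* x) :+ m :* (ρ :* y)) refl _ _ _ _ _ ⟩
    (suc n ×ᴷ 1#) * ((1# + ρ) * e (suc n) (suc (suc r))) + (n ×ᴷ 1#) * ((1# + ρ) * e n (suc (suc r)))
      ≈⟨ +-congˡ (*-congˡ (convolution-1 (suc r) n)) ⟨
    (suc n ×ᴷ 1#) * ((1# + ρ) * e (suc n) (suc (suc r))) + (n ×ᴷ 1#) * convolution 1 (suc r) n ∎))
    where ρ = suc r ×ᴷ 1#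

  -- The values of binom k

  b : ℕ → Carrier → Carrier
  b k x = eval (binom k) x

  b-0 : ∀ x → b 0 x ≈ 1#
  b-0 x = trans (+-cong e-0-0 (zeroʳ x)) (+-identityʳ _)

  private
    φ : ℕ → Carrier → Carrier
    φ k x = eval (fallingFactorial k) x

    b-φ : ∀ k x → b k x ≈ 1/ k ! * φ k x
    b-φ k x = eval-scale (1/ k !) (fallingFactorial k) x

    φ-suc : ∀ k x → φ (suc k) x ≈ φ k x * (x - k ×ᴷ 1#)
    φ-suc k x = trans (eval-* (fallingFactorial k) _ x) (*-congˡ (begin
      (0# + - (k ×ᴷ 1#)) + x * (1# + x * 0#) ≈⟨ +-cong (+-identityˡ _)
        (trans (*-congˡ (trans (+-congˡ (zeroʳ x)) (+-identityʳ 1#))) (*-identityʳ x)) ⟩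
      - (k ×ᴷ 1#) + x                        ≈⟨ +-comm _ _ ⟩
      x - k ×ᴷ 1#                            ∎))

    shift : ∀ k x → (1# + x) - suc k ×ᴷ 1# ≈ x - k ×ᴷ 1#
    shift k x = +-cancelʳ (suc k ×ᴷ 1#) _ _ (begin
      ((1# + x) - suc k ×ᴷ 1#) + suc k ×ᴷ 1#  ≈⟨ +-assoc _ _ _ ⟩
      (1# + x) + (- (suc k ×ᴷ 1#) + suc k ×ᴷ 1#) ≈⟨ trans (+-congˡ (-‿inverseˡ _)) (+-identityʳ _) ⟩
      1# + x                                ≈⟨ +-congˡ (trans (+-congˡ (-‿inverseˡ κ)) (+-identityʳ x)) ⟨
      1# + (x + (- κ + κ))                  ≈⟨ solve 3 (λ x m κ → con 1 :+ (x :+ (m :+ κ)) := (x :+ m) :+ (con 1 :+ κ)) refl x (- κ) κ ⟩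
      (x - κ) + (1# + κ)                    ∎)
      where κ = k ×ᴷ 1#

    -- The factors (1 + x) - (i + 1) are the factors x - i, and the first factor 1 + x remains.
    φ-shift : ∀ k x → φ (suc k) (1# + x) ≈ (1# + x) * φ k x
    φ-shift zero    x = trans (φ-suc 0 (1# + x))
      (trans (*-cong (trans (+-congˡ (zeroʳ _)) (sym (+-congˡ (zeroʳ x)))) (x-0≈x _)) (*-comm _ _))
    φ-shift (suc k) x = begin
      φ (suc (suc k)) (1# + x)                      ≈⟨ φ-suc (suc k) (1# + x) ⟩
      φ (suc k) (1# + x) * ((1# + x) - suc k ×ᴷ 1#)  ≈⟨ *-cong (φ-shift k x) (shift k x) ⟩
      ((1# + x) * φ k x) * (x - k ×ᴷ 1#)             ≈⟨ *-assoc _ _ _ ⟩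
      (1# + x) * (φ k x * (x - k ×ᴷ 1#))             ≈⟨ *-congˡ (φ-suc k x) ⟨
      (1# + x) * φ (suc k) x                        ∎

    φ-pascal : ∀ k x → φ (suc k) (1# + x) ≈ φ (suc k) x + (suc k ×ᴷ 1#) * φ k x
    φ-pascal k x = begin
      φ (suc k) (1# + x)                            ≈⟨ φ-shift k x ⟩
      (1# + x) * φ k x                              ≈⟨ *-congʳ (+-congˡ (trans (+-congˡ (-‿inverseˡ κ)) (+-identityʳ x))) ⟨
      (1# + (x + (- κ + κ))) * φ k x                ≈⟨ solve 4 (λ x m κ f →
        (con 1 :+ (x :+ (m :+ κ))) :* f := f :* (x :+ m) :+ (con 1 :+ κ) :* f) refl x (- κ) κ (φ k x) ⟩
      φ k x * (x - κ) + (1# + κ) * φ k x            ≈⟨ +-congʳ (φ-suc k x) ⟨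
      φ (suc k) x + (suc k ×ᴷ 1#) * φ k x            ∎
      where κ = k ×ᴷ 1#

  b-pascal : ∀ k x → b (suc k) (1# + x) ≈ b (suc k) x + b k x
  b-pascal k x = begin
    b (suc k) (1# + x)                                       ≈⟨ b-φ (suc k) _ ⟩
    κ! * φ (suc k) (1# + x)                                  ≈⟨ *-congˡ (φ-pascal k x) ⟩
    κ! * (φ (suc k) x + (suc k ×ᴷ 1#) * φ k x)                ≈⟨ solve 4 (λ κ p s q →
      κ :* (p :+ s :* q) := κ :* p :+ (s :* κ) :* q) refl _ _ _ _ ⟩
    κ! * φ (suc k) x + ((suc k ×ᴷ 1#) * κ!) * φ k x           ≈⟨ +-cong (sym (b-φ (suc k) x)) (*-congʳ (1/suc! k)) ⟩
    b (suc k) x + 1/ k ! * φ k x                             ≈⟨ +-congˡ (b-φ k x) ⟨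
    b (suc k) x + b k x                                      ∎
    where κ! = 1/ suc k !

  eval-at-0 : ∀ p → eval p 0# ≈ coeff p 0
  eval-at-0 []      = refl
  eval-at-0 (a ∷ p) = trans (+-congˡ (zeroˡ _)) (+-identityʳ a)

  b-suc-0 : ∀ k → b (suc k) 0# ≈ 0#
  b-suc-0 k = trans (eval-at-0 (binom (suc k))) (e-suc-0 k)

-- Counting words that increase on the blocks of a composition

module Blocks {c ℓ₁ ℓ₂} (F : HeytingField c ℓ₁ ℓ₂) (char0 : CharacteristicZero F) where
  open Goldberg F char0
  open CommutativeRing commutativeRing hiding (zero)
  open Sums commutativeRing
  open Polynomials commutativeRing
  open Binomials F char0
  open import Relation.Binary.Reasoning.Setoid setoid
  open SemiringMult semiring using () renaming (_×_ to _×ᴷ_)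

  -- Here k is the number of letters of block `s` read before χ. Started with k = 0 and s = 0, a
  -- nonempty composition produces one extra factor `binom 0`, the constant 1, for the empty block
  -- 0.
  blockProduct : ∀ {p} → ℕ → ℕ → Vec ℕ p → Poly
  blockProduct k s []      = binom k
  blockProduct k s (y ∷ χ) with y ℕ.≟ s
  ... | yes _ = blockProduct (suc k) s χ
  ... | no _  = binom k *ᵖ blockProduct 1 y χ

  -- The value of blockProduct at n, except that the current block takes the value at m.
  blockValue : ∀ {p} → ℕ → ℕ → Vec ℕ p → (m n : ℕ) → Carrier
  blockValue k s []      m n = b k (m ×ᴷ 1#)
  blockValue k s (y ∷ χ) m n with y ℕ.≟ s
  ... | yes _ = blockValue (suc k) s χ m n
  ... | no _  = b k (m ×ᴷ 1#) * blockValue 1 y χ n n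

  eval-blockProduct : ∀ {p} k s (χ : Vec ℕ p) n → eval (blockProduct k s χ) (n ×ᴷ 1#) ≈ blockValue k s χ n n
  eval-blockProduct k s []      n = refl
  eval-blockProduct k s (y ∷ χ) n with y ℕ.≟ s
  ... | yes _ = eval-blockProduct (suc k) s χ n
  ... | no _  = trans (eval-* (binom k) _ _) (*-congˡ (eval-blockProduct 1 y χ n))

  alphabet : ℕ → List ℕ
  alphabet N = map suc (upTo N)

  ∈-alphabet⇒positive : ∀ {N a} → a ∈ˡ alphabet N → 0 < a
  ∈-alphabet⇒positive a∈ with ∈-map⁻ suc a∈
  ... | _ , _ , ≡.refl = s≤s z≤n

  -- Classify the subsets of size k + 1 of {x + 1, ..., N} by their least element a. In the
  -- induction this is Pascal's rule.
  hockeyStick : ∀ k N x → Σᴿ (alphabet N) (λ a → ⟦ x ℕ.<? a ⟧ * b k ((N ∸ a) ×ᴷ 1#)) ≈ b (suc k) ((N ∸ x) ×ᴷ 1#)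
  hockeyStick k N x = trans (reflexive (∑-map suc (upTo N) _)) (go N x)
    where
    go : ∀ N x → Σᴿ (upTo N) (λ i → ⟦ x ℕ.<? suc i ⟧ * b k ((N ∸ suc i) ×ᴷ 1#)) ≈ b (suc k) ((N ∸ x) ×ᴷ 1#)
    go zero    x       = sym (trans (reflexive (≡.cong (λ m → b (suc k) (m ×ᴷ 1#)) (ℕ.0∸n≡0 x))) (b-suc-0 k))
    go (suc N) zero    = begin
      Σᴿ (upTo (suc N)) (λ i → 1# * b k ((N ∸ i) ×ᴷ 1#)) ≡⟨ ∑-upTo-suc N _ ⟩
      1# * b k (N ×ᴷ 1#) + Σᴿ (upTo N) (λ i → 1# * b k ((N ∸ suc i) ×ᴷ 1#))
        ≈⟨ +-cong (*-identityˡ _) (go N zero) ⟩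
      b k (N ×ᴷ 1#) + b (suc k) (N ×ᴷ 1#)  ≈⟨ +-comm _ _ ⟩
      b (suc k) (N ×ᴷ 1#) + b k (N ×ᴷ 1#)  ≈⟨ b-pascal k (N ×ᴷ 1#) ⟨
      b (suc k) (suc N ×ᴷ 1#)              ∎
    go (suc N) (suc x) = begin
      Σᴿ (upTo (suc N)) (λ i → ⟦ suc x ℕ.<? suc i ⟧ * b k ((N ∸ i) ×ᴷ 1#)) ≡⟨ ∑-upTo-suc N _ ⟩
      ⟦ suc x ℕ.<? 1 ⟧ * b k (N ×ᴷ 1#) + Σᴿ (upTo N) (λ i → ⟦ suc x ℕ.<? suc (suc i) ⟧ * b k ((N ∸ suc i) ×ᴷ 1#))
        ≈⟨ +-cong (trans (*-congʳ (⟦⟧-no (suc x ℕ.<? 1) (λ { (s≤s ()) }))) (zeroˡ _))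
             (∑-cong (upTo N) (λ i → *-congʳ (⟦⟧-⇔ (suc x ℕ.<? suc (suc i)) (x ℕ.<? suc i) ℕ.≤-pred s≤s))) ⟩
      0# + Σᴿ (upTo N) (λ i → ⟦ x ℕ.<? suc i ⟧ * b k ((N ∸ suc i) ×ᴷ 1#)) ≈⟨ +-identityˡ _ ⟩
      Σᴿ (upTo N) (λ i → ⟦ x ℕ.<? suc i ⟧ * b k ((N ∸ suc i) ×ᴷ 1#))      ≈⟨ go N x ⟩
      b (suc k) ((N ∸ x) ×ᴷ 1#)            ∎

  blockValue-hockeyStick : ∀ {p} k s (χ : Vec ℕ p) N x →
    Σᴿ (alphabet N) (λ a → ⟦ x ℕ.<? a ⟧ * blockValue k s χ (N ∸ a) N) ≈ blockValue (suc k) s χ (N ∸ x) N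
  blockValue-hockeyStick k s []      N x = hockeyStick k N x
  blockValue-hockeyStick k s (y ∷ χ) N x with y ℕ.≟ s
  ... | yes _ = blockValue-hockeyStick (suc k) s χ N x
  ... | no _  = begin
    Σᴿ (alphabet N) (λ a → ⟦ x ℕ.<? a ⟧ * (b k ((N ∸ a) ×ᴷ 1#) * rest))
      ≈⟨ ∑-cong (alphabet N) (λ a → *-assoc _ _ _) ⟨
    Σᴿ (alphabet N) (λ a → (⟦ x ℕ.<? a ⟧ * b k ((N ∸ a) ×ᴷ 1#)) * rest) ≈⟨ ∑-* (alphabet N) _ rest ⟨
    Σᴿ (alphabet N) (λ a → ⟦ x ℕ.<? a ⟧ * b k ((N ∸ a) ×ᴷ 1#)) * rest ≈⟨ *-congʳ (hockeyStick k N x) ⟩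
    b (suc k) ((N ∸ x) ×ᴷ 1#) * rest ∎
    where rest = blockValue 1 y χ N N

  -- The letters still to come in block `s` have to exceed `x`, which leaves N ∸ x values, while
  -- later blocks choose freely among N. Block sizes count only the letters to come, hence the
  -- initial 0.
  count-chains : ∀ {p} s x (χ : Vec ℕ p) N → Steps s χ →
    Σᴿ (wordsOver (alphabet N) p) (λ a → ⟦ chain? s x χ a ⟧) ≈ blockValue 0 s χ (N ∸ x) N
  count-chains         s x []      N _         = trans (+-identityʳ _) (sym (b-0 _))
  count-chains {suc p} s x (y ∷ χ) N (y≡ , st) = begin
    Σᴿ (wordsOver (alphabet N) (suc p)) (λ a → ⟦ chain? s x (y ∷ χ) a ⟧)
      ≈⟨ ∑-cartesianProductWith _∷_ (alphabet N) (wordsOver (alphabet N) p) _ ⟩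
    Σᴿ (alphabet N) (λ d → Σᴿ (wordsOver (alphabet N) p) (λ a → ⟦ lex? s x y d ×-dec chain? y d χ a ⟧))
      ≈⟨ ∑-cong (alphabet N) (λ d → begin
         Σᴿ (wordsOver (alphabet N) p) (λ a → ⟦ lex? s x y d ×-dec chain? y d χ a ⟧)
           ≈⟨ ∑-cong (wordsOver (alphabet N) p) (λ a → ⟦⟧-× (lex? s x y d) (chain? y d χ a)) ⟩
         Σᴿ (wordsOver (alphabet N) p) (λ a → ⟦ lex? s x y d ⟧ * ⟦ chain? y d χ a ⟧)
           ≈⟨ *-∑ (wordsOver (alphabet N) p) _ _ ⟨
         ⟦ lex? s x y d ⟧ * Σᴿ (wordsOver (alphabet N) p) (λ a → ⟦ chain? y d χ a ⟧)
           ≈⟨ *-congˡ (count-chains y d χ N st) ⟩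
         ⟦ lex? s x y d ⟧ * blockValue 0 y χ (N ∸ d) N ∎) ⟩
    Σᴿ (alphabet N) (λ d → ⟦ lex? s x y d ⟧ * blockValue 0 y χ (N ∸ d) N) ≈⟨ step y≡ ⟩
    blockValue 0 s (y ∷ χ) (N ∸ x) N ∎
    where
    step : _ → Σᴿ (alphabet N) (λ d → ⟦ lex? s x y d ⟧ * blockValue 0 y χ (N ∸ d) N) ≈
      blockValue 0 s (y ∷ χ) (N ∸ x) N
    step y≡ with y ℕ.≟ s
    step y≡             | yes ≡.refl = trans
      (∑-cong (alphabet N) (λ d → *-congʳ (⟦⟧-⇔ (lex? s x s d) (x ℕ.<? d)
        (λ { (inj₁ lt) → contradiction lt (ℕ.<-irrefl ≡.refl) ; (inj₂ (_ , lt)) → lt })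
        (λ lt → inj₂ (≡.refl , lt)))))
      (blockValue-hockeyStick 0 s χ N x)
    step (inj₁ y≡s)    | no y≢s = contradiction y≡s y≢s
    -- A new block puts no condition on its first letter; the condition 0 < d, true of every letter,
    -- brings the sum into the form of `blockValue-hockeyStick`.
    step (inj₂ ≡.refl) | no _   = begin
      Σᴿ (alphabet N) (λ d → ⟦ lex? s x y d ⟧ * blockValue 0 y χ (N ∸ d) N)
        ≈⟨ ∑-cong∈ (alphabet N) (λ {d} d∈ → *-congʳ (⟦⟧-⇔ (lex? s x y d) (0 ℕ.<? d)
             (λ _ → ∈-alphabet⇒positive d∈) (λ _ → inj₁ (ℕ.n<1+n s)))) ⟩
      Σᴿ (alphabet N) (λ d → ⟦ 0 ℕ.<? d ⟧ * blockValue 0 y χ (N ∸ d) N) ≈⟨ blockValue-hockeyStick 0 y χ N 0 ⟩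
      blockValue 1 y χ N N                         ≈⟨ *-identityˡ _ ⟨
      1# * blockValue 1 y χ N N                    ≈⟨ *-congʳ (b-0 _) ⟨
      b 0 ((N ∸ x) ×ᴷ 1#) * blockValue 1 y χ N N   ∎

  count-increasing : ∀ r N → Σᴿ (wordsOver (alphabet N) r) (λ θ → ⟦ increasing? θ ⟧) ≈ b r (N ×ᴷ 1#)
  count-increasing r N = trans (count-chains 0 0 (replicate r 0) N (steps r))
    (reflexive (≡.trans (value 0 r) (≡.cong (λ m → b m (N ×ᴷ 1#)) (ℕ.+-identityʳ r))))
    where
    steps : ∀ r → Steps 0 (replicate r 0)
    steps zero    = tt
    steps (suc r) = inj₁ ≡.refl , steps r
    value : ∀ k r → blockValue k 0 (replicate r 0) N N ≡ b (r ℕ.+ k) (N ×ᴷ 1#)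
    value k zero    = ≡.refl
    value k (suc r) = ≡.trans (value (suc k) r) (≡.cong (λ m → b m (N ×ᴷ 1#)) (ℕ.+-suc r k))

  -- Reads the weight binom(N, max μ) as the size of the packing class of μ over N letters, so that
  -- weighted sums over packed words become plain sums over words.
  count-packing : ∀ {p} (μ : PackedWord p) N →
    Σᴿ (wordsOver (alphabet N) p) (λ a → ⟦ packℕ a ≟ᵖ μ ⟧) ≈ b (maxᵖ μ) (N ×ᴷ 1#)
  count-packing {p} μ N = begin
    Σᴿ (wordsOver as p) (λ a → ⟦ packℕ a ≟ᵖ μ ⟧)      ≈⟨ ∑-cong (wordsOver as p) (λ a → *-identityʳ _) ⟨
    Σᴿ (wordsOver as p) (λ a → ⟦ packℕ a ≟ᵖ μ ⟧ * 1#) ≈⟨ ∑-reindex (λ a → packℕ a ≟ᵖ μ) increasing?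
      (wordsOver-unique as! p) (wordsOver-unique as! (maxᵖ μ)) (λ θ → act (toList θ) (letters μ)) inj ⇒ ⇐ (λ _ → 1#) ⟩
    Σᴿ (wordsOver as (maxᵖ μ)) (λ θ → ⟦ increasing? θ ⟧ * 1#) ≈⟨ ∑-cong (wordsOver as (maxᵖ μ)) (λ θ → *-identityʳ _) ⟩
    Σᴿ (wordsOver as (maxᵖ μ)) (λ θ → ⟦ increasing? θ ⟧)      ≈⟨ count-increasing (maxᵖ μ) N ⟩
    b (maxᵖ μ) (N ×ᴷ 1#) ∎
    where
    as = alphabet N
    as! : Unique as
    as! = Unique.map⁺ ℕ.suc-injective (Unique.upTo⁺ N)
    inj : ∀ {θ θ′ : Vec ℕ (maxᵖ μ)} → act (toList θ) (letters μ) ≡ act (toList θ′) (letters μ) → θ ≡ θ′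
    inj {θ} {θ′} e = ≡.trans (≡.sym (Vec.cast-is-id ≡.refl θ)) (Vec.toList-injective ≡.refl θ θ′
      (act-injective μ (Vec.length-toList θ) (Vec.length-toList θ′) e))
    ⇒ : ∀ {a} → a ∈ˡ wordsOver as p → packℕ a ≡ μ →
      ∃[ θ ] θ ∈ˡ wordsOver as (maxᵖ μ) × Increasing θ × a ≡ act (toList θ) (letters μ)
    ⇒ {a} a∈ e = values μ a e , ∈-wordsOver (values μ a e) letter ,
      values-increasing μ a e (λ i → ∈-alphabet⇒positive (∈-wordsOver⁻ a∈ (VecMem.∈-lookup i a))) , act-values μ a e
      where
      letter : ∀ {d} → d ∈ values μ a e → d ∈ˡ as
      letter d∈ = ≡.subst (_∈ˡ as)
        (≡.sym (≡.trans (VecAny.lookup-index d∈) (Vec.lookup∘tabulate _ (VecAny.index d∈))))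
        (∈-wordsOver⁻ a∈ (VecMem.∈-lookup _ a))
    ⇐ : ∀ {θ} → θ ∈ˡ wordsOver as (maxᵖ μ) → Increasing θ →
      act (toList θ) (letters μ) ∈ˡ wordsOver as p × packℕ (act (toList θ) (letters μ)) ≡ μ
    ⇐ {θ} θ∈ inc = ∈-wordsOver _ (λ d∈ → ∈-wordsOver⁻ θ∈ (to (∈-act μ θ) d∈)) , packℕ-act μ θ inc

  -- Double counting: the words over N letters are grouped by their packing, on which alone the
  -- chain condition depends.
  packed-chains : ∀ {p} (χ : Vec ℕ p) → Steps 0 χ → ∀ N →
    Σᴿ (packedWords p) (λ μ → ⟦ chain? 0 0 χ (letters μ) ⟧ * b (maxᵖ μ) (N ×ᴷ 1#)) ≈ blockValue 0 0 χ N N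
  packed-chains {p} χ st N = begin
    Σᴿ PW (λ μ → C μ * b (maxᵖ μ) (N ×ᴷ 1#))            ≈⟨ ∑-cong PW (λ μ → *-congˡ (count-packing μ N)) ⟨
    Σᴿ PW (λ μ → C μ * Σᴿ W (λ a → ⟦ packℕ a ≟ᵖ μ ⟧))   ≈⟨ ∑-cong PW (λ μ → *-∑ W _ _) ⟩
    Σᴿ PW (λ μ → Σᴿ W (λ a → C μ * ⟦ packℕ a ≟ᵖ μ ⟧))   ≈⟨ ∑-swap PW W _ ⟩
    Σᴿ W (λ a → Σᴿ PW (λ μ → C μ * ⟦ packℕ a ≟ᵖ μ ⟧))
      ≈⟨ ∑-cong W (λ a → ∑-cong PW (λ μ → *-comm _ _)) ⟩
    Σᴿ W (λ a → Σᴿ PW (λ μ → ⟦ packℕ a ≟ᵖ μ ⟧ * C μ))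
      ≈⟨ ∑-cong W (λ a → ∑-delta _≟ᵖ_ (packedWords-unique p) (∈-packedWords (packℕ a)) C) ⟩
    Σᴿ W (λ a → C (packℕ a))
      ≈⟨ ∑-cong∈ W (λ {a} a∈ → let
           iff = chain-packℕ (packℕ a) a ≡.refl (λ i → ∈-alphabet⇒positive (∈-wordsOver⁻ a∈ (VecMem.∈-lookup i a))) χ
         in ⟦⟧-⇔ (chain? 0 0 χ (letters (packℕ a))) (chain? 0 0 χ a) (from iff) (to iff)) ⟩
    Σᴿ W (λ a → ⟦ chain? 0 0 χ a ⟧)                     ≈⟨ count-chains 0 0 χ N st ⟩
    blockValue 0 0 χ N N                                ∎
    where
    PW = packedWords p
    W = wordsOver (alphabet N) p
    C : PackedWord p → Carrier
    C μ = ⟦ chain? 0 0 χ (letters μ) ⟧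

  -- The two polynomials take the same value at every natural number, so they have the same
  -- coefficients.
  packed-chains-coeff : ∀ {p} (χ : Vec ℕ p) → Steps 0 χ → ∀ j →
    Σᴿ (packedWords p) (λ μ → ⟦ chain? 0 0 χ (letters μ) ⟧ * e (maxᵖ μ) j) ≈ coeff (blockProduct 0 0 χ) j
  packed-chains-coeff {p} χ st j = begin
    Σᴿ PW (λ μ → C μ * e (maxᵖ μ) j)                   ≈⟨ ∑-cong PW (λ μ → coeff-scale (C μ) (binom (maxᵖ μ)) j) ⟨
    Σᴿ PW (λ μ → coeff (scale (C μ) (binom (maxᵖ μ))) j) ≈⟨ coeff-∑ PW _ j ⟨
    coeff (∑ R[t] PW (λ μ → scale (C μ) (binom (maxᵖ μ)))) j ≈⟨ eval-≈⇒≈ᵖ torsionFree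
      (∑ R[t] PW (λ μ → scale (C μ) (binom (maxᵖ μ)))) (blockProduct 0 0 χ) values≈ j ⟩
    coeff (blockProduct 0 0 χ) j                       ∎
    where
    PW = packedWords p
    C : PackedWord p → Carrier
    C μ = ⟦ chain? 0 0 χ (letters μ) ⟧
    values≈ : ∀ N → eval (∑ R[t] PW (λ μ → scale (C μ) (binom (maxᵖ μ)))) (N ×ᴷ 1#) ≈
      eval (blockProduct 0 0 χ) (N ×ᴷ 1#)
    values≈ N = begin
      eval (∑ R[t] PW (λ μ → scale (C μ) (binom (maxᵖ μ)))) (N ×ᴷ 1#)   ≈⟨ eval-∑ PW _ _ ⟩
      Σᴿ PW (λ μ → eval (scale (C μ) (binom (maxᵖ μ))) (N ×ᴷ 1#))      ≈⟨ ∑-cong PW (λ μ → eval-scale (C μ) (binom (maxᵖ μ)) (N ×ᴷ 1#)) ⟩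
      Σᴿ PW (λ μ → C μ * b (maxᵖ μ) (N ×ᴷ 1#))                         ≈⟨ packed-chains χ st N ⟩
      blockValue 0 0 χ N N                                             ≈⟨ eval-blockProduct 0 0 χ N ⟨
      eval (blockProduct 0 0 χ) (N ×ᴷ 1#)                              ∎

  -- For k ≥ 1, e k 1 = (-1)^{k-1} / k is the coefficient of xᵏ in log (1 + x).
  blockWeight : ∀ {p} → ℕ → ℕ → Vec ℕ p → Carrier
  blockWeight k s []      = e k 1
  blockWeight k s (y ∷ χ) with y ℕ.≟ s
  ... | yes _ = blockWeight (suc k) s χ
  ... | no _  = e k 1 * blockWeight 1 y χ

  weight : ∀ {p} → Vec ℕ p → Carrier
  weight []      = 1#
  weight (y ∷ χ) = blockWeight 1 y χ

  private
    shrink : ∀ {p s d} {χ : Vec ℕ p} → Steps (suc s) χ → d ℕ.+ s ≡ lastLetter (suc s) χ →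
      ∃[ d′ ] d ≡ suc d′ × d′ ℕ.+ suc s ≡ lastLetter (suc s) χ
    shrink {d = zero}  {χ} st eq = contradiction (Steps-≤last χ st) (ℕ.<-irrefl eq)
    shrink {d = suc d} st eq = d , ≡.refl , ≡.trans (ℕ.+-suc d _) eq

  -- χ opens d blocks, so with the current nonempty one there are d + 1 factors binom(t, k) with k ≥
  -- 1, each without constant term.
  blockProduct-below : ∀ {p} k s (χ : Vec ℕ p) → Steps s χ → ∀ d → d ℕ.+ s ≡ lastLetter s χ →
    ∀ {i} → i < suc d → coeff (blockProduct (suc k) s χ) i ≈ 0#
  blockProduct-below k s []      _         d eq {zero}  _ = e-suc-0 k
  blockProduct-below k s []      _         d eq {suc i} (s≤s i<d) =
    contradiction (≡.subst (i <_) (ℕ.+-cancelʳ-≡ s d 0 eq) i<d) λ ()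
  blockProduct-below k s (y ∷ χ) (y≡ , st) d eq i< with y ℕ.≟ s
  ... | yes ≡.refl = blockProduct-below (suc k) s χ st d eq i<
  blockProduct-below k s (y ∷ χ) (inj₁ y≡s , st)    d eq i< | no y≢s = contradiction y≡s y≢s
  blockProduct-below k s (y ∷ χ) (inj₂ ≡.refl , st) d eq i< | no _ with shrink st eq
  ... | d′ , ≡.refl , eq′ =
    coeff-*-below₁ (binom (suc k)) _ (e-suc-0 k) (blockProduct-below 0 y χ st d′ eq′) i<

  blockProduct-lowest : ∀ {p} k s (χ : Vec ℕ p) → Steps s χ → ∀ d → d ℕ.+ s ≡ lastLetter s χ →
    coeff (blockProduct (suc k) s χ) (suc d) ≈ blockWeight (suc k) s χ
  blockProduct-lowest k s []      _         d eq =
    reflexive (≡.cong (λ d → e (suc k) (suc d)) (ℕ.+-cancelʳ-≡ s d 0 eq))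
  blockProduct-lowest k s (y ∷ χ) (y≡ , st) d eq with y ℕ.≟ s
  ... | yes ≡.refl = blockProduct-lowest (suc k) s χ st d eq
  blockProduct-lowest k s (y ∷ χ) (inj₁ y≡s , st)    d eq | no y≢s = contradiction y≡s y≢s
  blockProduct-lowest k s (y ∷ χ) (inj₂ ≡.refl , st) d eq | no _ with shrink st eq
  ... | d′ , ≡.refl , eq′ = trans
    (coeff-*-lowest₁ (binom (suc k)) _ (suc d′) (e-suc-0 k) (blockProduct-below 0 y χ st d′ eq′))
    (*-congˡ (blockProduct-lowest 0 y χ st d′ eq′))

  -- max χ is the number of blocks, hence the lowest degree of the product; the choice of the index
  -- in `𝐊` makes its coordinates products over blocks.
  composition-weight : ∀ {p} (χ : Vec ℕ p) → χ ∈ˡ compositions p →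
    Σᴿ (packedWords p) (λ μ → ⟦ chain? 0 0 χ (letters μ) ⟧ * e (maxᵖ μ) (maxLetter χ)) ≈ weight χ
  composition-weight {p} χ χ∈ = trans (packed-chains-coeff χ (proj₁ (∈-compositions⁻ χ∈)) (maxLetter χ))
    (trans (reflexive (≡.cong (coeff (blockProduct 0 0 χ)) (max-composition χ∈))) (lowest χ χ∈))
    where
    lowest : ∀ {p} (χ : Vec ℕ p) → χ ∈ˡ compositions p → coeff (blockProduct 0 0 χ) (lastLetter 0 χ) ≈ weight χ
    lowest {zero}  []      _  = e-0-0
    lowest {suc p} (_ ∷ _) χ∈ with ∈-map⁻ (1 ∷_) χ∈
    ... | χ′ , χ′∈ , ≡.refl = go (lastLetter 1 χ′) ≡.refl
      where
      st = to (∈-stepsFrom χ′) χ′∈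
      go : ∀ l → l ≡ lastLetter 1 χ′ → coeff (binom 0 *ᵖ blockProduct 1 1 χ′) l ≈ blockWeight 1 1 χ′
      go zero    eq = contradiction (Steps-≤last χ′ st) (ℕ.<-irrefl eq)
      -- The factor `binom 0` of the empty block 0 enters only through its constant coefficient 1.
      go (suc d) eq = trans
        (coeff-*-lowest (binom 0) (blockProduct 1 1 χ′) (suc d) (blockProduct-below 0 1 χ′ st d eq′))
        (trans (*-cong e-0-0 (blockProduct-lowest 0 1 χ′ st d eq′)) (*-identityˡ _))
        where eq′ = ≡.trans (ℕ.+-comm d 1) eq

-- The substitution of log (1 + aᵢ) for aᵢ

module Substitution {c ℓ₁ ℓ₂} (F : HeytingField c ℓ₁ ℓ₂) (char0 : CharacteristicZero F) where
  open Goldberg F char0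
  open CommutativeRing commutativeRing hiding (zero)
  open Sums commutativeRing
  open Polynomials commutativeRing
  open Binomials F char0
  open Blocks F char0
  open import Relation.Binary.Reasoning.Setoid setoid
  open RingProperties ring using (+-cancelʳ)
  open SemiringMult semiring using (×1-homo-*) renaming (_×_ to _×ᴷ_)
  open SemiringSolver commutativeSemiring using (solve; _:+_; _:*_; _:=_; con)

  -- Formal series

  infix 4 _≐_

  _≐_ : Series → Series → Set ℓ₁
  f ≐ h = ∀ w → f w ≈ h w

  ⊛-[] : ∀ f h → (f ⊛ h) [] ≈ f [] * h []
  ⊛-[] f h = +-identityʳ _

  ⊛-∷ : ∀ f h a w → (f ⊛ h) (a ∷ w) ≈ f [] * h (a ∷ w) + ((f ∘ (a ∷_)) ⊛ h) w
  ⊛-∷ f h a w = reflexive (∑-upTo-suc (suc (length w)) _)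

  ⊛-cong : ∀ {f f′ h h′} → f ≐ f′ → h ≐ h′ → f ⊛ h ≐ f′ ⊛ h′
  ⊛-cong f≐ h≐ w = ∑-cong (upTo (suc (length w))) (λ i → *-cong (f≐ _) (h≐ _))

  ⊛-+ : ∀ f f′ h w → ((λ v → f v + f′ v) ⊛ h) w ≈ (f ⊛ h) w + (f′ ⊛ h) w
  ⊛-+ f f′ h w = trans (∑-cong (upTo (suc (length w))) (λ i → distribʳ _ _ _)) (∑-+ (upTo (suc (length w))) _ _)

  ⊛-scale : ∀ k f h w → ((λ v → k * f v) ⊛ h) w ≈ k * (f ⊛ h) w
  ⊛-scale k f h w = trans (∑-cong (upTo (suc (length w))) (λ i → *-assoc _ _ _)) (sym (*-∑ (upTo (suc (length w))) k _))

  ^-cong : ∀ {f f′} → f ≐ f′ → ∀ k → f ^ˢ k ≐ f′ ^ˢ k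
  ^-cong f≐ zero    w = refl
  ^-cong f≐ (suc k) w = ⊛-cong f≐ (^-cong f≐ k) w

  -- subst f substitutes log (1 + aᵢ) for aᵢ in f. In substFrom a k f w a block of
  -- letters a, of length k so far, is being read and may still grow into w.
  subst : Series → Series
  substFrom : ℕ → ℕ → Series → Series

  subst f []      = f []
  subst f (a ∷ w) = substFrom a 1 (f ∘ (a ∷_)) w

  substFrom a k f []      = e k 1 * f []
  substFrom a k f (d ∷ w) = ⟦ d ℕ.≟ a ⟧ * substFrom a (suc k) f w + e k 1 * subst f (d ∷ w)

  -- Only values of `f` at words in the letters of `w` enter. The relative form serves `subst-g`,
  -- where g is replaced by a partial product that agrees with it on words with bounded letters.
  substFrom-congᴬ : ∀ {Q : ℕ → Set} {f f′} → (∀ v → All Q v → f v ≈ f′ v) →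
    ∀ a k w → All Q w → substFrom a k f w ≈ substFrom a k f′ w
  substFrom-congᴬ f≐ a k []      _        = *-congˡ (f≐ [] [])
  substFrom-congᴬ f≐ a k (d ∷ w) (q ∷ qs) = +-cong (*-congˡ (substFrom-congᴬ f≐ a (suc k) w qs))
    (*-congˡ (substFrom-congᴬ (λ v qv → f≐ (d ∷ v) (q ∷ qv)) d 1 w qs))

  subst-congᴬ : ∀ {Q : ℕ → Set} {f f′} → (∀ v → All Q v → f v ≈ f′ v) → ∀ w → All Q w → subst f w ≈ subst f′ w
  subst-congᴬ f≐ []      _        = f≐ [] []
  subst-congᴬ f≐ (a ∷ w) (q ∷ qs) = substFrom-congᴬ (λ v qv → f≐ (a ∷ v) (q ∷ qv)) a 1 w qs

  substFrom-cong : ∀ {f f′} → f ≐ f′ → ∀ a k → substFrom a k f ≐ substFrom a k f′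
  substFrom-cong f≐ a k w = substFrom-congᴬ {Q = λ _ → ⊤} (λ v _ → f≐ v) a k w (All.universal (λ _ → tt) w)

  subst-cong : ∀ {f f′} → f ≐ f′ → subst f ≐ subst f′
  subst-cong f≐ w = subst-congᴬ {Q = λ _ → ⊤} (λ v _ → f≐ v) w (All.universal (λ _ → tt) w)

  substFrom-+ : ∀ f f′ a k w → substFrom a k (λ v → f v + f′ v) w ≈ substFrom a k f w + substFrom a k f′ w
  substFrom-+ f f′ a k []      = distribˡ _ _ _
  substFrom-+ f f′ a k (d ∷ w) = trans
    (+-cong (*-congˡ (substFrom-+ f f′ a (suc k) w)) (*-congˡ (substFrom-+ _ _ d 1 w)))
    (solve 6 (λ x y p q r s → x :* (p :+ q) :+ y :* (r :+ s) := (x :* p :+ y :* r) :+ (x :* q :+ y :* s))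
      refl _ _ _ _ _ _)

  subst-+ : ∀ f f′ w → subst (λ v → f v + f′ v) w ≈ subst f w + subst f′ w
  subst-+ f f′ []      = refl
  subst-+ f f′ (a ∷ w) = substFrom-+ _ _ a 1 w

  substFrom-scale : ∀ x f a k w → substFrom a k (λ v → x * f v) w ≈ x * substFrom a k f w
  substFrom-scale x f a k []      = x*yz≈y*xz _ _ _
  substFrom-scale x f a k (d ∷ w) = trans
    (+-cong (*-congˡ (substFrom-scale x f a (suc k) w)) (*-congˡ (substFrom-scale x _ d 1 w)))
    (solve 5 (λ x y z p q → y :* (x :* p) :+ z :* (x :* q) := x :* (y :* p :+ z :* q)) refl _ _ _ _ _)

  subst-scale : ∀ x f w → subst (λ v → x * f v) w ≈ x * subst f w
  subst-scale x f []      = refl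
  subst-scale x f (a ∷ w) = substFrom-scale x _ a 1 w

  substFrom-zero : ∀ {f} → (∀ w → f w ≈ 0#) → ∀ a k w → substFrom a k f w ≈ 0#
  substFrom-zero {f} f≈0 a k w = trans (substFrom-cong (λ v → trans (f≈0 v) (sym (zeroˡ (f v)))) a k w)
    (trans (substFrom-scale 0# f a k w) (zeroˡ _))

  subst-∑ : ∀ {b} {B : Set b} (xs : List B) (f : B → Series) w →
    subst (λ v → Σᴿ xs (λ x → f x v)) w ≈ Σᴿ xs (λ x → subst (f x) w)
  subst-∑ []       f []      = refl
  subst-∑ []       f (a ∷ w) = substFrom-zero (λ _ → refl) a 1 w
  subst-∑ (x ∷ xs) f w       = trans (subst-+ (f x) _ w) (+-congˡ (subst-∑ xs f w))

  -- A block cannot straddle a cut of w into two factors: substitution is multiplicative.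
  subst-⊛ : ∀ f h → subst (f ⊛ h) ≐ subst f ⊛ subst h
  substFrom-⊛ : ∀ f h a k → substFrom a k (f ⊛ h) ≐ substFrom a k f ⊛ subst h

  subst-⊛ f h []      = refl
  subst-⊛ f h (a ∷ w) = begin
    substFrom a 1 ((f ⊛ h) ∘ (a ∷_)) w
      ≈⟨ substFrom-cong (⊛-∷ f h a) a 1 w ⟩
    substFrom a 1 (λ v → f [] * h (a ∷ v) + ((f ∘ (a ∷_)) ⊛ h) v) w ≈⟨ substFrom-+ _ _ a 1 w ⟩
    substFrom a 1 (λ v → f [] * h (a ∷ v)) w + substFrom a 1 ((f ∘ (a ∷_)) ⊛ h) w
      ≈⟨ +-cong (substFrom-scale (f []) _ a 1 w) (substFrom-⊛ (f ∘ (a ∷_)) h a 1 w) ⟩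
    f [] * subst h (a ∷ w) + (substFrom a 1 (f ∘ (a ∷_)) ⊛ subst h) w ≈⟨ ⊛-∷ (subst f) (subst h) a w ⟨
    (subst f ⊛ subst h) (a ∷ w) ∎

  substFrom-⊛ f h a k []      = trans (*-congˡ (⊛-[] f h)) (trans (sym (*-assoc _ _ _)) (sym (⊛-[] (substFrom a k f) (subst h))))
  substFrom-⊛ f h a k (d ∷ w) = begin
    δ * substFrom a (suc k) (f ⊛ h) w + κ * subst (f ⊛ h) (d ∷ w)
      ≈⟨ +-cong (*-congˡ (substFrom-⊛ f h a (suc k) w))
           (*-congˡ (trans (subst-⊛ f h (d ∷ w)) (⊛-∷ (subst f) (subst h) d w))) ⟩
    δ * S + κ * (f [] * H + T)     ≈⟨ solve 6 (λ δ S κ f H T → δ :* S :+ κ :* (f :* H :+ T) :=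
                                         (κ :* f) :* H :+ (δ :* S :+ κ :* T)) refl δ S κ (f []) H T ⟩
    (κ * f []) * H + (δ * S + κ * T) ≈⟨ +-congˡ (trans (⊛-+ (λ v → δ * substFrom a (suc k) f v) (λ v → κ * subst f (d ∷ v)) (subst h) w)
      (+-cong (⊛-scale δ (substFrom a (suc k) f) (subst h) w) (⊛-scale κ (subst f ∘ (d ∷_)) (subst h) w))) ⟨
    (κ * f []) * H + ((substFrom a k f ∘ (d ∷_)) ⊛ subst h) w ≈⟨ ⊛-∷ (substFrom a k f) (subst h) d w ⟨
    (substFrom a k f ⊛ subst h) (d ∷ w) ∎
    where
    δ = ⟦ d ℕ.≟ a ⟧
    κ = e k 1
    S = (substFrom a (suc k) f ⊛ subst h) w
    T = ((subst f ∘ (d ∷_)) ⊛ subst h) w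
    H = subst h (d ∷ w)

  subst-1 : subst 1ˢ ≐ 1ˢ
  subst-1 []      = refl
  subst-1 (a ∷ w) = substFrom-zero (λ _ → refl) a 1 w

  subst-^ : ∀ f k → subst (f ^ˢ k) ≐ subst f ^ˢ k
  subst-^ f zero    w = subst-1 w
  subst-^ f (suc k) w = trans (subst-⊛ f (f ^ˢ k) w) (⊛-cong {subst f} (λ _ → refl) (subst-^ f k) w)

  -- exp (log (1 + x)) = 1 + x

  private
    -- The recursion of `substFrom` for an exponential series at n equal letters: k is the size of
    -- the open block and j the number of blocks opened so far, whence 1/j! at the end.
    p : ℕ → ℕ → ℕ → Carrier
    p k j zero    = e k 1 * 1/ j !
    p k j (suc n) = p (suc k) j n + e k 1 * p 1 (suc j) n

    -- q j n is the coefficient of xⁿ in ∑ᵣ log (1 + x)ʳ / (r + j)!.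
    q : ℕ → ℕ → Carrier
    q j zero    = 1/ j !
    q j (suc n) = p 1 (suc j) n

    -- The index i is the number of further letters that the open block takes.
    p-closed : ∀ k j n → p k j n ≈ Σᴿ (upTo (suc n)) (λ i → e (k ℕ.+ i) 1 * q j (n ∸ i))
    p-closed k j zero    = sym (trans (+-identityʳ _) (*-congʳ (reflexive (≡.cong (λ m → e m 1) (ℕ.+-identityʳ k)))))
    p-closed k j (suc n) = begin
      p (suc k) j n + e k 1 * q j (suc n)      ≈⟨ +-comm _ _ ⟩
      e k 1 * q j (suc n) + p (suc k) j n      ≈⟨ +-congˡ (p-closed (suc k) j n) ⟩
      e k 1 * q j (suc n) + Σᴿ (upTo (suc n)) (λ i → e (suc k ℕ.+ i) 1 * q j (n ∸ i))
        ≈⟨ +-cong (*-congʳ (reflexive (≡.cong (λ m → e m 1) (≡.sym (ℕ.+-identityʳ k)))))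
             (∑-cong (upTo (suc n)) (λ i → *-congʳ (reflexive (≡.cong (λ m → e m 1) (≡.sym (ℕ.+-suc k i)))))) ⟩
      e (k ℕ.+ 0) 1 * q j (suc n) + Σᴿ (upTo (suc n)) (λ i → e (k ℕ.+ suc i) 1 * q j (n ∸ i))
        ≡⟨ ∑-upTo-suc (suc n) _ ⟨
      Σᴿ (upTo (suc (suc n))) (λ i → e (k ℕ.+ i) 1 * q j (suc n ∸ i)) ∎

    -- The factor r!/(r + j)!, which turns E_r = log (1 + x)ʳ / r! into log (1 + x)ʳ / (r + j)!.
    κ : ℕ → ℕ → Carrier
    κ r j = ((r !) ×ᴷ 1#) * 1/ r ℕ.+ j !

    κ-suc : ∀ r j → (suc r ×ᴷ 1#) * κ r (suc j) ≈ κ (suc r) j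
    κ-suc r j = trans (sym (*-assoc _ _ _)) (*-cong (sym (×1-homo-* (suc r) (r !)))
      (reflexive (≡.cong 1/_! (ℕ.+-suc r j))))

    -- Splitting off the first block multiplies by E_1, and E_1 E_r = (r + 1) E_{r+1}
    -- (`convolution-1`) raises r by one. As `e n r` vanishes for r > n, a bound above n loses no
    -- term.
    q-closed : ∀ B j n → n < B → q j n ≈ Σᴿ (upTo B) (λ r → e n r * κ r j)
    q-closed (suc B) j zero    _         = sym (begin
      Σᴿ (upTo (suc B)) (λ r → e 0 r * κ r j)                    ≡⟨ ∑-upTo-suc B _ ⟩
      e 0 0 * κ 0 j + Σᴿ (upTo B) (λ r → e 0 (suc r) * κ (suc r) j)
        ≈⟨ +-cong (trans (*-congʳ e-0-0) (*-identityˡ _)) (∑-zero (upTo B) (λ _ → zeroˡ _)) ⟩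
      κ 0 j + 0#                                                 ≈⟨ +-identityʳ _ ⟩
      (1# + 0#) * 1/ j !                                         ≈⟨ *-congʳ (+-identityʳ 1#) ⟩
      1# * 1/ j !                                                ≈⟨ *-identityˡ _ ⟩
      1/ j !                                                     ∎)
    q-closed (suc B) j (suc n) (s≤s n<B) = begin
      p 1 (suc j) n                                                     ≈⟨ p-closed 1 (suc j) n ⟩
      Σᴿ I (λ i → e (suc i) 1 * q (suc j) (n ∸ i))
        ≈⟨ ∑-cong I (λ i → *-congˡ (q-closed B (suc j) (n ∸ i) (ℕ.≤-<-trans (ℕ.m∸n≤m n i) n<B))) ⟩
      Σᴿ I (λ i → e (suc i) 1 * Σᴿ (upTo B) (λ r → e (n ∸ i) r * κ r (suc j)))
        ≈⟨ ∑-cong I (λ i → trans (*-∑ (upTo B) _ _) (∑-cong (upTo B) (λ r → sym (*-assoc _ _ _)))) ⟩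
      Σᴿ I (λ i → Σᴿ (upTo B) (λ r → (e (suc i) 1 * e (n ∸ i) r) * κ r (suc j))) ≈⟨ ∑-swap I (upTo B) _ ⟩
      Σᴿ (upTo B) (λ r → Σᴿ I (λ i → (e (suc i) 1 * e (n ∸ i) r) * κ r (suc j)))
        ≈⟨ ∑-cong (upTo B) (λ r → trans (sym (∑-* I _ _)) (*-congʳ (row r))) ⟩
      Σᴿ (upTo B) (λ r → ((suc r ×ᴷ 1#) * e (suc n) (suc r)) * κ r (suc j))
        ≈⟨ ∑-cong (upTo B) (λ r → trans (*-congʳ (*-comm _ _)) (trans (*-assoc _ _ _) (*-congˡ (κ-suc r j)))) ⟩
      Σᴿ (upTo B) (λ r → e (suc n) (suc r) * κ (suc r) j)               ≈⟨ +-identityˡ _ ⟨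
      0# + Σᴿ (upTo B) (λ r → e (suc n) (suc r) * κ (suc r) j)
        ≈⟨ +-congʳ (trans (*-congʳ (e-suc-0 n)) (zeroˡ _)) ⟨
      e (suc n) 0 * κ 0 j + Σᴿ (upTo B) (λ r → e (suc n) (suc r) * κ (suc r) j) ≡⟨ ∑-upTo-suc B _ ⟨
      Σᴿ (upTo (suc B)) (λ r → e (suc n) r * κ r j)                     ∎
      where
      I = upTo (suc n)
      row : ∀ r → Σᴿ I (λ i → e (suc i) 1 * e (n ∸ i) r) ≈ (suc r ×ᴷ 1#) * e (suc n) (suc r)
      row r = begin
        Σᴿ I (λ i → e (suc i) 1 * e (n ∸ i) r)                            ≈⟨ +-identityˡ _ ⟨
        0# + Σᴿ I (λ i → e (suc i) 1 * e (n ∸ i) r)                       ≈⟨ +-congʳ (zeroˡ _) ⟨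
        e 0 1 * e (suc n) r + Σᴿ I (λ i → e (suc i) 1 * e (n ∸ i) r)      ≡⟨ ∑-upTo-suc (suc n) _ ⟨
        convolution 1 r (suc n)                                          ≈⟨ convolution-1 r (suc n) ⟩
        (suc r ×ᴷ 1#) * e (suc n) (suc r)                                 ∎

    -- The value at 1 is the sum of the coefficients. The argument has the form to which `b-pascal`
    -- applies at 0.
    eval-1 : ∀ P B → (∀ r → B ≤ r → coeff P r ≈ 0#) → eval P (1# + 0#) ≈ Σᴿ (upTo B) (coeff P)
    eval-1 P       zero    P≈0 = eval-zero P _ (λ r → P≈0 r z≤n)
    eval-1 []      (suc B) P≈0 = sym (∑-zero (upTo (suc B)) (λ _ → refl))
    eval-1 (a ∷ P) (suc B) P≈0 = begin
      a + (1# + 0#) * eval P (1# + 0#)    ≈⟨ +-congˡ (trans (*-congʳ (+-identityʳ 1#)) (*-identityˡ _)) ⟩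
      a + eval P (1# + 0#)                ≈⟨ +-congˡ (eval-1 P B (λ r B≤r → P≈0 (suc r) (s≤s B≤r))) ⟩
      a + Σᴿ (upTo B) (coeff P)           ≡⟨ ∑-upTo-suc B (coeff (a ∷ P)) ⟨
      Σᴿ (upTo (suc B)) (coeff (a ∷ P))   ∎

    -- For j = 0 the factors κ are 1, and the sum of the coefficients of binom(t, n + 1) is binom(1,
    -- n + 1), which Pascal's rule reduces to binom(0, n).
    q-0-suc : ∀ n → q 0 (suc n) ≈ b n 0#
    q-0-suc n = begin
      q 0 (suc n)                                           ≈⟨ q-closed (suc (suc n)) 0 (suc n) ℕ.≤-refl ⟩
      Σᴿ (upTo (suc (suc n))) (λ r → e (suc n) r * κ r 0)   ≈⟨ ∑-cong (upTo (suc (suc n))) (λ r →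
        trans (*-congˡ (trans (*-congˡ (reflexive (≡.cong 1/_! (ℕ.+-identityʳ r)))) (!-inverse r))) (*-identityʳ _)) ⟩
      Σᴿ (upTo (suc (suc n))) (e (suc n))                   ≈⟨ eval-1 (binom (suc n)) (suc (suc n)) (λ r → e-vanish) ⟨
      b (suc n) (1# + 0#)                                   ≈⟨ b-pascal n 0# ⟩
      b (suc n) 0# + b n 0#                                 ≈⟨ +-congʳ (b-suc-0 n) ⟩
      0# + b n 0#                                           ≈⟨ +-identityˡ _ ⟩
      b n 0#                                                ∎

    all? : ∀ a w → Dec (All (a ≡_) w)
    all? a = All.all? (a ℕ.≟_)

    -- The coefficient of `exp a` at `w` preceded by j letters `a`. Unlike `exp` alone, this family
    -- is closed under reading a letter, as the induction along `substFrom` requires.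
    expShift : ℕ → ℕ → Series
    expShift a j w = ⟦ all? a w ⟧ * 1/ length w ℕ.+ j !

    exp≐expShift : ∀ a → exp a ≐ expShift a 0
    exp≐expShift a w with does (all? a w)
    ... | true  = trans (reflexive (≡.cong 1/_! (≡.sym (ℕ.+-identityʳ (length w))))) (sym (*-identityˡ _))
    ... | false = sym (zeroˡ _)

    all-∷ : ∀ a w → ⟦ all? a (a ∷ w) ⟧ ≈ ⟦ all? a w ⟧
    all-∷ a w = ⟦⟧-⇔ (all? a (a ∷ w)) (all? a w) (λ { (_ ∷ h) → h }) (≡.refl ∷_)

    all-≢ : ∀ {a d} w → d ≢ a → ⟦ all? a (d ∷ w) ⟧ ≈ 0#
    all-≢ {a} {d} w d≢a = ⟦⟧-no (all? a (d ∷ w)) (λ { (a≡d ∷ _) → d≢a (≡.sym a≡d) })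

    expShift-∷ : ∀ a j w → expShift a j (a ∷ w) ≈ expShift a (suc j) w
    expShift-∷ a j w = *-cong (all-∷ a w) (reflexive (≡.cong 1/_! (≡.sym (ℕ.+-suc (length w) j))))

    expShift-≢ : ∀ {a d} j → d ≢ a → ∀ w → expShift a j (d ∷ w) ≈ 0#
    expShift-≢ j d≢a w = trans (*-congʳ (all-≢ w d≢a)) (zeroˡ _)

    substFrom-expShift : ∀ a k j w → substFrom a k (expShift a j) w ≈ ⟦ all? a w ⟧ * p k j (length w)
    substFrom-expShift a k j []      = x*yz≈y*xz _ _ _
    substFrom-expShift a k j (d ∷ w) = cases (d ℕ.≟ a)
      where
      cases : Dec (d ≡ a) → substFrom a k (expShift a j) (d ∷ w) ≈ ⟦ all? a (d ∷ w) ⟧ * p k j (suc (length w))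
      cases (yes ≡.refl) = begin
        ⟦ a ℕ.≟ a ⟧ * substFrom a (suc k) (expShift a j) w + e k 1 * substFrom a 1 (expShift a j ∘ (a ∷_)) w
          ≈⟨ +-cong (trans (*-congʳ (⟦⟧-yes (a ℕ.≟ a) ≡.refl))
                       (trans (*-identityˡ _) (substFrom-expShift a (suc k) j w)))
               (*-congˡ (trans (substFrom-cong (expShift-∷ a j) a 1 w) (substFrom-expShift a 1 (suc j) w))) ⟩
        ⟦ all? a w ⟧ * p (suc k) j (length w) + e k 1 * (⟦ all? a w ⟧ * p 1 (suc j) (length w))
          ≈⟨ solve 4 (λ x y z t → x :* y :+ z :* (x :* t) := x :* (y :+ z :* t)) refl _ _ _ _ ⟩
        ⟦ all? a w ⟧ * p k j (suc (length w)) ≈⟨ *-congʳ (all-∷ a w) ⟨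
        ⟦ all? a (a ∷ w) ⟧ * p k j (suc (length w)) ∎
      cases (no d≢a) = begin
        ⟦ d ℕ.≟ a ⟧ * substFrom a (suc k) (expShift a j) w + e k 1 * substFrom d 1 (expShift a j ∘ (d ∷_)) w
          ≈⟨ +-cong (trans (*-congʳ (⟦⟧-no (d ℕ.≟ a) d≢a)) (zeroˡ _))
               (trans (*-congˡ (substFrom-zero (expShift-≢ j d≢a) d 1 w)) (zeroʳ _)) ⟩
        0# + 0#                                        ≈⟨ +-identityˡ _ ⟩
        0#                                             ≈⟨ zeroˡ _ ⟨
        0# * p k j (suc (length w))                    ≈⟨ *-congʳ (all-≢ w d≢a) ⟨
        ⟦ all? a (d ∷ w) ⟧ * p k j (suc (length w))    ∎

  -- The substituted series (1 + a₁)(1 + a₂)⋯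

  1+letter : ℕ → Series
  1+letter a []          = 1#
  1+letter a (d ∷ [])    = ⟦ d ℕ.≟ a ⟧
  1+letter a (_ ∷ _ ∷ _) = 0#

  1+letter-≢ : ∀ {a d} w → d ≢ a → 1+letter a (d ∷ w) ≈ 0#
  1+letter-≢ {a} {d} []      d≢a = ⟦⟧-no (d ℕ.≟ a) d≢a
  1+letter-≢         (_ ∷ _) d≢a = refl

  subst-exp : ∀ a → subst (exp a) ≐ 1+letter a
  subst-exp a w = trans (subst-cong (exp≐expShift a) w) (go w)
    where
    go : subst (expShift a 0) ≐ 1+letter a
    go []      = trans (*-identityˡ _) 1/0!≈1
    go (d ∷ w) = first w (d ℕ.≟ a)
      where
      first : ∀ w → Dec (d ≡ a) → substFrom d 1 (expShift a 0 ∘ (d ∷_)) w ≈ 1+letter a (d ∷ w)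
      first w (no d≢a)     = trans (substFrom-zero (expShift-≢ 0 d≢a) d 1 w) (sym (1+letter-≢ w d≢a))
      first w (yes ≡.refl) = trans (trans (substFrom-cong (expShift-∷ a 0) a 1 w) (substFrom-expShift a 1 1 w))
        (trans (*-congˡ (q-0-suc (length w))) (rest w))
        where
        rest : ∀ w → ⟦ all? a w ⟧ * b (length w) 0# ≈ 1+letter a (a ∷ w)
        rest []      = trans (*-identityˡ _) (trans (b-0 0#) (sym (⟦⟧-yes (a ℕ.≟ a) ≡.refl)))
        rest (_ ∷ w) = trans (*-congˡ (b-suc-0 (length w))) (zeroʳ _)

  -- The product of the factors 1 + aᵢ over i > l in increasing order; for l = 0 it is the series h.
  rising : ℕ → Series
  rising l []      = 1#
  rising l (a ∷ w) = ⟦ l ℕ.<? a ⟧ * rising a w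

  risingUpTo : ℕ → ℕ → Series
  risingUpTo m l []      = 1#
  risingUpTo m l (a ∷ w) = ⟦ (l ℕ.<? a) ×-dec (a ℕ.≤? m) ⟧ * risingUpTo m a w

  -- A letter up to m belongs to the left factor, while m + 1 can only come from the new factor and
  -- then ends the word.
  risingUpTo-⊛ : ∀ {m l} → l ≤ m → risingUpTo m l ⊛ 1+letter (suc m) ≐ risingUpTo (suc m) l
  risingUpTo-⊛ {m} {l} l≤m []      = trans (⊛-[] (risingUpTo m l) (1+letter (suc m))) (*-identityˡ 1#)
  risingUpTo-⊛ {m} {l} l≤m (a ∷ w) = begin
    (risingUpTo m l ⊛ 1+letter (suc m)) (a ∷ w)     ≈⟨ ⊛-∷ (risingUpTo m l) (1+letter (suc m)) a w ⟩
    1# * 1+letter (suc m) (a ∷ w) + ((λ v → ⟦ d ⟧ * risingUpTo m a v) ⊛ 1+letter (suc m)) w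
      ≈⟨ +-cong (*-identityˡ _) (⊛-scale ⟦ d ⟧ (risingUpTo m a) (1+letter (suc m)) w) ⟩
    1+letter (suc m) (a ∷ w) + ⟦ d ⟧ * (risingUpTo m a ⊛ 1+letter (suc m)) w ≈⟨ cases d ⟩
    ⟦ (l ℕ.<? a) ×-dec (a ℕ.≤? suc m) ⟧ * risingUpTo (suc m) a w ∎
    where
    d = (l ℕ.<? a) ×-dec (a ℕ.≤? m)
    d′ = (l ℕ.<? a) ×-dec (a ℕ.≤? suc m)
    top : ∀ w → 1+letter (suc m) (suc m ∷ w) ≈ risingUpTo (suc m) (suc m) w
    top []      = ⟦⟧-yes (suc m ℕ.≟ suc m) ≡.refl
    top (x ∷ w) = sym (trans (*-congʳ (⟦⟧-no ((suc m ℕ.<? x) ×-dec (x ℕ.≤? suc m))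
      (λ (m<x , x≤m) → ℕ.<⇒≱ m<x x≤m))) (zeroˡ _))
    cases : (d : Dec (l < a × a ≤ m)) → 1+letter (suc m) (a ∷ w) + ⟦ d ⟧ * (risingUpTo m a ⊛ 1+letter (suc m)) w ≈
      ⟦ d′ ⟧ * risingUpTo (suc m) a w
    cases (yes (l<a , a≤m)) = trans
      (+-cong (1+letter-≢ w (λ { ≡.refl → ℕ.1+n≰n a≤m })) (trans (*-identityˡ _) (risingUpTo-⊛ a≤m w)))
      (trans (+-identityˡ _) (sym (trans (*-congʳ (⟦⟧-yes d′ (l<a , ℕ.m≤n⇒m≤1+n a≤m))) (*-identityˡ _))))
    cases (no ¬d) = trans (+-congˡ (zeroˡ _)) (trans (+-identityʳ _) (cases′ (a ℕ.≟ suc m)))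
      where
      cases′ : Dec (a ≡ suc m) → 1+letter (suc m) (a ∷ w) ≈ ⟦ d′ ⟧ * risingUpTo (suc m) a w
      cases′ (yes ≡.refl) = trans (top w) (sym (trans (*-congʳ (⟦⟧-yes d′ (s≤s l≤m , ℕ.≤-refl))) (*-identityˡ _)))
      cases′ (no a≢)      = trans (1+letter-≢ w a≢) (sym (trans (*-congʳ (⟦⟧-no d′
        (λ (l<a , a≤) → ¬d (l<a , ℕ.≤-pred (ℕ.≤∧≢⇒< a≤ a≢))))) (zeroˡ _)))

  risingUpTo-0 : risingUpTo 0 0 ≐ 1ˢ
  risingUpTo-0 []      = refl
  risingUpTo-0 (a ∷ w) = trans (*-congʳ (⟦⟧-no ((0 ℕ.<? a) ×-dec (a ℕ.≤? 0)) (λ (0<a , a≤0) → ℕ.<⇒≱ 0<a a≤0))) (zeroˡ _)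

  risingUpTo-rising : ∀ {m} l w → All (_≤ m) w → risingUpTo m l w ≈ rising l w
  risingUpTo-rising         l []      _          = refl
  risingUpTo-rising {m} l (a ∷ w) (a≤m ∷ w≤m) = *-cong
    (⟦⟧-⇔ ((l ℕ.<? a) ×-dec (a ℕ.≤? m)) (l ℕ.<? a) proj₁ (_, a≤m)) (risingUpTo-rising a w w≤m)

  subst-expProduct : ∀ m → subst (expProduct m) ≐ risingUpTo m 0
  subst-expProduct zero    w = trans (subst-1 w) (sym (risingUpTo-0 w))
  subst-expProduct (suc m) w = begin
    subst (expProduct m ⊛ exp (suc m)) w          ≈⟨ subst-⊛ (expProduct m) (exp (suc m)) w ⟩
    (subst (expProduct m) ⊛ subst (exp (suc m))) w ≈⟨ ⊛-cong (subst-expProduct m) (subst-exp (suc m)) w ⟩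
    (risingUpTo m 0 ⊛ 1+letter (suc m)) w         ≈⟨ risingUpTo-⊛ z≤n w ⟩
    risingUpTo (suc m) 0 w                        ∎

  subst-g : subst g ≐ rising 0
  subst-g w = begin
    subst g w              ≈⟨ subst-congᴬ (λ v v≤m → sym (expProduct-stable m v (max≤v⁺ z≤n v≤m))) w w≤m ⟩
    subst (expProduct m) w ≈⟨ subst-expProduct m w ⟩
    risingUpTo m 0 w       ≈⟨ risingUpTo-rising 0 w w≤m ⟩
    rising 0 w             ∎
    where
    m = max 0 w
    w≤m : All (_≤ m) w
    w≤m = xs≤max 0 w

  -- This is h - 1; its k-th power counts the cuts of a word of positive letters into k nonempty
  -- strictly increasing blocks.
  rising⁺ : Series
  rising⁺ []      = 0#
  rising⁺ (a ∷ w) = rising 0 (a ∷ w)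

  subst-g-1 : subst (g -ˢ 1ˢ) ≐ rising⁺
  subst-g-1 w = +-cancelʳ (1ˢ w) _ _ (begin
    subst (g -ˢ 1ˢ) w + 1ˢ w              ≈⟨ +-congˡ (subst-1 w) ⟨
    subst (g -ˢ 1ˢ) w + subst 1ˢ w        ≈⟨ subst-+ (g -ˢ 1ˢ) 1ˢ w ⟨
    subst (λ v → (g v - 1ˢ v) + 1ˢ v) w   ≈⟨ subst-cong (λ v → trans (+-assoc _ _ _)
      (trans (+-congˡ (-‿inverseˡ _)) (+-identityʳ _))) w ⟩
    subst g w                             ≈⟨ subst-g w ⟩
    rising 0 w                            ≈⟨ split w ⟩
    rising⁺ w + 1ˢ w                      ∎)
    where
    split : ∀ w → rising 0 w ≈ rising⁺ w + 1ˢ w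
    split []      = sym (+-identityˡ _)
    split (a ∷ w) = sym (+-identityʳ _)

  -- The first of the k + 1 blocks is nonempty and begins with `d`; the rest of it must rise above
  -- `d`.
  rising⁺-suc : ∀ d w k → 0 < d → (rising⁺ ^ˢ suc k) (d ∷ w) ≈ (rising d ⊛ rising⁺ ^ˢ k) w
  rising⁺-suc d w k 0<d = begin
    (rising⁺ ⊛ rising⁺ ^ˢ k) (d ∷ w)         ≈⟨ ⊛-∷ rising⁺ (rising⁺ ^ˢ k) d w ⟩
    0# * (rising⁺ ^ˢ k) (d ∷ w) + ((λ v → ⟦ 0 ℕ.<? d ⟧ * rising d v) ⊛ rising⁺ ^ˢ k) w
      ≈⟨ +-cong (zeroˡ _) (trans (⊛-scale _ (rising d) (rising⁺ ^ˢ k) w)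
           (trans (*-congʳ (⟦⟧-yes (0 ℕ.<? d) 0<d)) (*-identityˡ _))) ⟩
    0# + (rising d ⊛ rising⁺ ^ˢ k) w         ≈⟨ +-identityˡ _ ⟩
    (rising d ⊛ rising⁺ ^ˢ k) w              ∎

  -- Both sides of the theorem as sums over compositions

  -- The letter `d` either prolongs the current block, which requires a < d, or opens block s + 1:
  -- in `⊛-∷` this is whether `rising a` or the first `rising⁺` receives it. Here k counts the newly
  -- opened blocks, and powers with k > n vanish, so the bound `B` can stay free.
  chains-from : ∀ {n} (β : ℕ → Carrier) s a (w : Vec ℕ n) → (∀ i → 0 < lookup w i) → ∀ B → n < B →
    Σᴿ (stepsFrom s n) (λ φ → ⟦ chain? s a φ w ⟧ * β (lastLetter s φ)) ≈
    Σᴿ (upTo B) (λ k → β (k ℕ.+ s) * (rising a ⊛ rising⁺ ^ˢ k) (toList w))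
  chains-from β s a [] _ (suc B) _ = begin
    1# * β s + 0#                     ≈⟨ trans (+-identityʳ _) (*-identityˡ _) ⟩
    β s                               ≈⟨ trans (+-identityʳ _) (*-identityʳ _) ⟨
    β s * 1# + 0#                     ≈⟨ +-cong (*-congˡ (trans (⊛-[] (rising a) 1ˢ) (*-identityˡ 1#)))
      (∑-zero (upTo B) (λ {k} _ → trans (*-congˡ (trans (⊛-[] (rising a) (rising⁺ ⊛ rising⁺ ^ˢ k))
        (trans (*-identityˡ _) (trans (⊛-[] rising⁺ (rising⁺ ^ˢ k)) (zeroˡ _))))) (zeroʳ _))) ⟨
    β s * (rising a ⊛ 1ˢ) [] + Σᴿ (upTo B) (λ k → β (suc k ℕ.+ s) * (rising a ⊛ rising⁺ ^ˢ suc k) [])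
                                      ≡⟨ ∑-upTo-suc B _ ⟨
    Σᴿ (upTo (suc B)) (λ k → β (k ℕ.+ s) * (rising a ⊛ rising⁺ ^ˢ k) []) ∎
  chains-from {suc n} β s a (d ∷ w) pos (suc B) (s≤s n<B) = begin
    Σᴿ (map (s ∷_) (stepsFrom s n) ++ map (suc s ∷_) (stepsFrom (suc s) n)) G
      ≈⟨ ∑-++ (map (s ∷_) (stepsFrom s n)) _ G ⟩
    Σᴿ (map (s ∷_) (stepsFrom s n)) G + Σᴿ (map (suc s ∷_) (stepsFrom (suc s) n)) G
      ≡⟨ ≡.cong₂ _+_ (∑-map (s ∷_) (stepsFrom s n) G) (∑-map (suc s ∷_) (stepsFrom (suc s) n) G) ⟩
    Σᴿ (stepsFrom s n) (λ φ → G (s ∷ φ)) + Σᴿ (stepsFrom (suc s) n) (λ φ → G (suc s ∷ φ)) ≈⟨ +-cong same next ⟩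
    Σᴿ (upTo (suc B)) (λ k → β (k ℕ.+ s) * (δ * (rising d ⊛ rising⁺ ^ˢ k) (toList w))) +
    Σᴿ (upTo (suc B)) (λ k → β (k ℕ.+ s) * (rising⁺ ^ˢ k) (d ∷ toList w))
      ≈⟨ +-comm _ _ ⟩
    _ ≈⟨ ∑-+ (upTo (suc B)) _ _ ⟨
    Σᴿ (upTo (suc B)) (λ k → β (k ℕ.+ s) * (rising⁺ ^ˢ k) (d ∷ toList w) +
      β (k ℕ.+ s) * (δ * (rising d ⊛ rising⁺ ^ˢ k) (toList w)))
      ≈⟨ ∑-cong (upTo (suc B)) (λ k → trans (*-congˡ (trans (⊛-∷ (rising a) (rising⁺ ^ˢ k) d (toList w))
           (+-cong (*-identityˡ _) (⊛-scale δ (rising d) (rising⁺ ^ˢ k) (toList w))))) (distribˡ _ _ _)) ⟨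
    Σᴿ (upTo (suc B)) (λ k → β (k ℕ.+ s) * (rising a ⊛ rising⁺ ^ˢ k) (d ∷ toList w)) ∎
    where
    G : Vec ℕ (suc n) → Carrier
    G φ = ⟦ chain? s a φ (d ∷ w) ⟧ * β (lastLetter s φ)
    δ = ⟦ a ℕ.<? d ⟧
    pos′ : ∀ i → 0 < lookup w i
    pos′ i = pos (Fin.suc i)
    same : Σᴿ (stepsFrom s n) (λ φ → G (s ∷ φ)) ≈
      Σᴿ (upTo (suc B)) (λ k → β (k ℕ.+ s) * (δ * (rising d ⊛ rising⁺ ^ˢ k) (toList w)))
    same = begin
      Σᴿ (stepsFrom s n) (λ φ → ⟦ lex? s a s d ×-dec chain? s d φ w ⟧ * β (lastLetter s φ))
        ≈⟨ ∑-cong (stepsFrom s n) (λ φ → trans (*-congʳ (trans (⟦⟧-× (lex? s a s d) (chain? s d φ w))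
             (*-congʳ (⟦⟧-⇔ (lex? s a s d) (a ℕ.<? d)
               (λ { (inj₁ lt) → contradiction lt (ℕ.<-irrefl ≡.refl) ; (inj₂ (_ , lt)) → lt })
               (λ lt → inj₂ (≡.refl , lt)))))) (*-assoc _ _ _)) ⟩
      Σᴿ (stepsFrom s n) (λ φ → δ * (⟦ chain? s d φ w ⟧ * β (lastLetter s φ))) ≈⟨ *-∑ (stepsFrom s n) δ _ ⟨
      δ * Σᴿ (stepsFrom s n) (λ φ → ⟦ chain? s d φ w ⟧ * β (lastLetter s φ))
        ≈⟨ *-congˡ (chains-from β s d w pos′ (suc B) (ℕ.m<n⇒m<1+n n<B)) ⟩
      δ * Σᴿ (upTo (suc B)) (λ k → β (k ℕ.+ s) * (rising d ⊛ rising⁺ ^ˢ k) (toList w)) ≈⟨ *-∑ (upTo (suc B)) δ _ ⟩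
      Σᴿ (upTo (suc B)) (λ k → δ * (β (k ℕ.+ s) * (rising d ⊛ rising⁺ ^ˢ k) (toList w)))
        ≈⟨ ∑-cong (upTo (suc B)) (λ k → x*yz≈y*xz _ _ _) ⟩
      Σᴿ (upTo (suc B)) (λ k → β (k ℕ.+ s) * (δ * (rising d ⊛ rising⁺ ^ˢ k) (toList w))) ∎
    next : Σᴿ (stepsFrom (suc s) n) (λ φ → G (suc s ∷ φ)) ≈
      Σᴿ (upTo (suc B)) (λ k → β (k ℕ.+ s) * (rising⁺ ^ˢ k) (d ∷ toList w))
    next = begin
      Σᴿ (stepsFrom (suc s) n) (λ φ → ⟦ lex? s a (suc s) d ×-dec chain? (suc s) d φ w ⟧ * β (lastLetter (suc s) φ))
        ≈⟨ ∑-cong (stepsFrom (suc s) n) (λ φ → *-congʳ (⟦⟧-⇔ (lex? s a (suc s) d ×-dec chain? (suc s) d φ w)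
             (chain? (suc s) d φ w) proj₂ (inj₁ (ℕ.n<1+n s) ,_))) ⟩
      Σᴿ (stepsFrom (suc s) n) (λ φ → ⟦ chain? (suc s) d φ w ⟧ * β (lastLetter (suc s) φ))
        ≈⟨ chains-from β (suc s) d w pos′ B n<B ⟩
      Σᴿ (upTo B) (λ k → β (k ℕ.+ suc s) * (rising d ⊛ rising⁺ ^ˢ k) (toList w))
        ≈⟨ ∑-cong (upTo B) (λ k → *-cong (reflexive (≡.cong β (ℕ.+-suc k s))) (sym (rising⁺-suc d (toList w) k (pos Fin.zero)))) ⟩
      Σᴿ (upTo B) (λ k → β (suc k ℕ.+ s) * (rising⁺ ^ˢ suc k) (d ∷ toList w)) ≈⟨ +-identityˡ _ ⟨
      0# + Σᴿ (upTo B) (λ k → β (suc k ℕ.+ s) * (rising⁺ ^ˢ suc k) (d ∷ toList w)) ≈⟨ +-congʳ (zeroʳ _) ⟨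
      β s * 0# + Σᴿ (upTo B) (λ k → β (suc k ℕ.+ s) * (rising⁺ ^ˢ suc k) (d ∷ toList w)) ≡⟨ ∑-upTo-suc B _ ⟨
      Σᴿ (upTo (suc B)) (λ k → β (k ℕ.+ s) * (rising⁺ ^ˢ k) (d ∷ toList w)) ∎

  -- Each unfolding of `substFrom` lets the next letter join the open block or start a new one, and
  -- χ records these choices; `same` and `next` are the two summands.
  substFrom-blocks : ∀ {n} a k s f (w : Vec ℕ n) → substFrom a k f (toList w) ≈
    Σᴿ (stepsFrom s n) (λ χ → ⟦ blockConstant? s a χ w ⟧ * (blockWeight k s χ * f (blockHeads s χ w)))
  substFrom-blocks a k s f []      = sym (trans (+-identityʳ _) (*-identityˡ _))
  substFrom-blocks {suc n} a k s f (d ∷ w) = sym (begin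
    Σᴿ (map (s ∷_) (stepsFrom s n) ++ map (suc s ∷_) (stepsFrom (suc s) n)) G
      ≈⟨ ∑-++ (map (s ∷_) (stepsFrom s n)) _ G ⟩
    Σᴿ (map (s ∷_) (stepsFrom s n)) G + Σᴿ (map (suc s ∷_) (stepsFrom (suc s) n)) G
      ≡⟨ ≡.cong₂ _+_ (∑-map (s ∷_) (stepsFrom s n) G) (∑-map (suc s ∷_) (stepsFrom (suc s) n) G) ⟩
    Σᴿ (stepsFrom s n) (λ χ → G (s ∷ χ)) + Σᴿ (stepsFrom (suc s) n) (λ χ → G (suc s ∷ χ)) ≈⟨ +-cong same next ⟩
    δ * substFrom a (suc k) f (toList w) + e k 1 * substFrom d 1 (f ∘ (d ∷_)) (toList w) ∎)
    where
    G : Vec ℕ (suc n) → Carrier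
    G χ = ⟦ blockConstant? s a χ (d ∷ w) ⟧ * (blockWeight k s χ * f (blockHeads s χ (d ∷ w)))
    δ = ⟦ d ℕ.≟ a ⟧
    same : Σᴿ (stepsFrom s n) (λ χ → G (s ∷ χ)) ≈ δ * substFrom a (suc k) f (toList w)
    same = begin
      Σᴿ (stepsFrom s n) (λ χ → G (s ∷ χ)) ≈⟨ ∑-cong (stepsFrom s n) term ⟩
      Σᴿ (stepsFrom s n) (λ χ → δ * (⟦ blockConstant? s a χ w ⟧ * (blockWeight (suc k) s χ * f (blockHeads s χ w))))
        ≈⟨ *-∑ (stepsFrom s n) δ _ ⟨
      δ * Σᴿ (stepsFrom s n) (λ χ → ⟦ blockConstant? s a χ w ⟧ * (blockWeight (suc k) s χ * f (blockHeads s χ w)))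
        ≈⟨ *-congˡ (substFrom-blocks a (suc k) s f w) ⟨
      δ * substFrom a (suc k) f (toList w) ∎
      where
      constant⇔ : ∀ χ → ⟦ blockConstant? s a (s ∷ χ) (d ∷ w) ⟧ ≈ δ * ⟦ blockConstant? s a χ w ⟧
      constant⇔ χ = trans
        (⟦⟧-⇔ (blockConstant? s a (s ∷ χ) (d ∷ w)) ((d ℕ.≟ a) ×-dec blockConstant? s a χ w)
          (λ (h , bc) → h ≡.refl , ≡.subst (λ x → BlockConstant s x χ w) (h ≡.refl) bc)
          (λ { (≡.refl , bc) → (λ _ → ≡.refl) , bc }))
        (⟦⟧-× (d ℕ.≟ a) (blockConstant? s a χ w))
      value : ∀ χ → blockWeight k s (s ∷ χ) * f (blockHeads s (s ∷ χ) (d ∷ w)) ≈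
        blockWeight (suc k) s χ * f (blockHeads s χ w)
      value χ with s ℕ.≟ s
      ... | yes _  = refl
      ... | no s≢s = contradiction ≡.refl s≢s
      term : ∀ χ → G (s ∷ χ) ≈ δ * (⟦ blockConstant? s a χ w ⟧ * (blockWeight (suc k) s χ * f (blockHeads s χ w)))
      term χ = trans (*-cong (constant⇔ χ) (value χ)) (*-assoc _ _ _)
    next : Σᴿ (stepsFrom (suc s) n) (λ χ → G (suc s ∷ χ)) ≈ e k 1 * substFrom d 1 (f ∘ (d ∷_)) (toList w)
    next = begin
      Σᴿ (stepsFrom (suc s) n) (λ χ → G (suc s ∷ χ)) ≈⟨ ∑-cong (stepsFrom (suc s) n) term ⟩
      Σᴿ (stepsFrom (suc s) n) (λ χ → e k 1 * (⟦ blockConstant? (suc s) d χ w ⟧ *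
        (blockWeight 1 (suc s) χ * f (d ∷ blockHeads (suc s) χ w)))) ≈⟨ *-∑ (stepsFrom (suc s) n) (e k 1) _ ⟨
      e k 1 * Σᴿ (stepsFrom (suc s) n) (λ χ → ⟦ blockConstant? (suc s) d χ w ⟧ *
        (blockWeight 1 (suc s) χ * f (d ∷ blockHeads (suc s) χ w)))
        ≈⟨ *-congˡ (substFrom-blocks d 1 (suc s) (f ∘ (d ∷_)) w) ⟨
      e k 1 * substFrom d 1 (f ∘ (d ∷_)) (toList w) ∎
      where
      value : ∀ χ → blockWeight k s (suc s ∷ χ) * f (blockHeads s (suc s ∷ χ) (d ∷ w)) ≈
        e k 1 * (blockWeight 1 (suc s) χ * f (d ∷ blockHeads (suc s) χ w))
      value χ with suc s ℕ.≟ s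
      ... | yes eq = contradiction eq ℕ.1+n≢n
      ... | no _   = *-assoc _ _ _
      term : ∀ χ → G (suc s ∷ χ) ≈ e k 1 * (⟦ blockConstant? (suc s) d χ w ⟧ *
        (blockWeight 1 (suc s) χ * f (d ∷ blockHeads (suc s) χ w)))
      term χ = trans (*-cong (⟦⟧-⇔ (blockConstant? s a (suc s ∷ χ) (d ∷ w)) (blockConstant? (suc s) d χ w)
        proj₂ ((λ eq → contradiction eq ℕ.1+n≢n) ,_)) (value χ)) (x*yz≈y*xz _ _ _)

  composition-chains : ∀ {n} (β : ℕ → Carrier) (w : Vec ℕ n) → (∀ i → 0 < lookup w i) →
    Σᴿ (compositions n) (λ φ → ⟦ chain? 0 0 φ w ⟧ * β (lastLetter 0 φ)) ≈
    Σᴿ (upTo (suc n)) (λ k → β k * (rising⁺ ^ˢ k) (toList w))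
  composition-chains β [] _ = +-congʳ (trans (*-identityˡ _) (sym (*-identityʳ _)))
  composition-chains {suc n} β (d ∷ w) pos = begin
    Σᴿ (map (1 ∷_) (stepsFrom 1 n)) (λ φ → ⟦ chain? 0 0 φ (d ∷ w) ⟧ * β (lastLetter 0 φ))
      ≡⟨ ∑-map (1 ∷_) (stepsFrom 1 n) _ ⟩
    Σᴿ (stepsFrom 1 n) (λ φ → ⟦ lex? 0 0 1 d ×-dec chain? 1 d φ w ⟧ * β (lastLetter 1 φ))
      ≈⟨ ∑-cong (stepsFrom 1 n) (λ φ → *-congʳ (⟦⟧-⇔ (lex? 0 0 1 d ×-dec chain? 1 d φ w)
           (chain? 1 d φ w) proj₂ (inj₁ (s≤s z≤n) ,_))) ⟩
    Σᴿ (stepsFrom 1 n) (λ φ → ⟦ chain? 1 d φ w ⟧ * β (lastLetter 1 φ))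
      ≈⟨ chains-from β 1 d w (λ i → pos (Fin.suc i)) (suc n) ℕ.≤-refl ⟩
    Σᴿ (upTo (suc n)) (λ k → β (k ℕ.+ 1) * (rising d ⊛ rising⁺ ^ˢ k) (toList w))
      ≈⟨ ∑-cong (upTo (suc n)) (λ k → *-cong (reflexive (≡.cong β (ℕ.+-comm k 1))) (sym (rising⁺-suc d (toList w) k (pos Fin.zero)))) ⟩
    Σᴿ (upTo (suc n)) (λ k → β (suc k) * (rising⁺ ^ˢ suc k) (d ∷ toList w)) ≈⟨ +-identityˡ _ ⟨
    -- The term for k = 0 is restored: the zeroth power vanishes at a nonempty word.
    0# + Σᴿ (upTo (suc n)) (λ k → β (suc k) * (rising⁺ ^ˢ suc k) (d ∷ toList w)) ≈⟨ +-congʳ (zeroʳ _) ⟨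
    β 0 * 0# + Σᴿ (upTo (suc n)) (λ k → β (suc k) * (rising⁺ ^ˢ suc k) (d ∷ toList w)) ≡⟨ ∑-upTo-suc (suc n) _ ⟨
    Σᴿ (upTo (suc (suc n))) (λ k → β k * (rising⁺ ^ˢ k) (d ∷ toList w)) ∎

  composition-subst : ∀ {n} f (w : Vec ℕ n) → subst f (toList w) ≈
    Σᴿ (compositions n) (λ χ → ⟦ blockConstant? 0 0 χ w ⟧ * (weight χ * f (blockHeads 0 χ w)))
  composition-subst f []      = sym (trans (+-identityʳ _) (trans (*-identityˡ _) (*-identityˡ _)))
  composition-subst {suc n} f (d ∷ w) = begin
    substFrom d 1 (f ∘ (d ∷_)) (toList w) ≈⟨ substFrom-blocks d 1 1 (f ∘ (d ∷_)) w ⟩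
    Σᴿ (stepsFrom 1 n) (λ χ → ⟦ blockConstant? 1 d χ w ⟧ * (blockWeight 1 1 χ * f (d ∷ blockHeads 1 χ w)))
      ≈⟨ ∑-cong (stepsFrom 1 n) (λ χ → *-congʳ (⟦⟧-⇔ (blockConstant? 1 d χ w)
           (blockConstant? 0 0 (1 ∷ χ) (d ∷ w)) ((λ ()) ,_) proj₂)) ⟩
    Σᴿ (stepsFrom 1 n) (λ χ → ⟦ blockConstant? 0 0 (1 ∷ χ) (d ∷ w) ⟧ *
      (weight (1 ∷ χ) * f (blockHeads 0 (1 ∷ χ) (d ∷ w))))
      ≡⟨ ∑-map (1 ∷_) (stepsFrom 1 n) _ ⟨
    Σᴿ (compositions (suc n)) (λ χ → ⟦ blockConstant? 0 0 χ (d ∷ w) ⟧ * (weight χ * f (blockHeads 0 χ (d ∷ w)))) ∎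

-- Comparison of the two sides at one coordinate

module Expansion {c ℓ₁ ℓ₂} (F : HeytingField c ℓ₁ ℓ₂) (char0 : CharacteristicZero F) where
  open Goldberg F char0
  open CommutativeRing commutativeRing hiding (zero)
  open Sums commutativeRing
  open Polynomials commutativeRing
  open Binomials F char0
  open Blocks F char0
  open Substitution F char0
  open import Relation.Binary.Reasoning.Setoid setoid

  ∑-upTo-extend : ∀ {m n} (f : ℕ → Carrier) → m ≤ n → (∀ k → m ≤ k → f k ≈ 0#) → Σᴿ (upTo m) f ≈ Σᴿ (upTo n) f
  ∑-upTo-extend {n = n} f z≤n       f≈0 = sym (∑-zero (upTo n) (λ {k} _ → f≈0 k z≤n))
  ∑-upTo-extend         f (s≤s {m} {n} m≤n) f≈0 = trans (reflexive (∑-upTo-suc m f))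
    (trans (+-congˡ (∑-upTo-extend (f ∘ suc) m≤n (λ k m≤k → f≈0 (suc k) (s≤s m≤k)))) (reflexive (≡.sym (∑-upTo-suc n f))))

  coeff-*-N : ∀ {n} p (u w : PackedWord n) j → coeff (p *ᵖ WQ[t].N u w) j ≈ coeff p j * ⟦ u ≟ᵖ w ⟧
  coeff-*-N p u w j = go (does (u ≟ᵖ w))
    where
    go : ∀ x → coeff (p *ᵖ (if x then constant 1# else [])) j ≈ coeff p j * (if x then 1# else 0#)
    go true  = coeff-*-constant p 1# j
    go false = trans (coeff-*-0 p j) (sym (zeroʳ _))

  -- The words that `w` refines are exactly the words χ ∘ w, with χ unique, so a condition that
  -- implies this refinement loses no terms.
  ∑-compose : ∀ {n} (w : PackedWord n) {P : PackedWord n → Set} (P? : ∀ x → Dec (P x)) → (∀ x → P x → WRef x w) →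
    (f : PackedWord n → Carrier) → Σᴿ (packedWords n) (λ x → ⟦ P? x ⟧ * f x) ≈
    Σᴿ (packedWords (maxᵖ w)) (λ χ → ⟦ P? (compose w χ) ⟧ * f (compose w χ))
  ∑-compose {n} w {P} P? P⇒ f = ∑-reindex P? (λ χ → P? (compose w χ))
    (packedWords-unique n) (packedWords-unique (maxᵖ w)) (compose w) (compose-injective w)
    (λ {x} _ px → let x≤w = P⇒ x px ; eq = compose-refinement x w x≤w in
      refinement x w x≤w , ∈-packedWords _ , ≡.subst P (≡.sym eq) px , ≡.sym eq)
    (λ _ q → ∈-packedWords _ , q) f

  ∑-nonDecreasing : ∀ {p} (f : Vec ℕ p → Carrier) →
    Σᴿ (packedWords p) (λ χ → ⟦ nonDecreasing? 0 (letters χ) ⟧ * f (letters χ)) ≈ Σᴿ (compositions p) f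
  ∑-nonDecreasing {p} f = trans
    (sym (∑-reindex (λ _ → yes tt) (λ χ → nonDecreasing? 0 (letters χ))
      (compositions-unique p) (packedWords-unique p) letters letters-injective
      (λ {φ} φ∈ _ → compositionWord φ∈ , ∈-packedWords _ ,
        Steps⇒NonDecreasing φ (proj₁ (∈-compositions⁻ φ∈)) , ≡.refl)
      (λ {χ} _ nd → ∈-compositions⁺ χ nd , tt) f))
    (∑-cong (compositions p) (λ φ → *-identityˡ _))

  U-coeff : ∀ {n} (v w : PackedWord n) j →
    coeff (U v w) j ≈ Σᴿ (packedWords n) (λ u → ⟦ packBiword u v ≟ᵖ w ⟧ * e (maxᵖ u) j)
  U-coeff {n} v w j = trans (coeff-∑ PW _ j) (∑-cong PW λ u → begin
    coeff (∑ R[t] PW (λ x → (binom (maxᵖ u) *ᵖ WQ[t].N v x) *ᵖ WQ[t].N (packBiword u x) w)) j ≈⟨ coeff-∑ PW _ j ⟩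
    Σᴿ PW (λ x → coeff ((binom (maxᵖ u) *ᵖ WQ[t].N v x) *ᵖ WQ[t].N (packBiword u x) w) j)
      ≈⟨ ∑-cong PW (λ x → trans (coeff-*-N (binom (maxᵖ u) *ᵖ WQ[t].N v x) (packBiword u x) w j)
           (trans (*-congʳ (trans (coeff-*-N (binom (maxᵖ u)) v x j) (*-comm _ _))) (*-assoc _ _ _))) ⟩
    Σᴿ PW (λ x → ⟦ v ≟ᵖ x ⟧ * (e (maxᵖ u) j * ⟦ packBiword u x ≟ᵖ w ⟧))
      ≈⟨ ∑-delta _≟ᵖ_ (packedWords-unique n) (∈-packedWords v) _ ⟩
    e (maxᵖ u) j * ⟦ packBiword u v ≟ᵖ w ⟧ ≈⟨ *-comm _ _ ⟩
    ⟦ packBiword u v ≟ᵖ w ⟧ * e (maxᵖ u) j ∎)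
    where PW = packedWords n

  𝐊-coordinate : ∀ {n} (x w : PackedWord n) →
    𝐊 x w ≈ Σᴿ (packedWords n) (λ u → ⟦ packBiword x u ≟ᵖ w ⟧ * e (maxᵖ u) (maxᵖ x))
  𝐊-coordinate {n} x w = begin
    Σᴿ PW (λ y → Σᴿ PW (λ u → (⟦ x ≟ᵖ y ⟧ * e (maxᵖ u) (maxᵖ x)) * ⟦ packBiword y u ≟ᵖ w ⟧))
      ≈⟨ ∑-cong PW (λ y → trans (∑-cong PW (λ u → *-assoc _ _ _)) (sym (*-∑ PW _ _))) ⟩
    Σᴿ PW (λ y → ⟦ x ≟ᵖ y ⟧ * Σᴿ PW (λ u → e (maxᵖ u) (maxᵖ x) * ⟦ packBiword y u ≟ᵖ w ⟧))
      ≈⟨ ∑-delta _≟ᵖ_ (packedWords-unique n) (∈-packedWords x) _ ⟩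
    Σᴿ PW (λ u → e (maxᵖ u) (maxᵖ x) * ⟦ packBiword x u ≟ᵖ w ⟧) ≈⟨ ∑-cong PW (λ u → *-comm _ _) ⟩
    Σᴿ PW (λ u → ⟦ packBiword x u ≟ᵖ w ⟧ * e (maxᵖ u) (maxᵖ x)) ∎
    where PW = packedWords n

  𝐊-zero : ∀ {n} (x w : PackedWord n) → ¬ WRef x w → 𝐊 x w ≈ 0#
  𝐊-zero {n} x w x≰w = trans (𝐊-coordinate x w) (∑-zero (packedWords n) (λ {u} _ → trans
    (*-congʳ (⟦⟧-no (packBiword x u ≟ᵖ w) (λ eq → x≰w (packBiword⇒WRefˡ x u w eq)))) (zeroˡ _)))

  𝐊-compose : ∀ {n} (w : PackedWord n) (χ : PackedWord (maxᵖ w)) → 𝐊 (compose w χ) w ≈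
    Σᴿ (packedWords (maxᵖ w)) (λ μ → ⟦ chain? 0 0 (letters χ) (letters μ) ⟧ * e (maxᵖ μ) (maxᵖ χ))
  𝐊-compose {n} w χ = begin
    𝐊 x w                                                                    ≈⟨ 𝐊-coordinate x w ⟩
    Σᴿ (packedWords n) (λ u → ⟦ packBiword x u ≟ᵖ w ⟧ * e (maxᵖ u) (maxᵖ x))
      ≈⟨ ∑-compose w (λ u → packBiword x u ≟ᵖ w) (λ u → packBiword⇒WRefʳ x u w) (λ u → e (maxᵖ u) (maxᵖ x)) ⟩
    Σᴿ (packedWords (maxᵖ w)) (λ μ → ⟦ packBiword x (compose w μ) ≟ᵖ w ⟧ * e (maxᵖ (compose w μ)) (maxᵖ x))
      ≈⟨ ∑-cong (packedWords (maxᵖ w)) (λ μ → *-cong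
           (⟦⟧-⇔ (packBiword x (compose w μ) ≟ᵖ w) (chain? 0 0 (letters χ) (letters μ))
             (pack⇒Chain w χ μ) (Chain⇒pack w χ μ))
           (reflexive (≡.cong₂ e (max-compose w μ) (max-compose w χ)))) ⟩
    Σᴿ (packedWords (maxᵖ w)) (λ μ → ⟦ chain? 0 0 (letters χ) (letters μ) ⟧ * e (maxᵖ μ) (maxᵖ χ)) ∎
    where x = compose w χ

  -- The number of terms of `gᵗ z` depends on z. A common bound makes the coefficient of t^j the
  -- value of one finite combination of powers of g - 1, to which `subst` applies linearly.
  goldberg-coeff : ∀ {m} z → length z ≤ m → ∀ j →
    coeff (gᵗ z) j ≈ Σᴿ (upTo (suc m)) (λ k → e k j * ((g -ˢ 1ˢ) ^ˢ k) z)
  goldberg-coeff {m} z z≤m j = begin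
    coeff (gᵗ z) j                                          ≈⟨ coeff-∑ (upTo (suc (length z))) (λ k → scale (((g -ˢ 1ˢ) ^ˢ k) z) (binom k)) j ⟩
    Σᴿ (upTo (suc (length z))) (λ k → coeff (scale (((g -ˢ 1ˢ) ^ˢ k) z) (binom k)) j)
      ≈⟨ ∑-cong (upTo (suc (length z))) (λ k → trans (coeff-scale (((g -ˢ 1ˢ) ^ˢ k) z) (binom k) j) (*-comm _ _)) ⟩
    Σᴿ (upTo (suc (length z))) (λ k → e k j * ((g -ˢ 1ˢ) ^ˢ k) z)
      ≈⟨ ∑-upTo-extend _ (s≤s z≤m) (λ k z<k → trans (*-congˡ (power-vanishes k z z<k)) (zeroʳ _)) ⟩
    Σᴿ (upTo (suc m)) (λ k → e k j * ((g -ˢ 1ˢ) ^ˢ k) z)    ∎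

  module _ {n} (w : PackedWord n) (ψ : PackedWord (maxᵖ w)) (j : ℕ) where
    private
      m = maxᵖ w
      v = compose w ψ

      right : PackedWord n → Carrier
      right x = coeff (goldberg (refinementWord v x)) j * 𝐊 x w

      truncated : Series
      truncated z = Σᴿ (upTo (suc m)) (λ k → e k j * ((g -ˢ 1ˢ) ^ˢ k) z)

      block : Vec ℕ m → Carrier
      block χ = ⟦ blockConstant? 0 0 χ (letters ψ) ⟧ * (weight χ * truncated (blockHeads 0 χ (letters ψ)))

    expansion-left : coeff (U v w) j ≈ Σᴿ (upTo (suc m)) (λ k → e k j * (rising⁺ ^ˢ k) (toList (letters ψ)))
    expansion-left = begin
      coeff (U v w) j                                                          ≈⟨ U-coeff v w j ⟩
      Σᴿ (packedWords n) (λ u → ⟦ packBiword u v ≟ᵖ w ⟧ * e (maxᵖ u) j)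
        ≈⟨ ∑-compose w (λ u → packBiword u v ≟ᵖ w) (λ u → packBiword⇒WRefˡ u v w) (λ u → e (maxᵖ u) j) ⟩
      Σᴿ (packedWords m) (λ φ → ⟦ packBiword (compose w φ) v ≟ᵖ w ⟧ * e (maxᵖ (compose w φ)) j)
        ≈⟨ ∑-cong (packedWords m) term ⟩
      Σᴿ (packedWords m) (λ φ → ⟦ nonDecreasing? 0 (letters φ) ⟧ * chains (letters φ)) ≈⟨ ∑-nonDecreasing chains ⟩
      Σᴿ (compositions m) chains
        ≈⟨ ∑-cong∈ (compositions m) (λ φ∈ → *-congˡ (reflexive (≡.cong (λ r → e r j) (max-composition φ∈)))) ⟩
      Σᴿ (compositions m) (λ φ → ⟦ chain? 0 0 φ (letters ψ) ⟧ * e (lastLetter 0 φ) j)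
        ≈⟨ composition-chains (λ r → e r j) (letters ψ) (packed-positive (packedProof ψ)) ⟩
      Σᴿ (upTo (suc m)) (λ k → e k j * (rising⁺ ^ˢ k) (toList (letters ψ)))    ∎
      where
      chains : Vec ℕ m → Carrier
      chains φ = ⟦ chain? 0 0 φ (letters ψ) ⟧ * e (maxLetter φ) j
      term : ∀ φ → ⟦ packBiword (compose w φ) v ≟ᵖ w ⟧ * e (maxᵖ (compose w φ)) j ≈
        ⟦ nonDecreasing? 0 (letters φ) ⟧ * chains (letters φ)
      term φ = trans (*-cong
        (⟦⟧-⇔ (packBiword (compose w φ) v ≟ᵖ w) (chain? 0 0 (letters φ) (letters ψ))
          (pack⇒Chain w φ ψ) (Chain⇒pack w φ ψ))
        (reflexive (≡.cong (λ r → e r j) (max-compose w φ)))) (absorb (nonDecreasing? 0 (letters φ)))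
        where
        absorb : (d : Dec (NonDecreasing 0 (letters φ))) → chains (letters φ) ≈ ⟦ d ⟧ * chains (letters φ)
        absorb (yes _)  = sym (*-identityˡ _)
        absorb (no ¬nd) = trans (trans (*-congʳ (⟦⟧-no (chain? 0 0 (letters φ) (letters ψ))
          (λ ch → ¬nd (Chain⇒NonDecreasing (letters φ) (letters ψ) ch)))) (zeroˡ _)) (sym (zeroˡ _))

    private
      right-term : ∀ χ → ⟦ wRef? v (compose w χ) ⟧ * right (compose w χ) ≈
        ⟦ nonDecreasing? 0 (letters χ) ⟧ * block (letters χ)
      right-term χ = cases (nonDecreasing? 0 (letters χ))
        where
        x = compose w χ
        cases : (d : Dec (NonDecreasing 0 (letters χ))) → ⟦ wRef? v x ⟧ * right x ≈ ⟦ d ⟧ * block (letters χ)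
        cases (yes nd) = begin
          ⟦ wRef? v x ⟧ * right x
            ≈⟨ *-congʳ (⟦⟧-⇔ (wRef? v x) (blockConstant? 0 0 (letters χ) (letters ψ))
                 (WRef⇒BlockConstant w ψ χ∈) (BlockConstant⇒WRef w ψ χ∈)) ⟩
          ⟦ blockConstant? 0 0 (letters χ) (letters ψ) ⟧ * right x
            -- The refinement word may be replaced by the block heads only where the indicator is 1.
            ≈⟨ ⟦⟧*-cong (blockConstant? 0 0 (letters χ) (letters ψ)) (λ bc → begin
                 coeff (gᵗ (toList (refinementWord v x))) j * 𝐊 x w
                   ≈⟨ *-cong (reflexive (≡.cong (λ z → coeff (gᵗ z) j) (refinementWord-blockHeads w ψ χ∈ bc)))
                        (trans (𝐊-compose w χ) (composition-weight (letters χ) χ∈)) ⟩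
                 coeff (gᵗ (blockHeads 0 (letters χ) (letters ψ))) j * weight (letters χ)
                   ≈⟨ *-congʳ (goldberg-coeff (blockHeads 0 (letters χ) (letters ψ))
                        (length-blockHeads-≤ 0 (letters χ) (letters ψ)) j) ⟩
                 truncated (blockHeads 0 (letters χ) (letters ψ)) * weight (letters χ) ≈⟨ *-comm _ _ ⟩
                 weight (letters χ) * truncated (blockHeads 0 (letters χ) (letters ψ)) ∎) ⟩
          block (letters χ)        ≈⟨ *-identityˡ _ ⟨
          1# * block (letters χ)   ∎
          where χ∈ = ∈-compositions⁺ χ nd
        cases (no ¬nd) = trans (*-congˡ (trans (*-congˡ 𝐊≈0) (zeroʳ _))) (trans (zeroʳ _) (sym (zeroˡ _)))
          where
          𝐊≈0 : 𝐊 x w ≈ 0#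
          𝐊≈0 = trans (𝐊-compose w χ) (∑-zero (packedWords m) (λ {μ} _ → trans
            (*-congʳ (⟦⟧-no (chain? 0 0 (letters χ) (letters μ))
              (λ ch → ¬nd (Chain⇒NonDecreasing (letters χ) (letters μ) ch)))) (zeroˡ _)))

    expansion-right : Σᴿ (packedWords n) (λ x → ⟦ wRef? v x ⟧ * right x) ≈
      Σᴿ (upTo (suc m)) (λ k → e k j * (rising⁺ ^ˢ k) (toList (letters ψ)))
    expansion-right = begin
      -- Only those x that `w` refines remain, since otherwise 𝐊 x has coordinate 0 at `w`; the sum
      -- can then run over χ with x = χ ∘ w.
      Σᴿ (packedWords n) (λ x → ⟦ wRef? v x ⟧ * right x) ≈⟨ ∑-cong (packedWords n) (λ x → restrict x (wRef? x w)) ⟩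
      Σᴿ (packedWords n) (λ x → ⟦ wRef? x w ⟧ * (⟦ wRef? v x ⟧ * right x))
        ≈⟨ ∑-compose w (λ x → wRef? x w) (λ _ → id) _ ⟩
      Σᴿ (packedWords m) (λ χ → ⟦ wRef? (compose w χ) w ⟧ * (⟦ wRef? v (compose w χ) ⟧ * right (compose w χ)))
        ≈⟨ ∑-cong (packedWords m) (λ χ → trans
             (*-congʳ (⟦⟧-yes (wRef? (compose w χ) w) (WRef-compose w χ))) (trans (*-identityˡ _) (right-term χ))) ⟩
      Σᴿ (packedWords m) (λ χ → ⟦ nonDecreasing? 0 (letters χ) ⟧ * block (letters χ)) ≈⟨ ∑-nonDecreasing block ⟩
      Σᴿ (compositions m) block                                              ≈⟨ composition-subst truncated (letters ψ) ⟨
      subst truncated (toList (letters ψ))                                   ≈⟨ subst-∑ (upTo (suc m)) (λ k z → e k j * ((g -ˢ 1ˢ) ^ˢ k) z) (toList (letters ψ)) ⟩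
      Σᴿ (upTo (suc m)) (λ k → subst (λ z → e k j * ((g -ˢ 1ˢ) ^ˢ k) z) (toList (letters ψ)))
        ≈⟨ ∑-cong (upTo (suc m)) (λ k → trans (subst-scale (e k j) ((g -ˢ 1ˢ) ^ˢ k) (toList (letters ψ)))
             (*-congˡ (trans (subst-^ (g -ˢ 1ˢ) k (toList (letters ψ))) (^-cong subst-g-1 k (toList (letters ψ)))))) ⟩
      Σᴿ (upTo (suc m)) (λ k → e k j * (rising⁺ ^ˢ k) (toList (letters ψ)))  ∎
      where
      restrict : ∀ x (d : Dec (WRef x w)) → ⟦ wRef? v x ⟧ * right x ≈ ⟦ d ⟧ * (⟦ wRef? v x ⟧ * right x)
      restrict x (yes _)  = sym (*-identityˡ _)
      restrict x (no x≰w) = trans (*-congˡ (trans (*-congˡ (𝐊-zero x w x≰w)) (zeroʳ _))) (trans (zeroʳ _) (sym (zeroˡ _)))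

  expansion : ∀ {n} (v w : PackedWord n) j → coeff (U v w) j ≈
    Σᴿ (packedWords n) (λ x → ⟦ wRef? v x ⟧ * (coeff (goldberg (refinementWord v x)) j * 𝐊 x w))
  expansion {n} v w j = cases (wRef? v w)
    where
    Expands : PackedWord n → Set ℓ₁
    Expands v = coeff (U v w) j ≈
      Σᴿ (packedWords n) (λ x → ⟦ wRef? v x ⟧ * (coeff (goldberg (refinementWord v x)) j * 𝐊 x w))
    cases : Dec (WRef v w) → Expands v
    cases (yes v≤w) = ≡.subst Expands (compose-refinement v w v≤w)
      (trans (expansion-left w ψ j) (sym (expansion-right w ψ j)))
      where ψ = refinement v w v≤w
    cases (no v≰w) = trans
      (trans (U-coeff v w j) (∑-zero (packedWords n) (λ {u} _ → trans
        (*-congʳ (⟦⟧-no (packBiword u v ≟ᵖ w) (λ eq → v≰w (packBiword⇒WRefʳ u v w eq)))) (zeroˡ _))))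
      (sym (∑-zero (packedWords n) (λ {x} _ → vanish x (wRef? v x))))
      where
      vanish : ∀ x (d : Dec (WRef v x)) → ⟦ d ⟧ * (coeff (goldberg (refinementWord v x)) j * 𝐊 x w) ≈ 0#
      -- By transitivity of weak refinement, `w` cannot refine such an x without refining `v`, so
      -- the coordinate of 𝐊 x at `w` is 0.
      vanish x (yes v≤x) = trans (*-identityˡ _) (trans
        (*-congˡ (𝐊-zero x w (λ x≤w → v≰w (λ i j → v≤x i j ∘ x≤w i j)))) (zeroʳ _))
      vanish x (no _)    = zeroˡ _

  expansion-in-𝐊 : ∀ {n} (v : PackedWord n) →
    U v ≋ ∑ʷ (wRefs v) (λ x → goldberg (refinementWord v x) • extend (𝐊 x))
  expansion-in-𝐊 {n} v w j = begin
    coeff (U v w) j                                                            ≈⟨ expansion v w j ⟩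
    Σᴿ (packedWords n) (λ x → ⟦ wRef? v x ⟧ * (coeff (goldberg (refinementWord v x)) j * 𝐊 x w))
      ≈⟨ ∑-filter (wRef? v) (packedWords n) _ ⟨
    Σᴿ (wRefs v) (λ x → coeff (goldberg (refinementWord v x)) j * 𝐊 x w)
      ≈⟨ ∑-cong (wRefs v) (λ x → coeff-*-constant (goldberg (refinementWord v x)) (𝐊 x w) j) ⟨
    Σᴿ (wRefs v) (λ x → coeff (goldberg (refinementWord v x) *ᵖ constant (𝐊 x w)) j) ≈⟨ coeff-∑ (wRefs v) _ j ⟨
    coeff (∑ R[t] (wRefs v) (λ x → goldberg (refinementWord v x) *ᵖ constant (𝐊 x w))) j ∎

mainTheorem6 : ∀ {c ℓ₁ ℓ₂} (F : HeytingField c ℓ₁ ℓ₂) (char0 : CharacteristicZero F) →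
    let open Goldberg F char0 in
    ∀ {n} (v : PackedWord n) →
    U v ≋ ∑ʷ (wRefs v) (λ x → goldberg (refinementWord v x) • extend (𝐊 x))
mainTheorem6 F char0 = Expansion.expansion-in-𝐊 F char0
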